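{- Let $k,l\ge 2$ be integers such that the pair $(k,l)$ admits a stability graph $F$ which is strict. Then there is $n_0$ such that every graph $G$ with $n=v(G)\ge n_0$, $\alpha(G)<l$, and $P(K_k,G)=f(n,k,l)$ contains an expansion of $F$ as a spanning subgraph (that is, with $V(F)=[m]$, there is a partition $V(G)=V_1\cup\dots\cup V_m$ with $E(F(\!(V_1,\dots,V_m)\!))\subseteq E(G)$).
   Context: All graphs are finite and simple. $v(G)$ is the order, $\alpha(G)$ the independence number of $G$, $\overline K_r$ the edgeless graph on $r$ vertices. $P(K_k,G)$ is the number of $k$-cliques in $G$ and $p(K_k,G)=P(K_k,G)/\binom{v(G)}{k}$. Define $$f(n,k,l)=\min\{P(K_k,G) : v(G)=n,\ \alpha(G)<l\},\qquad c_{k,l}=\lim_{n\to\infty}\frac{f(n,k,l)}{\binom{n}{k}}$$ (the limit is known to exist). Expansion: given a graph $F$ with vertex set $[m]=\{1,\dots,m\}$ and disjoint sets $V_1,\dots,V_m$, $F(\!(V_1,\dots,V_m)\!)$ is the graph on $V_1\cup\dots\cup V_m$ obtained by putting the complete graph on each $V_i$ and, for each edge $\{i,j\}\in E(F)$, the complete bipartite graph between $V_i$ and $V_j$ (and no other edges). Let $F$ be a graph with vertex set $[m]$ and $\alpha(F)<l$. $F$ is a stability graph for $(k,l)$ if for every $\varepsilon>0$ there are $n_0$ and $\delta>0$ such that for every graph $G$ with $n=v(G)\ge n_0$, $\alpha(G)<l$ and $p(K_k,G)\le c_{k,l}+\delta$ there is a partition $V(G)=V_1\cup\dots\cup V_m$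 with part sizes differing by at most $1$ and $$|E(F(\!(V_1,\dots,V_m)\!))\bigtriangleup E(G)|\le\varepsilon\binom n2.$$ A set $X\subseteq[m]$ is legal if $F-X$ (the subgraph of $F$ induced by $[m]\setminus X$) does not contain $\overline K_{l-1}$ as an induced subgraph. The gradient $\mathrm{grad}(X)$ is the probability, when $k-1$ independent uniformly distributed vertices $x_1,\dots,x_{k-1}\in[m]$ are picked, that all of them belong to $X$ and for every $i,j\in[k-1]$ the vertices $x_i$ and $x_j$ are adjacent in $F$ or equal. For $i\in[m]$, $\hat\Gamma_F(i)=\{i\}\cup\{j\in V(F): \{i,j\}\in E(F)\}$ is the closed neighbourhood of $i$. A stability graph $F$ is strict if $\mathrm{grad}(X)>c_{k,l}$ for every legal $X$ for which there is no $i\in[m]$ with $X=\hat\Gamma_F(i)$. -}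

module Defs where

import Data.Nat.Properties as ℕ
open import Data.Bool.Base using (Bool; true; false; T)
open import Data.Bool.Properties using (T?)
open import Data.Empty using (⊥)
open import Data.Fin.Base as Fin using (Fin)
import Data.Fin.Properties as Fin
open import Data.Fin.Subset using (Subset; inside; outside; _∈_; _∉_; ∣_∣; Empty)
open import Data.Fin.Subset.Properties using (_∈?_; Empty-unique; ∣⊥∣≡0)
open import Data.Integer.Base using (+_)
open import Data.List.Base
  using (List; []; _∷_; length; map; filter; allFin; cartesianProduct; cartesianProductWith)
open import Data.List.Extrema ℕ.≤-totalOrder using (argmin-sel)
open import Data.List.Extrema.Nat using (min; max; min≤v⁺; max≤v⁺)
open import Data.List.Membership.Propositional using () renaming (_∈_ to _∈ᴸ_)
open import Data.List.Membership.Propositional.Properties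
  using (∈-cartesianProductWith⁺; ∈-filter⁺; ∈-filter⁻; ∈-map⁺; ∈-map⁻)
open import Data.List.Properties using (filter-≐)
import Data.List.Relation.Unary.All as All
import Data.List.Relation.Unary.All.Properties as All
import Data.List.Relation.Unary.Any as Any
open Any using (here; there)
open import Data.Nat.Base as ℕ using (ℕ; zero; suc; _∸_; _^_)
open import Data.Nat.Combinatorics using (_C_)
open import Data.Product.Base using (Σ; ∃-syntax; _×_; _,_; proj₂)
open import Data.Rational.Base using (ℚ; 0ℚ; _/_; _+_; _*_; _≤_; _<_)
open import Data.Sum.Base as Sum using (_⊎_; inj₁; inj₂)
open import Data.Vec.Base using (Vec; []; _∷_; here; there; lookup; tabulate)
open import Data.Vec.Properties using (lookup∘tabulate)
open import Function.Base using (_∘_; id)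
open import Function.Bundles using (_⇔_; mk⇔; Equivalence)
open import Function.Definitions using (Injective)
open import Level using (Level; 0ℓ)
open import Relation.Binary.Core using (Rel)
open import Relation.Binary.Definitions
  using (Decidable; Symmetric; Irreflexive; tri<; tri≈; tri>)
open import Relation.Binary.PropositionalEquality
  using (_≡_; _≢_; refl; sym; trans; cong; subst; ≢-sym)
open import Relation.Nullary using (¬_; no; does; contradiction)
open import Relation.Nullary.Decidable
  using (_×-dec_; _⊎-dec_; _→-dec_; ¬?; isYes; toWitness; fromWitness; decidable-stable)
import Relation.Unary as U

private variable
  a p : Level
  A : Set a
  k l m n r : ℕ

count : {P : A → Set p} → U.Decidable P → List A → ℕ
count P? xs = length (filter P? xs)

-- Every vector with entries in xs, once for each choice of positions in xs.
vectors : List A → ∀ n → List (Vec A n)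
vectors xs zero    = [] ∷ []
vectors xs (suc n) = cartesianProductWith _∷_ xs (vectors xs n)

booleans : List Bool
booleans = true ∷ false ∷ []

subsets : ∀ n → List (Subset n)
subsets = vectors booleans

-- Division by zero gives 0.  Below this only affects the clique density of
-- graphs on fewer than k vertices and the gradient for m = 0.
infixl 7 _÷_
_÷_ : ℕ → ℕ → ℚ
i ÷ zero    = 0ℚ
i ÷ (suc j) = + i / suc j

fromℕ : ℕ → ℚ
fromℕ i = + i / 1

record Graph (n : ℕ) : Set₁ where
  infix 4 _~_ _~?_
  field
    _~_    : Rel (Fin n) 0ℓ
    ~-sym  : Symmetric _~_
    ~-irr  : Irreflexive _≡_ _~_
    _~?_   : Decidable _~_

open Graph public using () renaming (_~?_ to adj?)

infix 4 _~[_]_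
_~[_]_ : Fin n → Graph n → Fin n → Set
x ~[ G ] y = Graph._~_ G x y

edgeless : ∀ r → Graph r
edgeless r = record
  { _~_ = λ _ _ → ⊥ ; ~-sym = λ () ; ~-irr = λ _ () ; _~?_ = λ _ _ → no λ () }

complete : ∀ n → Graph n
complete n = record
  { _~_   = _≢_
  ; ~-sym = ≢-sym
  ; ~-irr = λ x≡y x≢y → x≢y x≡y
  ; _~?_  = λ x y → ¬? (x Fin.≟ y)
  }

IsClique : Graph n → Subset n → Set
IsClique G S = ∀ x y → x ∈ S → y ∈ S → x ≢ y → x ~[ G ] y

IsIndependent : Graph n → Subset n → Set
IsIndependent G S = ∀ x y → x ∈ S → y ∈ S → ¬ (x ~[ G ] y)

isClique? : (G : Graph n) → U.Decidable (IsClique G)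
isClique? G S = Fin.all? λ x → Fin.all? λ y →
  (x ∈? S) →-dec (y ∈? S) →-dec ¬? (x Fin.≟ y) →-dec adj? G x y

isIndependent? : (G : Graph n) → U.Decidable (IsIndependent G)
isIndependent? G S = Fin.all? λ x → Fin.all? λ y →
  (x ∈? S) →-dec (y ∈? S) →-dec ¬? (adj? G x y)

α : Graph n → ℕ
α {n} G = max 0 (map ∣_∣ (filter (isIndependent? G) (subsets n)))

IsKClique : ℕ → Graph n → Subset n → Set
IsKClique k G S = ∣ S ∣ ≡ k × IsClique G S

isKClique? : ∀ k (G : Graph n) → U.Decidable (IsKClique k G)
isKClique? k G S = (∣ S ∣ ℕ.≟ k) ×-dec isClique? G S

P : ℕ → Graph n → ℕ
P {n} k G = count (isKClique? k G) (subsets n)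

density : ℕ → Graph n → ℚ
density {n} k G = P k G ÷ (n C k)

-- Only the entries of the matrix above the diagonal are used.
ofMatrix : Vec (Vec Bool n) n → Graph n
ofMatrix M = record
  { _~_   = λ x y → Upper x y ⊎ Upper y x
  ; ~-sym = Sum.swap
  ; ~-irr = λ { refl (inj₁ (x<x , _)) → Fin.<-irrefl refl x<x
              ; refl (inj₂ (x<x , _)) → Fin.<-irrefl refl x<x }
  ; _~?_  = λ x y → upper? x y ⊎-dec upper? y x
  }
  where
  Upper : Rel (Fin _) 0ℓ
  Upper x y = x Fin.< y × T (lookup (lookup M x) y)

  upper? : Decidable Upper
  upper? x y = (x Fin.<? y) ×-dec T? (lookup (lookup M x) y)

graphs : ∀ n → List (Graph n)
graphs n = map ofMatrix (vectors (vectors booleans n) n)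

-- The complete graph is given separately to make the minimum total; it is one
-- of the competitors as soon as l ≥ 2 (see f-attained and f-minimal).
f : (n k l : ℕ) → ℕ
f n k l = min (P k (complete n)) (map (P k) (filter (λ G → α G ℕ.<? l) (graphs n)))

-- A real number is given by a rational sequence converging to it.  For
-- convergent s and t, s <lim t and s ≤lim t say lim s < lim t and lim s ≤ lim t.
Sequence : Set
Sequence = ℕ → ℚ

const : ℚ → Sequence
const q _ = q

infixl 6 _⊕_
_⊕_ : Sequence → Sequence → Sequence
(s ⊕ t) n = s n + t n

infix 4 _<lim_ _≤lim_

_<lim_ : Sequence → Sequence → Set
s <lim t = ∃[ η ] (0ℚ < η × ∃[ N ] (∀ n → N ℕ.≤ n → s n + η ≤ t n))

_≤lim_ : Sequence → Sequence → Set
s ≤lim t = ∀ η → 0ℚ < η → ∃[ N ] (∀ n → N ℕ.≤ n → s n ≤ t n + η)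

-- The number c_{k,l}: for l ≥ 2 this sequence is bounded, and by averaging over
-- vertex-deleted subgraphs it is nondecreasing, so it converges.
c : (k l : ℕ) → Sequence
c k l n = f n k l ÷ (n C k)

-- A partition of Fin n into parts indexed by Fin m is given by the function
-- sending each vertex to the index of its part; parts may be empty.
Partition : (n m : ℕ) → Set
Partition n m = Fin n → Fin m

partSize : Partition n m → Fin m → ℕ
partSize {n} V i = count (λ x → V x Fin.≟ i) (allFin n)

Balanced : Partition n m → Set
Balanced V = ∀ i j → partSize V i ℕ.≤ suc (partSize V j)

expansion : Graph m → Partition n m → Graph n
expansion F V = record
  { _~_   = λ x y → x ≢ y × (V x ≡ V y ⊎ V x ~[ F ] V y)
  ; ~-sym = λ (x≢y , e) → ≢-sym x≢y , Sum.map sym (Graph.~-sym F) e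
  ; ~-irr = λ x≡y (x≢y , _) → x≢y x≡y
  ; _~?_  = λ x y → ¬? (x Fin.≟ y) ×-dec ((V x Fin.≟ V y) ⊎-dec adj? F (V x) (V y))
  }

infix 4 _⊆ᴱ_
_⊆ᴱ_ : Graph n → Graph n → Set
G ⊆ᴱ H = ∀ x y → x ~[ G ] y → x ~[ H ] y

-- |E(G) △ E(H)|; each unordered pair is represented by (x , y) with x < y.
∣E_△E_∣ : Graph n → Graph n → ℕ
∣E_△E_∣ {n} G H = count differ? (cartesianProduct (allFin n) (allFin n))
  where
  Differ : Fin n × Fin n → Set
  Differ (x , y) = x Fin.< y ×
    ((x ~[ G ] y × ¬ (x ~[ H ] y)) ⊎ (x ~[ H ] y × ¬ (x ~[ G ] y)))

  differ? : U.Decidable Differ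
  differ? (x , y) = (x Fin.<? y) ×-dec
    ((adj? G x y ×-dec ¬? (adj? H x y)) ⊎-dec (adj? H x y ×-dec ¬? (adj? G x y)))

StabilityProperty : (k l : ℕ) → Graph m → Set₁
StabilityProperty {m} k l F =
  ∀ ε → 0ℚ < ε →
  ∃[ n₀ ] ∃[ δ ] (0ℚ < δ ×
    (∀ n → n₀ ℕ.≤ n → (G : Graph n) → α G ℕ.< l →
     const (density k G) ≤lim c k l ⊕ const δ →
     Σ (Partition n m) λ V →
       Balanced V ×
       fromℕ (∣E expansion F V △E G ∣) ≤ ε * fromℕ (n C 2)))

record IsStabilityGraph (k l : ℕ) (F : Graph m) : Set₁ where
  field
    α<l    : α F ℕ.< l
    stable : StabilityProperty k l F

-- φ embeds H as an induced subgraph of F - X.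
record InducedAvoiding (H : Graph r) (F : Graph m) (X : Subset m) : Set where
  field
    φ         : Fin r → Fin m
    injective : Injective _≡_ _≡_ φ
    avoids    : ∀ i → φ i ∉ X
    induced   : ∀ i j → (i ~[ H ] j) ⇔ (φ i ~[ F ] φ j)

Legal : (l : ℕ) → Graph m → Subset m → Set
Legal l F X = ¬ InducedAvoiding (edgeless (l ∸ 1)) F X

GoodTuple : Graph m → Subset m → Vec (Fin m) r → Set
GoodTuple F X xs =
  (∀ i → lookup xs i ∈ X) ×
  (∀ i j → lookup xs i ~[ F ] lookup xs j ⊎ lookup xs i ≡ lookup xs j)

goodTuple? : (F : Graph m) (X : Subset m) → U.Decidable (GoodTuple {r = r} F X)
goodTuple? F X xs =
  (Fin.all? λ i → lookup xs i ∈? X) ×-dec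
  (Fin.all? λ i → Fin.all? λ j →
    adj? F (lookup xs i) (lookup xs j) ⊎-dec (lookup xs i Fin.≟ lookup xs j))

grad : (k : ℕ) → Graph m → Subset m → ℚ
grad {m} k F X = count (goodTuple? F X) (vectors (allFin m) (k ∸ 1)) ÷ (m ^ (k ∸ 1))

closedNeighbourhood : Graph m → Fin m → Subset m
closedNeighbourhood F i = tabulate λ j → does ((j Fin.≟ i) ⊎-dec adj? F i j)

IsStrict : (k l : ℕ) → Graph m → Set
IsStrict {m} k l F =
  (X : Subset m) → Legal l F X →
  ¬ (∃[ i ] X ≡ closedNeighbourhood F i) →
  c k l <lim const (grad k F X)

∈-vectors : {xs : List A} → (∀ x → x ∈ᴸ xs) → (v : Vec A n) → v ∈ᴸ vectors xs n
∈-vectors all []      = here refl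
∈-vectors all (x ∷ v) = ∈-cartesianProductWith⁺ _∷_ (all x) (∈-vectors all v)

∈-booleans : ∀ b → b ∈ᴸ booleans
∈-booleans true  = here refl
∈-booleans false = there (here refl)

infix 4 _≈ᴳ_
_≈ᴳ_ : Graph n → Graph n → Set
G ≈ᴳ H = ∀ x y → (x ~[ G ] y) ⇔ (x ~[ H ] y)

P-cong : ∀ k {G H : Graph n} → G ≈ᴳ H → P k G ≡ P k H
P-cong {n} k {G} {H} G≈H =
  cong length (filter-≐ (isKClique? k G) (isKClique? k H) (to , from) (subsets n))
  where
  to : ∀ {S} → IsKClique k G S → IsKClique k H S
  to (size , cl) = size , λ x y x∈ y∈ x≢y → Equivalence.to (G≈H x y) (cl x y x∈ y∈ x≢y)

  from : ∀ {S} → IsKClique k H S → IsKClique k G S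
  from (size , cl) = size , λ x y x∈ y∈ x≢y → Equivalence.from (G≈H x y) (cl x y x∈ y∈ x≢y)

α-cong : {G H : Graph n} → G ≈ᴳ H → α G ≡ α H
α-cong {n} {G} {H} G≈H =
  cong (max 0 ∘ map ∣_∣) (filter-≐ (isIndependent? G) (isIndependent? H) (to , from) (subsets n))
  where
  to : ∀ {S} → IsIndependent G S → IsIndependent H S
  to ind x y x∈ y∈ x~y = ind x y x∈ y∈ (Equivalence.from (G≈H x y) x~y)

  from : ∀ {S} → IsIndependent H S → IsIndependent G S
  from ind x y x∈ y∈ x~y = ind x y x∈ y∈ (Equivalence.to (G≈H x y) x~y)

toMatrix : Graph n → Vec (Vec Bool n) n
toMatrix G = tabulate λ x → tabulate λ y → isYes (adj? G x y)

lookup-toMatrix : (G : Graph n) → ∀ x y →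
  lookup (lookup (toMatrix G) x) y ≡ isYes (adj? G x y)
lookup-toMatrix G x y = trans
  (cong (λ v → lookup v y) (lookup∘tabulate _ x))
  (lookup∘tabulate _ y)

ofMatrix-toMatrix : (G : Graph n) → ofMatrix (toMatrix G) ≈ᴳ G
ofMatrix-toMatrix G x y = mk⇔ to from
  where
  entry⁻ : ∀ {x y} → T (lookup (lookup (toMatrix G) x) y) → x ~[ G ] y
  entry⁻ {x} {y} t = toWitness {a? = adj? G x y} (subst T (lookup-toMatrix G x y) t)

  entry⁺ : ∀ {x y} → x ~[ G ] y → T (lookup (lookup (toMatrix G) x) y)
  entry⁺ {x} {y} x~y = subst T (sym (lookup-toMatrix G x y)) (fromWitness {a? = adj? G x y} x~y)

  to : x ~[ ofMatrix (toMatrix G) ] y → x ~[ G ] y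
  to (inj₁ (_ , t)) = entry⁻ t
  to (inj₂ (_ , t)) = Graph.~-sym G (entry⁻ t)

  from : x ~[ G ] y → x ~[ ofMatrix (toMatrix G) ] y
  from x~y with Fin.<-cmp x y
  ... | tri< x<y _ _ = inj₁ (x<y , entry⁺ x~y)
  ... | tri≈ _ x≡y _ = contradiction x~y (Graph.~-irr G x≡y)
  ... | tri> _ _ y<x = inj₂ (y<x , entry⁺ (Graph.~-sym G x~y))

f-minimal : ∀ n k l (G : Graph n) → α G ℕ.< l → f n k l ℕ.≤ P k G
f-minimal n k l G αG<l = subst (f n k l ℕ.≤_) (P-cong k {G = G′} {H = G} G′≈G)
  (min≤v⁺ _ _ (inj₂ (Any.map (ℕ.≤-reflexive ∘ sym) (∈-map⁺ (P k) G′∈))))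
  where
  G′ = ofMatrix (toMatrix G)

  G′≈G : G′ ≈ᴳ G
  G′≈G = ofMatrix-toMatrix G

  G′∈ : G′ ∈ᴸ filter (λ H → α H ℕ.<? l) (graphs n)
  G′∈ = ∈-filter⁺ (λ H → α H ℕ.<? l)
    (∈-map⁺ ofMatrix (∈-vectors (∈-vectors ∈-booleans) (toMatrix G)))
    (subst (ℕ._< l) (sym (α-cong {G = G′} {H = G} G′≈G)) αG<l)

atMostOne : (S : Subset n) → (∀ x y → x ∈ S → y ∈ S → x ≡ y) → ∣ S ∣ ℕ.≤ 1
atMostOne []            _  = ℕ.z≤n
atMostOne (outside ∷ S) eq =
  atMostOne S λ x y x∈ y∈ → Fin.suc-injective (eq _ _ (there x∈) (there y∈))
atMostOne {suc n} (inside ∷ S) eq =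
  ℕ.s≤s (ℕ.≤-reflexive (trans (cong ∣_∣ (Empty-unique empty)) (∣⊥∣≡0 n)))
  where
  empty : Empty S
  empty (x , x∈) with () ← eq _ _ here (there x∈)

α-complete : ∀ n → α (complete n) ℕ.≤ 1
α-complete n = max≤v⁺ ℕ.z≤n (All.map⁺ (All.map size
  (All.all-filter (isIndependent? (complete n)) (subsets n))))
  where
  size : ∀ {S} → IsIndependent (complete n) S → ∣ S ∣ ℕ.≤ 1
  size {S} ind = atMostOne S λ x y x∈ y∈ →
    decidable-stable (x Fin.≟ y) (ind x y x∈ y∈)

f-attained : ∀ n k l → 2 ℕ.≤ l → Σ (Graph n) λ G → α G ℕ.< l × P k G ≡ f n k l
f-attained n k l 2≤l with argmin-sel id (P k (complete n)) xs
  where xs = map (P k) (filter (λ G → α G ℕ.<? l) (graphs n))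
... | inj₁ f≡ = complete n , ℕ.≤-trans (ℕ.s≤s (α-complete n)) 2≤l , sym f≡
... | inj₂ f∈ with G , G∈ , f≡ ← ∈-map⁻ (P k) f∈ =
  G , proj₂ (∈-filter⁻ (λ H → α H ℕ.<? l) {xs = graphs n} G∈) , sym f≡

-- In an extremal G all vertices lie in nearly the same number of k-cliques,
-- since otherwise replacing one vertex by a clone of another would reduce
-- P k G.  Stability makes G close to an expansion of F.  For a vertex x, the set
-- X of parts almost completely joined to x is legal: an independent set of F
-- avoiding X would yield, together with x, an independent set of size l in G.
-- As x lies in about grad X of the possible k-cliques, strictness makes X a
-- closed neighbourhood of some i, and x has few neighbours in the parts outside
-- X, as these would create too many further cliques.  Now move x to the part i.
-- Let x and y belong to parts i and j that are equal or adjacent in F.  The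
-- closed neighbourhoods all have gradient c, so the neighbourhood of i with j
-- removed has smaller gradient and is not legal.  This gives an independent set
-- of F of size l - 1 consisting of j and of vertices far from i and j; replacing
-- j by x and y shows that x and y are adjacent.

module Submission where

open import Defs
open import Data.Bool.Base using (Bool; true; false; _∧_; _∨_; not; T)
open import Data.Bool.Properties using (T?; T-≡) renaming (_≟_ to _≟ᵇ_)
import Data.Fin.Base as Fin
open import Data.Fin.Base using (Fin; zero; suc; punchIn)
import Data.Fin.Properties as Fin
open import Data.Fin.Properties
  using (_≟_; <-cmp; all?; any?; suc-injective; punchInᵢ≢i; punchIn-injective)
open import Data.Fin.Subset using (Subset; _∈_; _∉_; ∣_∣; inside; outside)
open import Data.Fin.Subset.Properties using (_∈?_)
import Data.Integer.Base as ℤ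
import Data.Integer.Properties as ℤ
open import Data.List.Base as List
  using (List; []; _∷_; allFin; cartesianProduct; cartesianProductWith)
open import Data.List.Extrema.Nat using (v≤max⁺; max≤v⁺)
open import Data.List.Membership.Propositional using (lose) renaming (_∈_ to _∈ᴸ_)
open import Data.List.Membership.Propositional.Properties using (∈-allFin; ∈-filter⁺; ∈-map⁺)
open import Data.List.Relation.Unary.All as All using (All; []; _∷_)
import Data.List.Relation.Unary.All.Properties as All
import Data.List.Relation.Unary.Any as Any
open import Data.Nat.Base
  using (ℕ; zero; suc; _+_; _*_; _∸_; _^_; _⊔_; _!; _≤_; _<_; z≤n; s≤s; NonZero; >-nonZero)
open import Data.Nat.Combinatorics using (_C_; nC1≡n; nCk+nC[k+1]≡[n+1]C[k+1]; k>n⇒nCk≡0)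
import Data.Nat.Properties as ℕ
open import Data.Nat.Properties hiding (_≟_; <-cmp; suc-injective)
open import Data.Nat.Tactic.RingSolver using (solve-∀)
open import Data.Product.Base using (Σ; ∃-syntax; _×_; _,_; proj₁; proj₂)
open import Data.Rational.Base as ℚ using (0ℚ; toℚᵘ; mkℚ)
import Data.Rational.Properties as ℚ
open import Data.Rational.Unnormalised.Base as ℚᵘ using (mkℚᵘ; *≤*; *<*)
import Data.Rational.Unnormalised.Properties as ℚᵘ
open import Data.Sum.Base as Sum using (_⊎_; inj₁; inj₂)
open import Data.Vec.Base as Vec using (Vec; []; _∷_; here; there; lookup; tabulate; _[_]≔_)
open import Data.Vec.Properties
  using ([]=⇒lookup; lookup⇒[]=; lookup∘tabulate; lookup∘update; lookup∘update′; ≡-dec)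
open import Function.Base using (_∘_; id)
open import Function.Bundles using (Equivalence; mk⇔)
open import Relation.Binary.Definitions using (tri<; tri≈; tri>)
open import Relation.Binary.PropositionalEquality
  using (_≡_; _≢_; refl; sym; trans; cong; cong₂; subst; subst₂; ≢-sym)
open import Relation.Nullary using (¬_; Dec; does; yes; no; contradiction)
open import Relation.Nullary.Decidable
  using (_⊎-dec_; _×-dec_; _→-dec_; ¬?; map′; dec-true; dec-false; decidable-stable)
import Relation.Unary as U
open import Algebra.Properties.CommutativeSemigroup *-commutativeSemigroup using (x∙yz≈y∙xz)
open import Algebra.Properties.Semiring.Sum +-*-semiring
  using (sum; sum-cong-≗; sum-replicate-zero; sum-remove; ∑-comm; ∑-distrib-+; *-distribˡ-sum; *-distribʳ-sum)

-- All estimates are carried out in ℕ with denominators cleared. The real number c is never handled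
-- itself: at the given n it is replaced by `t` / n ^ k with `t` = k! f(n, k, l), and strictness is
-- used as a gap of 1 / q above f(n, k, l) / C(n, k). Cliques are counted as ordered tuples, because
-- blow-ups, perturbations and restrictions to neighbourhoods then become inductions on the length.
-- Tuples of indices of F may repeat, so F and its expansion are given loops; G has none, and the n
-- diagonal pairs are charged to the editing error. Stability bounds only the total error, whereas
-- every single vertex has to be placed, including those joined in an atypical way. What is known
-- about such a vertex is that its clique degree hardly exceeds the average. Counting yields
-- gradients only approximately, yet the last step needs them to be exactly equal; being multiples
-- of 1 / m ^ (k - 1), they are, once the error is below that scale. This fixes the order of the
-- constants: q and m determine K, the precision of counts; then come g, the threshold for being
-- almost joined, J, the quality of stability, and n₀.

private variable
  m n p b : ℕ

-- Indicators and finite sums.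

⟦_⟧ : Bool → ℕ
⟦ true ⟧  = 1
⟦ false ⟧ = 0

⟦⟧-mono : ∀ {a b} → (a ≡ true → b ≡ true) → ⟦ a ⟧ ≤ ⟦ b ⟧
⟦⟧-mono {false}         _   = z≤n
⟦⟧-mono {true}  {true}  _   = ≤-refl
⟦⟧-mono {true}  {false} imp with () ← imp refl

⟦⟧≤1 : ∀ b → ⟦ b ⟧ ≤ 1
⟦⟧≤1 true  = ≤-refl
⟦⟧≤1 false = z≤n

⟦∧⟧ : ∀ a b → ⟦ a ∧ b ⟧ ≡ ⟦ a ⟧ * ⟦ b ⟧
⟦∧⟧ true  b = sym (+-identityʳ ⟦ b ⟧)
⟦∧⟧ false b = refl

∧-true : ∀ {a b} → a ≡ true → b ≡ true → a ∧ b ≡ true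
∧-true refl refl = refl

∧-trueˡ : ∀ {a b} → a ∧ b ≡ true → a ≡ true
∧-trueˡ {true} _ = refl

∧-trueʳ : ∀ {a b} → a ∧ b ≡ true → b ≡ true
∧-trueʳ {true} eq = eq

not-true : ∀ {b} → not b ≡ true → b ≢ true
not-true {false} _ ()

≢true : ∀ {b} → b ≢ true → b ≡ false
≢true {true}  b≢ = contradiction refl b≢
≢true {false} _  = refl

true≢false : ∀ {b} → b ≡ true → b ≢ false
true≢false refl ()

does⁻ : ∀ {p} {A : Set p} (a? : Dec A) → does a? ≡ true → A
does⁻ (yes a) _ = a

sum-mono : {g h : Fin n → ℕ} → (∀ x → g x ≤ h x) → sum g ≤ sum h
sum-mono {zero}  g≤h = z≤n
sum-mono {suc n} g≤h = +-mono-≤ (g≤h zero) (sum-mono (g≤h ∘ suc))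

sum-const : ∀ n a → sum {n} (λ _ → a) ≡ n * a
sum-const zero    a = refl
sum-const (suc n) a = cong (a +_) (sum-const n a)

sum-bound : ∀ {g : Fin n → ℕ} {b} → (∀ x → g x ≤ b) → sum g ≤ n * b
sum-bound {n} {b = b} g≤b = ≤-trans (sum-mono g≤b) (≤-reflexive (sum-const n b))

sum-δ : (j : Fin n) (h : Fin n → ℕ) → sum (λ i → ⟦ does (j ≟ i) ⟧ * h i) ≡ h j
sum-δ {suc n} zero    h = trans
  (cong₂ _+_ (+-identityʳ (h zero)) (sum-replicate-zero n)) (+-identityʳ (h zero))
sum-δ {suc n} (suc j) h = sum-δ j (h ∘ suc)

sum-δ₁ : (j : Fin n) → sum (λ i → ⟦ does (j ≟ i) ⟧) ≡ 1
sum-δ₁ j = trans (sum-cong-≗ λ i → sym (*-identityʳ ⟦ does (j ≟ i) ⟧)) (sum-δ j λ _ → 1)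

pigeonhole : (A : Fin n → Bool) (u : Fin n → ℕ) (b : ℕ) →
  sum (λ x → ⟦ A x ⟧ * u x) < sum (λ x → ⟦ A x ⟧) * b →
  ∃[ x ] (A x ≡ true × u x < b)
pigeonhole {suc n} A u b lt with A zero in A0 | u zero <? b
... | true  | yes u<b = zero , A0 , u<b
... | false | _ with x , Ax , ux ← pigeonhole (A ∘ suc) (u ∘ suc) b lt = suc x , Ax , ux
... | true  | no  u≮b
  with x , Ax , ux ← pigeonhole (A ∘ suc) (u ∘ suc) b
    (+-cancelˡ-< b _ _ (≤-<-trans (+-monoˡ-≤ _ (≤-trans (≮⇒≥ u≮b) (m≤m+n (u zero) 0))) lt))
  = suc x , Ax , ux

-- Cardinalities, fibres and counts of tuples.

card : (Fin n → Bool) → ℕ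
card A = sum λ x → ⟦ A x ⟧

card-mono : {A B : Fin n → Bool} → (∀ x → A x ≡ true → B x ≡ true) → card A ≤ card B
card-mono A⊆B = sum-mono λ x → ⟦⟧-mono (A⊆B x)

fibre : (Fin n → Fin m) → Fin m → Fin n → Bool
fibre V i x = does (V x ≟ i)

sum-fibres : (V : Fin n → Fin m) (h : Fin m → ℕ) →
  sum (h ∘ V) ≡ sum λ i → card (fibre V i) * h i
sum-fibres V h = begin-equality
  sum (h ∘ V)                                 ≡⟨ sum-cong-≗ (λ x → sum-δ (V x) h) ⟨
  sum (λ x → sum λ i → ⟦ fibre V i x ⟧ * h i) ≡⟨ ∑-comm (λ x i → ⟦ fibre V i x ⟧ * h i) ⟩
  sum (λ i → sum λ x → ⟦ fibre V i x ⟧ * h i) ≡⟨ sum-cong-≗ (λ i → *-distribʳ-sum (h i) λ x → ⟦ fibre V i x ⟧) ⟨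
  sum (λ i → card (fibre V i) * h i)          ∎
  where open ≤-Reasoning

-- The number of tuples (x₀ , … , x₍ᵣ₋₁₎) with xₐ in As a for all a and
-- R xₐ x_b for all a < b.
tuples : ∀ r → (Fin r → Fin n → Bool) → (Fin n → Fin n → Bool) → ℕ
tuples zero    As R = 1
tuples (suc r) As R = sum λ x → ⟦ As zero x ⟧ * tuples r (λ a z → As (suc a) z ∧ R x z) R

tuples-mono : ∀ r {As Bs : Fin r → Fin n → Bool} {R S : Fin n → Fin n → Bool} →
  (∀ a x → As a x ≡ true → Bs a x ≡ true) → (∀ x y → R x y ≡ true → S x y ≡ true) →
  tuples r As R ≤ tuples r Bs S
tuples-mono zero    A⊆B R⊆S = ≤-refl
tuples-mono (suc r) A⊆B R⊆S = sum-mono λ x → *-mono-≤ (⟦⟧-mono (A⊆B zero x))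
  (tuples-mono r (λ a z e → ∧-true (A⊆B (suc a) z (∧-trueˡ e)) (R⊆S x z (∧-trueʳ e))) R⊆S)

tuples-≤ : ∀ r (As : Fin r → Fin n → Bool) R → tuples r As R ≤ n ^ r
tuples-≤ zero    As R = ≤-refl
tuples-≤ (suc r) As R = sum-bound λ x →
  ≤-trans (*-mono-≤ (⟦⟧≤1 (As zero x)) (tuples-≤ r _ R)) (≤-reflexive (*-identityˡ _))

excess : (R S : Fin n → Fin n → Bool) → ℕ
excess R S = sum λ x → card λ z → R x z ∧ not (S x z)

sum-linear : ∀ p (f : Fin n → ℕ) c q g s h →
  sum (λ x → p * f x + (c + q * g x + s * h x)) ≡
  p * sum f + (n * c + q * sum g + s * sum h)
sum-linear {zero}  p f c q g s h = zeros p q s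
  where
  zeros : ∀ p q s → 0 ≡ p * 0 + (q * 0 + s * 0)
  zeros = solve-∀
sum-linear {suc n} p f c q g s h = trans
  (cong (p * f zero + (c + q * g zero + s * h zero) +_)
    (sum-linear p (f ∘ suc) c q (g ∘ suc) s (h ∘ suc)))
  (regroup p (f zero) (sum (f ∘ suc)) c (n * c) q (g zero) (sum (g ∘ suc)) s (h zero) (sum (h ∘ suc)))
  where
  regroup : ∀ p f F c C q g G s h H →
    (p * f + (c + q * g + s * h)) + (p * F + (C + q * G + s * H)) ≡
    p * (f + F) + ((c + C) + q * (g + G) + s * (h + H))
  regroup = solve-∀

-- Multiplied by n² so that the exponents are never negative.
tuples-perturb : ∀ r (As Bs : Fin r → Fin n → Bool) (R S : Fin n → Fin n → Bool) d →
  (∀ a → card (λ z → As a z ∧ not (Bs a z)) ≤ d) →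
  n * n * tuples r As R ≤
  n * n * tuples r Bs S + (r * d * n ^ suc r + r * r * excess R S * n ^ r)
tuples-perturb zero As Bs R S d _ = m≤m+n _ 0
tuples-perturb {n} (suc r) As Bs R S d A∖B≤d = begin
  n * n * sum (λ x → ⟦ As zero x ⟧ * tR x)
    ≡⟨ *-distribˡ-sum (n * n) (λ x → ⟦ As zero x ⟧ * tR x) ⟩
  sum (λ x → n * n * (⟦ As zero x ⟧ * tR x))
    ≤⟨ sum-mono (λ x → begin
      n * n * (⟦ As zero x ⟧ * tR x)
        ≤⟨ *-monoʳ-≤ (n * n) (switch (As zero x) (Bs zero x) (tuples-≤ r _ R)) ⟩
      n * n * (⟦ Bs zero x ⟧ * tR x + ⟦ As zero x ∧ not (Bs zero x) ⟧ * n ^ r)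
        ≡⟨ dist (n * n) ⟦ Bs zero x ⟧ (tR x) _ ⟩
      ⟦ Bs zero x ⟧ * (n * n * tR x) + n * n * (⟦ As zero x ∧ not (Bs zero x) ⟧ * n ^ r)
        -- Once the first coordinate is x, each remaining set may also lose the z with R x z but not
        -- S x z, so d grows to d + e x. Summed over x, these increments contribute r times
        -- `excess R S`.
        ≤⟨ +-monoˡ-≤ _ (*-monoʳ-≤ ⟦ Bs zero x ⟧
             (tuples-perturb r _ _ R S (d + e x) (λ a → slice a x))) ⟩
      ⟦ Bs zero x ⟧ * (n * n * tS x + err x) + n * n * (⟦ As zero x ∧ not (Bs zero x) ⟧ * n ^ r)
        ≤⟨ +-monoˡ-≤ _ (drop (Bs zero x) (n * n * tS x) (err x)) ⟩
      (⟦ Bs zero x ⟧ * (n * n * tS x) + err x) + n * n * (⟦ As zero x ∧ not (Bs zero x) ⟧ * n ^ r)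
        ≡⟨ shape n r d (e x) E (n ^ r) ⟦ Bs zero x ⟧ (tS x) ⟦ As zero x ∧ not (Bs zero x) ⟧ ⟩
      n * n * (⟦ Bs zero x ⟧ * tS x) + (base + (r * n ^ suc r) * e x + (n * n * n ^ r) * ⟦ As zero x ∧ not (Bs zero x) ⟧) ∎) ⟩
  sum (λ x → n * n * (⟦ Bs zero x ⟧ * tS x) + (base + (r * n ^ suc r) * e x + (n * n * n ^ r) * D x))
    ≡⟨ sum-linear (n * n) (λ x → ⟦ Bs zero x ⟧ * tS x) base (r * n ^ suc r) e (n * n * n ^ r) D ⟩
  n * n * tuples (suc r) Bs S + (n * base + (r * n ^ suc r) * E + (n * n * n ^ r) * sum D)
    ≤⟨ +-monoʳ-≤ (n * n * tuples (suc r) Bs S) (≤-trans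
         (+-monoʳ-≤ (n * base + (r * n ^ suc r) * E) (*-monoʳ-≤ (n * n * n ^ r) (A∖B≤d zero)))
         -- The recursion produces the coefficient r * r + r of E; adding 1 + r more rounds it up to
         -- the square of 1 + r.
         (≤-trans (m≤m+n _ (suc r * E * n ^ suc r)) (≤-reflexive (total n r d E (n ^ r))))) ⟩
  n * n * tuples (suc r) Bs S + (suc r * d * n ^ suc (suc r) + suc r * suc r * E * n ^ suc r) ∎
  where
  open ≤-Reasoning
  tR = λ x → tuples r (λ a z → As (suc a) z ∧ R x z) R
  tS = λ x → tuples r (λ a z → Bs (suc a) z ∧ S x z) S
  e  = λ x → card λ z → R x z ∧ not (S x z)
  D  = λ x → ⟦ As zero x ∧ not (Bs zero x) ⟧
  E  = excess R S
  base  = r * d * n ^ suc r + r * r * E * n ^ r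
  err = λ x → r * (d + e x) * n ^ suc r + r * r * E * n ^ r

  switch : ∀ a b {y N} → y ≤ N → ⟦ a ⟧ * y ≤ ⟦ b ⟧ * y + ⟦ a ∧ not b ⟧ * N
  switch false b     y≤N = z≤n
  switch true  true  y≤N = m≤m+n _ _
  switch true  false y≤N = +-monoˡ-≤ 0 y≤N

  drop : ∀ b p q → ⟦ b ⟧ * (p + q) ≤ ⟦ b ⟧ * p + q
  drop true  p q = ≤-reflexive (assoc p q)
    where
    assoc : ∀ p q → p + q + 0 ≡ p + 0 + q
    assoc = solve-∀
  drop false p q = z≤n

  slice : ∀ a x → card (λ z → (As (suc a) z ∧ R x z) ∧ not (Bs (suc a) z ∧ S x z)) ≤ d + e x
  slice a x = ≤-trans
    (sum-mono λ z → cover (As (suc a) z) (R x z) (Bs (suc a) z) (S x z))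
    (≤-trans (≤-reflexive (∑-distrib-+ (λ z → ⟦ As (suc a) z ∧ not (Bs (suc a) z) ⟧) _))
      (+-monoˡ-≤ (e x) (A∖B≤d (suc a))))
    where
    cover : ∀ p q p′ q′ →
      ⟦ (p ∧ q) ∧ not (p′ ∧ q′) ⟧ ≤ ⟦ p ∧ not p′ ⟧ + ⟦ q ∧ not q′ ⟧
    cover false _     _     _     = z≤n
    cover true  false _     _     = z≤n
    cover true  true  false _     = s≤s z≤n
    cover true  true  true  q′    = ≤-refl

  dist : ∀ N b y z → N * (b * y + z) ≡ b * (N * y) + N * z
  dist = solve-∀

  shape : ∀ n r d e E N b t D →
    (b * (n * n * t) + (r * (d + e) * (n * N) + r * r * E * N)) + n * n * (D * N) ≡
    n * n * (b * t) + ((r * d * (n * N) + r * r * E * N) + (r * (n * N)) * e + (n * n * N) * D)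
  shape = solve-∀

  total : ∀ n r d E N →
    (n * (r * d * (n * N) + r * r * E * N) + r * (n * N) * E) + n * n * N * d + (1 + r) * E * (n * N) ≡
    (1 + r) * d * (n * (n * N)) + (1 + r) * (1 + r) * E * (n * N)
  total = solve-∀

-- The hypothesis says that A and B are disjoint subsets of S, so no nonempty tuple lies in both.
-- The length is a successor because the empty tuple would be counted twice on the left and once on
-- the right.
tuples-super : ∀ r (A B S : Fin n → Bool) R → (∀ x → ⟦ A x ⟧ + ⟦ B x ⟧ ≤ ⟦ S x ⟧) →
  tuples (suc r) (λ _ → A) R + tuples (suc r) (λ _ → B) R ≤ tuples (suc r) (λ _ → S) R
tuples-super r A B S R A+B≤S = begin
  tuples (suc r) (λ _ → A) R + tuples (suc r) (λ _ → B) R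
    ≡⟨ ∑-distrib-+ (λ x → ⟦ A x ⟧ * within A x) (λ x → ⟦ B x ⟧ * within B x) ⟨
  sum (λ x → ⟦ A x ⟧ * within A x + ⟦ B x ⟧ * within B x)
    ≤⟨ sum-mono (λ x → begin
      ⟦ A x ⟧ * within A x + ⟦ B x ⟧ * within B x
        ≤⟨ +-mono-≤ (*-monoʳ-≤ ⟦ A x ⟧ (within-mono (λ z → ≤-trans (m≤m+n _ _) (A+B≤S z)) x))
                    (*-monoʳ-≤ ⟦ B x ⟧ (within-mono (λ z → ≤-trans (m≤n+m _ _) (A+B≤S z)) x)) ⟩
      ⟦ A x ⟧ * within S x + ⟦ B x ⟧ * within S x
        ≡⟨ *-distribʳ-+ (within S x) ⟦ A x ⟧ ⟦ B x ⟧ ⟨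
      (⟦ A x ⟧ + ⟦ B x ⟧) * within S x
        ≤⟨ *-monoˡ-≤ (within S x) (A+B≤S x) ⟩
      ⟦ S x ⟧ * within S x ∎) ⟩
  tuples (suc r) (λ _ → S) R ∎
  where
  open ≤-Reasoning
  within : (Fin _ → Bool) → Fin _ → ℕ
  within A x = tuples r (λ _ z → A z ∧ R x z) R

  ⟦⟧-reflect : ∀ {a b} → ⟦ a ⟧ ≤ ⟦ b ⟧ → a ≡ true → b ≡ true
  ⟦⟧-reflect {true} {true}  _ _ = refl
  ⟦⟧-reflect {true} {false} ()

  within-mono : ∀ {A B} → (∀ z → ⟦ A z ⟧ ≤ ⟦ B z ⟧) → ∀ x → within A x ≤ within B x
  within-mono A≤B x = tuples-mono r
    (λ _ z e → ∧-true (⟦⟧-reflect (A≤B z) (∧-trueˡ e)) (∧-trueʳ e)) (λ _ _ e → e)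

-- R holds between members of any two of the sets, so the tuples form the full product. The lower
-- bound on the factors is the fraction w / g.
tuples-product : ∀ r (As : Fin r → Fin n → Bool) R w g →
  (∀ a b x y → a ≢ b → As a x ≡ true → As b y ≡ true → R x y ≡ true) →
  (∀ a → w ≤ g * card (As a)) → w ^ r ≤ g ^ r * tuples r As R
tuples-product zero    As R w g full large = ≤-refl
tuples-product (suc r) As R w g full large = begin
  w * w ^ r
    ≤⟨ *-monoˡ-≤ (w ^ r) (large zero) ⟩
  (g * card (As zero)) * w ^ r
    ≡⟨ *-assoc g (card (As zero)) (w ^ r) ⟩
  g * (card (As zero) * w ^ r)
    ≡⟨ cong (g *_) (*-distribʳ-sum (w ^ r) (λ x → ⟦ As zero x ⟧)) ⟩
  g * sum (λ x → ⟦ As zero x ⟧ * w ^ r)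
    ≤⟨ *-monoʳ-≤ g (sum-mono λ x → step x (As zero x) refl) ⟩
  g * sum (λ x → g ^ r * (⟦ As zero x ⟧ * rest x))
    ≡⟨ cong (g *_) (*-distribˡ-sum (g ^ r) (λ x → ⟦ As zero x ⟧ * rest x)) ⟨
  g * (g ^ r * tuples (suc r) As R)
    ≡⟨ *-assoc g (g ^ r) _ ⟨
  g ^ suc r * tuples (suc r) As R ∎
  where
  open ≤-Reasoning
  rest = λ x → tuples r (λ a z → As (suc a) z ∧ R x z) R

  step : ∀ x b → As zero x ≡ b → ⟦ b ⟧ * w ^ r ≤ g ^ r * (⟦ b ⟧ * rest x)
  step x false _  = z≤n
  step x true  Ax = begin
    w ^ r + 0            ≡⟨ +-identityʳ (w ^ r) ⟩
    w ^ r                ≤⟨ tuples-product r _ R w g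
                              (λ a b y z a≢b Ay Az → full (suc a) (suc b) y z
                                (λ { refl → a≢b refl }) (∧-trueˡ Ay) (∧-trueˡ Az))
                              (λ a → ≤-trans (large (suc a)) (*-monoʳ-≤ g
                                (card-mono λ z Az → ∧-true Az (full zero (suc a) x z (λ ()) Ax Az)))) ⟩
    g ^ r * rest x       ≡⟨ cong (g ^ r *_) (+-identityʳ (rest x)) ⟨
    g ^ r * (rest x + 0) ∎

module _ (V : Fin n → Fin m) where

  private
    h : ∀ r → (Fin (suc r) → Fin m → Bool) → (Fin m → Fin m → Bool) → Fin m → ℕ
    h r As R i = ⟦ As zero i ⟧ *
      tuples r (λ a z → As (suc a) (V z) ∧ R i (V z)) (λ x y → R (V x) (V y))

    out : ∀ w N a t → w * N * (a * t) ≡ w * (a * (N * t))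
    out = solve-∀
    into : ∀ g c a N t → g * c * (a * (N * t)) ≡ g * N * (c * (a * t))
    into = solve-∀

  -- Over a tuple of indices lie as many tuples of vertices as the product of the sizes of its
  -- parts, and w / g bounds each size from below. Indices and vertices may repeat whenever R is
  -- reflexive.
  blowup-lower : ∀ r (As : Fin r → Fin m → Bool) R w g →
    (∀ i → w ≤ g * card (fibre V i)) →
    w ^ r * tuples r As R ≤ g ^ r * tuples r (λ a x → As a (V x)) (λ x y → R (V x) (V y))
  blowup-lower zero    As R w g large = ≤-refl
  blowup-lower (suc r) As R w g large = begin
    w ^ suc r * tuples (suc r) As R
      ≡⟨ *-distribˡ-sum (w ^ suc r) (λ i → ⟦ As zero i ⟧ * rest i) ⟩
    sum (λ i → w ^ suc r * (⟦ As zero i ⟧ * rest i))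
      ≤⟨ sum-mono (λ i → begin
        w * w ^ r * (⟦ As zero i ⟧ * rest i)
          ≡⟨ out w (w ^ r) ⟦ As zero i ⟧ (rest i) ⟩
        w * (⟦ As zero i ⟧ * (w ^ r * rest i))
          ≤⟨ *-mono-≤ (large i) (*-monoʳ-≤ ⟦ As zero i ⟧ (blowup-lower r _ R w g large)) ⟩
        g * card (fibre V i) * (⟦ As zero i ⟧ * (g ^ r * blown i))
          ≡⟨ into g (card (fibre V i)) ⟦ As zero i ⟧ (g ^ r) (blown i) ⟩
        g ^ suc r * (card (fibre V i) * h r As R i) ∎) ⟩
    sum (λ i → g ^ suc r * (card (fibre V i) * h r As R i))
      ≡⟨ *-distribˡ-sum (g ^ suc r) (λ i → card (fibre V i) * h r As R i) ⟨
    g ^ suc r * sum (λ i → card (fibre V i) * h r As R i)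
      ≡⟨ cong (g ^ suc r *_) (sum-fibres V (h r As R)) ⟨
    g ^ suc r * sum (λ x → h r As R (V x)) ∎
    where
    open ≤-Reasoning
    rest = λ i → tuples r (λ a z → As (suc a) z ∧ R i z) R
    blown = λ i → tuples r (λ a z → As (suc a) (V z) ∧ R i (V z)) (λ x y → R (V x) (V y))

  blowup-upper : ∀ r (As : Fin r → Fin m → Bool) R w g →
    (∀ i → g * card (fibre V i) ≤ w) →
    g ^ r * tuples r (λ a x → As a (V x)) (λ x y → R (V x) (V y)) ≤ w ^ r * tuples r As R
  blowup-upper zero    As R w g small = ≤-refl
  blowup-upper (suc r) As R w g small = begin
    g ^ suc r * sum (λ x → h r As R (V x))
      ≡⟨ cong (g ^ suc r *_) (sum-fibres V (h r As R)) ⟩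
    g ^ suc r * sum (λ i → card (fibre V i) * h r As R i)
      ≡⟨ *-distribˡ-sum (g ^ suc r) (λ i → card (fibre V i) * h r As R i) ⟩
    sum (λ i → g ^ suc r * (card (fibre V i) * h r As R i))
      ≤⟨ sum-mono (λ i → begin
        g ^ suc r * (card (fibre V i) * h r As R i)
          ≡⟨ into g (card (fibre V i)) ⟦ As zero i ⟧ (g ^ r) (blown i) ⟨
        g * card (fibre V i) * (⟦ As zero i ⟧ * (g ^ r * blown i))
          ≤⟨ *-mono-≤ (small i) (*-monoʳ-≤ ⟦ As zero i ⟧ (blowup-upper r _ R w g small)) ⟩
        w * (⟦ As zero i ⟧ * (w ^ r * rest i))
          ≡⟨ out w (w ^ r) ⟦ As zero i ⟧ (rest i) ⟨
        w * w ^ r * (⟦ As zero i ⟧ * rest i) ∎) ⟩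
    sum (λ i → w ^ suc r * (⟦ As zero i ⟧ * rest i))
      ≡⟨ *-distribˡ-sum (w ^ suc r) (λ i → ⟦ As zero i ⟧ * rest i) ⟨
    w ^ suc r * tuples (suc r) As R ∎
    where
    open ≤-Reasoning
    rest = λ i → tuples r (λ a z → As (suc a) z ∧ R i z) R
    blown = λ i → tuples r (λ a z → As (suc a) (V z) ∧ R i (V z)) (λ x y → R (V x) (V y))

tuples-punchIn : ∀ r (v : Fin (suc n)) (As : Fin r → Fin (suc n) → Bool) R →
  (∀ a → As a v ≡ false) →
  tuples r As R ≡
  tuples r (λ a x → As a (punchIn v x)) (λ x y → R (punchIn v x) (punchIn v y))
tuples-punchIn zero    v As R out = refl
tuples-punchIn (suc r) v As R out = trans
  (sum-remove {i = v} λ x → ⟦ As zero x ⟧ * tuples r (λ a z → As (suc a) z ∧ R x z) R)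
  (cong₂ _+_ (cong (λ b → ⟦ b ⟧ * tuples r (λ a z → As (suc a) z ∧ R v z) R) (out zero))
    (sum-cong-≗ λ x → cong (⟦ As zero (punchIn v x) ⟧ *_)
      (tuples-punchIn r v _ R λ a → cong (_∧ R (punchIn v x) v) (out (suc a)))))

sum-positive : (g : Fin n → ℕ) → 0 < sum g → ∃[ x ] 0 < g x
sum-positive {suc n} g pos with g zero in g0
... | suc _ = zero , subst (0 <_) (sym g0) (s≤s z≤n)
... | zero with x , gx ← sum-positive (g ∘ suc) pos = suc x , gx

-- `tuples` tests R on positions in increasing order only; symmetry supplies the other order.
tuples-witness : ∀ r (As : Fin r → Fin n → Bool) R → (∀ x y → R x y ≡ true → R y x ≡ true) →
  0 < tuples r As R →
  Σ (Fin r → Fin n) λ φ → (∀ a → As a (φ a) ≡ true) × (∀ a b → a ≢ b → R (φ a) (φ b) ≡ true)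
tuples-witness zero    As R R-sym pos = (λ ()) , (λ ()) , λ ()
tuples-witness (suc r) As R R-sym pos with sum-positive _ pos
... | x , pos′ with As zero x in Ax
...   | true with φ , in-A , pairs ← tuples-witness r _ R R-sym (subst (0 <_) (+-identityʳ _) pos′)
  = ψ , in-A′ , pairs′
  where
  ψ : Fin (suc r) → _
  ψ zero    = x
  ψ (suc a) = φ a

  in-A′ : ∀ a → As a (ψ a) ≡ true
  in-A′ zero    = Ax
  in-A′ (suc a) = ∧-trueˡ (in-A a)

  pairs′ : ∀ a b → a ≢ b → R (ψ a) (ψ b) ≡ true
  pairs′ zero    zero    a≢b = contradiction refl a≢b
  pairs′ zero    (suc b) _   = ∧-trueʳ (in-A b)
  pairs′ (suc a) zero    _   = R-sym _ _ (∧-trueʳ (in-A a))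
  pairs′ (suc a) (suc b) a≢b = pairs a b λ { refl → a≢b refl }

-- Sums over lists, and the gradient as a count of tuples.

total : ∀ {a} {A : Set a} → (A → ℕ) → List A → ℕ
total h []       = 0
total h (x ∷ xs) = h x + total h xs

module _ {a} {A : Set a} where

  total-cong : {g h : A → ℕ} → (∀ x → g x ≡ h x) → ∀ xs → total g xs ≡ total h xs
  total-cong g≗h []       = refl
  total-cong g≗h (x ∷ xs) = cong₂ _+_ (g≗h x) (total-cong g≗h xs)

  count≡total : ∀ {p} {P : A → Set p} (P? : U.Decidable P) xs →
    count P? xs ≡ total (λ x → ⟦ does (P? x) ⟧) xs
  count≡total P? []       = refl
  count≡total P? (x ∷ xs) with does (P? x)
  ... | true  = cong suc (count≡total P? xs)
  ... | false = count≡total P? xs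

  total-++ : (h : A → ℕ) → ∀ xs ys → total h (xs List.++ ys) ≡ total h xs + total h ys
  total-++ h []       ys = refl
  total-++ h (x ∷ xs) ys =
    trans (cong (h x +_) (total-++ h xs ys)) (sym (+-assoc (h x) (total h xs) (total h ys)))

  total-map : ∀ {b} {B : Set b} (h : A → ℕ) (g : B → A) xs →
    total h (List.map g xs) ≡ total (h ∘ g) xs
  total-map h g []       = refl
  total-map h g (x ∷ xs) = cong (h (g x) +_) (total-map h g xs)

  total-tabulate : (h : A → ℕ) (g : Fin n → A) → total h (List.tabulate g) ≡ sum (h ∘ g)
  total-tabulate {zero}  h g = refl
  total-tabulate {suc n} h g = cong (h (g zero) +_) (total-tabulate h (g ∘ suc))

total-product : ∀ {a b c} {A : Set a} {B : Set b} {D : Set c} (h : D → ℕ) (g : A → B → D) xs ys →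
  total h (cartesianProductWith g xs ys) ≡ total (λ x → total (h ∘ g x) ys) xs
total-product h g []       ys = refl
total-product h g (x ∷ xs) ys = trans
  (total-++ h (List.map (g x) ys) (cartesianProductWith g xs ys))
  (cong₂ _+_ (total-map h (g x) ys) (total-product h g xs ys))

-- Runs the recursion of `tuples` on one given vector, so that counting over `vectors` turns into
-- `tuples` by induction.
good : ∀ r → (Fin r → Fin n → Bool) → (Fin n → Fin n → Bool) → Vec (Fin n) r → Bool
good zero    As R []       = true
good (suc r) As R (x ∷ xs) = As zero x ∧ good r (λ a z → As (suc a) z ∧ R x z) R xs

good⁺ : ∀ r (As : Fin r → Fin n → Bool) R xs → (∀ a → As a (lookup xs a) ≡ true) →
  (∀ a b → R (lookup xs a) (lookup xs b) ≡ true) → good r As R xs ≡ true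
good⁺ zero    As R []       _    _     = refl
good⁺ (suc r) As R (x ∷ xs) in-A pairs = ∧-true (in-A zero)
  (good⁺ r _ R xs (λ a → ∧-true (in-A (suc a)) (pairs zero (suc a))) (λ a b → pairs (suc a) (suc b)))

good⁻ : ∀ r (As : Fin r → Fin n → Bool) R xs → good r As R xs ≡ true →
  (∀ a → As a (lookup xs a) ≡ true) × (∀ a b → a Fin.< b → R (lookup xs a) (lookup xs b) ≡ true)
good⁻ zero    As R []       _ = (λ ()) , λ ()
good⁻ (suc r) As R (x ∷ xs) e with good⁻ r _ R xs (∧-trueʳ e)
... | in-A , pairs =
  (λ { zero → ∧-trueˡ e ; (suc a) → ∧-trueˡ (in-A a) }) ,
  λ { zero    (suc b) _         → ∧-trueʳ (in-A b)
    ; (suc a) (suc b) (s≤s a<b) → pairs a b a<b }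

total-good : ∀ r (As : Fin r → Fin n → Bool) R →
  total (λ xs → ⟦ good r As R xs ⟧) (vectors (allFin n) r) ≡ tuples r As R
total-good zero    As R = refl
total-good {n} (suc r) As R = begin-equality
  total (λ xs → ⟦ good (suc r) As R xs ⟧) (vectors (allFin n) (suc r))
    ≡⟨ total-product (λ xs → ⟦ good (suc r) As R xs ⟧) _∷_ (allFin n) (vectors (allFin n) r) ⟩
  total (λ x → total (λ xs → ⟦ good (suc r) As R (x ∷ xs) ⟧) (vectors (allFin n) r)) (allFin n)
    ≡⟨ total-tabulate (λ x → total (λ xs → ⟦ good (suc r) As R (x ∷ xs) ⟧) (vectors (allFin n) r)) id ⟩
  sum (λ x → total (λ xs → ⟦ good (suc r) As R (x ∷ xs) ⟧) (vectors (allFin n) r))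
    ≡⟨ sum-cong-≗ (λ x → trans
         (factor (As zero x) (good r (λ a z → As (suc a) z ∧ R x z) R) (vectors (allFin n) r))
         (cong (⟦ As zero x ⟧ *_) (total-good r _ R))) ⟩
  tuples (suc r) As R ∎
  where
  open ≤-Reasoning
  factor : ∀ {a} {A : Set a} b (g : A → Bool) xs →
    total (λ x → ⟦ b ∧ g x ⟧) xs ≡ ⟦ b ⟧ * total (λ x → ⟦ g x ⟧) xs
  factor true  g xs       = sym (+-identityʳ _)
  factor false g []       = refl
  factor false g (x ∷ xs) = factor false g xs

does-≡true : ∀ {p} {A : Set p} (a? : Dec A) {b} → (A → b ≡ true) → (b ≡ true → A) → does a? ≡ b
does-≡true a? {true}  to from = dec-true a? (from refl)
does-≡true a? {false} to from = dec-false a? λ a → contradiction (to a) λ ()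

-- Written exactly like the entries of `closedNeighbourhood`, so that looking one up returns
-- `closed`. Reflexivity reflects that an expansion is complete inside each part.
closed : Graph m → Fin m → Fin m → Bool
closed F i j = does ((j ≟ i) ⊎-dec adj? F i j)

module _ (F : Graph m) {i j : Fin m} where

  closed⁺ : i ≡ j ⊎ i ~[ F ] j → closed F i j ≡ true
  closed⁺ near = dec-true ((j ≟ i) ⊎-dec adj? F i j) (Sum.map₁ sym near)

  closed⁻ : closed F i j ≡ true → i ≡ j ⊎ i ~[ F ] j
  closed⁻ e = Sum.map₁ sym (does⁻ ((j ≟ i) ⊎-dec adj? F i j) e)

closed-refl : (F : Graph m) → ∀ i → closed F i i ≡ true
closed-refl F i = closed⁺ F (inj₁ refl)

-- `GoodTuple` speaks of all pairs of positions, `tuples` of increasing ones; symmetry and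
-- reflexivity of `closed F` make up the difference.
count-goodTuple : ∀ r (F : Graph m) X →
  count (goodTuple? {r = r} F X) (vectors (allFin m) r) ≡ tuples r (λ _ → lookup X) (closed F)
count-goodTuple {m} r F X = trans (count≡total (goodTuple? F X) (vectors (allFin m) r))
  (trans (total-cong (λ xs → cong ⟦_⟧ (does-≡true (goodTuple? F X xs) (to xs) (from xs)))
           (vectors (allFin m) r))
    (total-good r (λ _ → lookup X) (closed F)))
  where
  to : ∀ xs → GoodTuple F X xs → good r (λ _ → lookup X) (closed F) xs ≡ true
  to xs (in-X , pairs) = good⁺ r _ _ xs (λ a → []=⇒lookup (in-X a))
    λ a b → closed⁺ F (Sum.swap (pairs a b))

  from : ∀ xs → good r (λ _ → lookup X) (closed F) xs ≡ true → GoodTuple F X xs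
  from xs e with good⁻ r _ _ xs e
  ... | in-X , pairs = (λ a → lookup⇒[]= (lookup xs a) X (in-X a)) , pairs′
    where
    pairs′ : ∀ a b → lookup xs a ~[ F ] lookup xs b ⊎ lookup xs a ≡ lookup xs b
    pairs′ a b with <-cmp a b
    ... | tri≈ _ refl _ = inj₂ refl
    ... | tri< a<b _ _  = Sum.swap (closed⁻ F (pairs a b a<b))
    ... | tri> _ _ b<a  = Sum.swap (Sum.map sym (Graph.~-sym F) (closed⁻ F (pairs b a b<a)))

-- Independent families and the independence number.

-- Families of vertices stand in for independent subsets, since they can be extended, reindexed and
-- mapped by composition.
IndependentFamily : Graph n → (Fin p → Fin n) → Set
IndependentFamily G φ = ∀ a b → a ≢ b → φ a ≢ φ b × ¬ (φ a ~[ G ] φ b)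

size≡card : (S : Subset n) → ∣ S ∣ ≡ card (lookup S)
size≡card []            = refl
size≡card (inside ∷ S)  = cong suc (size≡card S)
size≡card (outside ∷ S) = size≡card S

size-insert : (S : Subset n) (x : Fin n) → lookup S x ≡ false → ∣ S [ x ]≔ inside ∣ ≡ suc ∣ S ∣
size-insert (false ∷ S) zero    _  = refl
size-insert (true ∷ S)  (suc x) x∉ = cong suc (size-insert S x x∉)
size-insert (false ∷ S) (suc x) x∉ = size-insert S x x∉

lookup-insert⁻ : (S : Subset n) (x y : Fin n) →
  lookup (S [ x ]≔ inside) y ≡ true → y ≡ x ⊎ lookup S y ≡ true
lookup-insert⁻ S x y e with y ≟ x
... | yes y≡x = inj₁ y≡x
... | no  y≢x = inj₂ (trans (sym (lookup∘update′ y≢x S inside)) e)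

lookup-insert⁺ : (S : Subset n) (x y : Fin n) →
  y ≡ x ⊎ lookup S y ≡ true → lookup (S [ x ]≔ inside) y ≡ true
lookup-insert⁺ S x y (inj₁ refl) = lookup∘update x S inside
lookup-insert⁺ S x y (inj₂ y∈) with y ≟ x
... | yes refl = lookup∘update x S inside
... | no  y≢x  = trans (lookup∘update′ y≢x S inside) y∈

image : (φ : Fin p → Fin n) → (∀ a b → a ≢ b → φ a ≢ φ b) →
  Σ (Subset n) λ S → ∣ S ∣ ≡ p × (∀ x → lookup S x ≡ true → ∃[ a ] φ a ≡ x)
image {zero} {n} φ inj = Vec.replicate n false , empty n , λ x x∈ → contradiction (trans (sym x∈) (out x)) λ ()
  where
  empty : ∀ n → ∣ Vec.replicate n false ∣ ≡ 0
  empty zero    = refl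
  empty (suc n) = empty n

  out : ∀ {n} (x : Fin n) → lookup (Vec.replicate n false) x ≡ false
  out zero    = refl
  out (suc x) = out x
image {suc p} φ inj with image (φ ∘ suc) (λ a b a≢b → inj (suc a) (suc b) (a≢b ∘ suc-injective))
... | S , size , hit = S [ φ zero ]≔ inside , trans (size-insert S (φ zero) fresh) (cong suc size) , hit′
  where
  fresh : lookup S (φ zero) ≡ false
  fresh with lookup S (φ zero) in e
  ... | false = refl
  ... | true with a , φa ← hit (φ zero) e = contradiction φa (inj (suc a) zero λ ())

  hit′ : ∀ x → lookup (S [ φ zero ]≔ inside) x ≡ true → ∃[ a ] φ a ≡ x
  hit′ x x∈ with lookup-insert⁻ S (φ zero) x x∈
  ... | inj₁ x≡ = zero , sym x≡
  ... | inj₂ x∈S with a , φa ← hit x x∈S = suc a , φa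

enumerate : (S : Subset n) →
  Σ (Fin ∣ S ∣ → Fin n) λ φ → (∀ a b → a ≢ b → φ a ≢ φ b) × (∀ a → φ a ∈ S)
enumerate []            = (λ ()) , (λ ()) , λ ()
enumerate (outside ∷ S) with enumerate S
... | φ , inj , φ∈ = suc ∘ φ , (λ a b a≢b → inj a b a≢b ∘ suc-injective) , there ∘ φ∈
enumerate (inside ∷ S)  with enumerate S
... | φ , inj , φ∈ = ψ , inj′ , λ { zero → here ; (suc a) → there (φ∈ a) }
  where
  ψ : Fin (suc ∣ S ∣) → Fin _
  ψ zero    = zero
  ψ (suc a) = suc (φ a)

  inj′ : ∀ a b → a ≢ b → ψ a ≢ ψ b
  inj′ zero    zero    a≢b _ = a≢b refl
  inj′ (suc a) (suc b) a≢b e = inj a b (λ { refl → a≢b refl }) (suc-injective e)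

family⇒≤α : (G : Graph n) (φ : Fin p → Fin n) → IndependentFamily G φ → p ≤ α G
family⇒≤α {n} G φ ind with image φ (λ a b a≢b → proj₁ (ind a b a≢b))
... | S , size , hit = v≤max⁺ 0 _ (inj₂ (Any.map (≤-reflexive ∘ trans (sym size))
        (∈-map⁺ ∣_∣ (∈-filter⁺ (isIndependent? G) (∈-vectors ∈-booleans S) indS))))
  where
  indS : IsIndependent G S
  indS x y x∈ y∈ x~y with hit x ([]=⇒lookup x∈) | hit y ([]=⇒lookup y∈)
  ... | a , refl | b , refl with a ≟ b
  ...   | yes refl = Graph.~-irr G refl x~y
  ...   | no  a≢b  = proj₂ (ind a b a≢b) x~y

α≤-families : (G : Graph n) → (∀ p (φ : Fin p → Fin n) → IndependentFamily G φ → p ≤ b) → α G ≤ b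
α≤-families {n} {b} G bound = max≤v⁺ z≤n (All.map⁺ (All.map size
  (All.all-filter (isIndependent? G) (subsets n))))
  where
  size : ∀ {S} → IsIndependent G S → ∣ S ∣ ≤ b
  size {S} ind with φ , inj , φ∈ ← enumerate S = bound ∣ S ∣ φ λ i j i≢j →
    inj i j i≢j , ind (φ i) (φ j) (φ∈ i) (φ∈ j)

-- Such a map is injective on independent sets and keeps them independent. Expansions, vertex
-- deletions and, through expansions, clones are instances.
α-hom : (G : Graph n) (H : Graph m) (σ : Fin n → Fin m) →
  (∀ u v → u ≢ v → ¬ (u ~[ G ] v) → σ u ≢ σ v × ¬ (σ u ~[ H ] σ v)) → α G ≤ α H
α-hom G H σ hom = α≤-families G λ p φ ind → family⇒≤α H (σ ∘ φ) λ a b a≢b →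
  hom (φ a) (φ b) (proj₁ (ind a b a≢b)) (proj₂ (ind a b a≢b))

α-expansion : (F : Graph m) (V : Fin n → Fin m) → α (expansion F V) ≤ α F
α-expansion F V = α-hom (expansion F V) F V λ u v u≢v u≁v →
  (λ Vu≡Vv → u≁v (u≢v , inj₁ Vu≡Vv)) , λ Vu~Vv → u≁v (u≢v , inj₂ Vu~Vv)

delete : Fin (suc n) → Graph (suc n) → Graph n
delete v G = record
  { _~_   = λ x y → punchIn v x ~[ G ] punchIn v y
  ; ~-sym = Graph.~-sym G
  ; ~-irr = λ x≡y → Graph.~-irr G (cong (punchIn v) x≡y)
  ; _~?_  = λ x y → adj? G (punchIn v x) (punchIn v y)
  }

α-delete : (v : Fin (suc n)) (G : Graph (suc n)) → α (delete v G) ≤ α G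
α-delete v G = α-hom (delete v G) G (punchIn v) λ x y x≢y x≁y →
  (x≢y ∘ punchIn-injective v x y) , x≁y

-- Counting cliques through their vertices.

module _ {a} {A : Set a} where

  total-mono : {g h : A → ℕ} → (∀ x → g x ≤ h x) → ∀ xs → total g xs ≤ total h xs
  total-mono g≤h []       = z≤n
  total-mono g≤h (x ∷ xs) = +-mono-≤ (g≤h x) (total-mono g≤h xs)

  total-+ : (g h : A → ℕ) → ∀ xs → total (λ x → g x + h x) xs ≡ total g xs + total h xs
  total-+ g h []       = refl
  total-+ g h (x ∷ xs) = trans (cong (g x + h x +_) (total-+ g h xs))
    (regroup (g x) (h x) (total g xs) (total h xs))
    where
    regroup : ∀ a b c d → a + b + (c + d) ≡ a + c + (b + d)
    regroup = solve-∀

  total-* : ∀ c (h : A → ℕ) xs → total (λ x → c * h x) xs ≡ c * total h xs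
  total-* c h []       = sym (*-zeroʳ c)
  total-* c h (x ∷ xs) = trans (cong (c * h x +_) (total-* c h xs))
    (sym (*-distribˡ-+ c (h x) (total h xs)))

  total-sum : (h : Fin n → A → ℕ) → ∀ xs →
    total (λ S → sum λ x → h x S) xs ≡ sum λ x → total (h x) xs
  total-sum {n} h []       = sym (sum-replicate-zero n)
  total-sum     h (S ∷ xs) = trans (cong ((sum λ x → h x S) +_) (total-sum h xs))
    (sym (∑-distrib-+ (λ x → h x S) (λ x → total (h x) xs)))

total-subsets : (h : Subset (suc n) → ℕ) →
  total h (subsets (suc n)) ≡
  total (λ S → h (true ∷ S)) (subsets n) + total (λ S → h (false ∷ S)) (subsets n)
total-subsets {n} h = trans (total-product h _∷_ booleans (subsets n))
  (cong (total (λ S → h (true ∷ S)) (subsets n) +_) (+-identityʳ _))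

-- Adding x is a bijection from the sets without x to the sets with x.
total-insert : (x : Fin n) (h : Subset n → ℕ) →
  total (λ S → ⟦ lookup S x ⟧ * h S) (subsets n) ≡
  total (λ S → ⟦ not (lookup S x) ⟧ * h (S [ x ]≔ inside)) (subsets n)
total-insert {suc n} zero h = trans (total-subsets {n} _) (trans
  (+-comm (total (λ S → 1 * h (true ∷ S)) (subsets n)) _) (sym (total-subsets {n} _)))
total-insert {suc n} (suc x) h = trans (total-subsets {n} _) (trans
  (cong₂ _+_ (total-insert x (h ∘ (true ∷_))) (total-insert x (h ∘ (false ∷_))))
  (sym (total-subsets {n} _)))

adj : Graph n → Fin n → Fin n → Bool
adj G x y = does (adj? G x y)

everything : Fin n → Bool
everything _ = true

module _ {n} (G : Graph n) where

  KCliqueIn : ℕ → (Fin n → Bool) → Subset n → Set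
  KCliqueIn j A S = IsKClique j G S × (∀ z → z ∈ S → T (A z))

  kCliqueIn? : ∀ j A S → Dec (KCliqueIn j A S)
  kCliqueIn? j A S = isKClique? j G S ×-dec all? λ z → (z ∈? S) →-dec T? (A z)

  cliques : ℕ → (Fin n → Bool) → ℕ
  cliques j A = total (λ S → ⟦ does (kCliqueIn? j A S) ⟧) (subsets n)

  P≡cliques : ∀ k → P k G ≡ cliques k everything
  P≡cliques k = trans (count≡total (isKClique? k G) (subsets n))
    (total-cong (λ S → cong ⟦_⟧ (does-≡true (isKClique? k G S)
      (λ c → dec-true (kCliqueIn? k everything S) (c , λ _ _ → _))
      (proj₁ ∘ does⁻ (kCliqueIn? k everything S)))) (subsets n))

  insert-clique : ∀ j A S x → lookup S x ≡ false →
    does (kCliqueIn? (suc j) A (S [ x ]≔ inside)) ≡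
    A x ∧ does (kCliqueIn? j (λ z → A z ∧ adj G x z) S)
  insert-clique j A S x x∉S = does-≡true (kCliqueIn? (suc j) A S⁺) to from
    where
    S⁺ = S [ x ]≔ inside

    ∈⁺ : ∀ {y} → y ≡ x ⊎ y ∈ S → y ∈ S⁺
    ∈⁺ {y} (inj₁ e)  = lookup⇒[]= y S⁺ (lookup-insert⁺ S x y (inj₁ e))
    ∈⁺ {y} (inj₂ y∈) = lookup⇒[]= y S⁺ (lookup-insert⁺ S x y (inj₂ ([]=⇒lookup y∈)))

    x≢ : ∀ {y} → y ∈ S → x ≢ y
    x≢ y∈ refl = contradiction (trans (sym ([]=⇒lookup y∈)) x∉S) λ ()

    to : KCliqueIn (suc j) A S⁺ → A x ∧ does (kCliqueIn? j (λ z → A z ∧ adj G x z) S) ≡ true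
    to ((size , cl) , S⁺⊆A) = ∧-true (Equivalence.to T-≡ (S⁺⊆A x (∈⁺ (inj₁ refl))))
      (dec-true (kCliqueIn? j _ S)
        ( ( ℕ.suc-injective (trans (sym (size-insert S x x∉S)) size)
          , λ u v u∈ v∈ → cl u v (∈⁺ (inj₂ u∈)) (∈⁺ (inj₂ v∈)))
        , λ z z∈ → Equivalence.from T-≡ (∧-true (Equivalence.to T-≡ (S⁺⊆A z (∈⁺ (inj₂ z∈))))
            (dec-true (adj? G x z) (cl x z (∈⁺ (inj₁ refl)) (∈⁺ (inj₂ z∈)) (x≢ z∈))))))

    from : A x ∧ does (kCliqueIn? j (λ z → A z ∧ adj G x z) S) ≡ true → KCliqueIn (suc j) A S⁺
    from e with does⁻ (kCliqueIn? j _ S) (∧-trueʳ {A x} e)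
    ... | (size , cl) , S⊆ = (trans (size-insert S x x∉S) (cong suc size) , cl′) , S⁺⊆A
      where
      x~ : ∀ {z} → z ∈ S → x ~[ G ] z
      x~ {z} z∈ = does⁻ (adj? G x z) (∧-trueʳ {A z} (Equivalence.to T-≡ (S⊆ z z∈)))

      ∈⁻ : ∀ {y} → y ∈ S⁺ → y ≡ x ⊎ y ∈ S
      ∈⁻ {y} y∈ with lookup-insert⁻ S x y ([]=⇒lookup y∈)
      ... | inj₁ y≡x = inj₁ y≡x
      ... | inj₂ e′  = inj₂ (lookup⇒[]= y S e′)

      cl′ : IsClique G S⁺
      cl′ u v u∈ v∈ u≢v with ∈⁻ u∈ | ∈⁻ v∈
      ... | inj₁ refl | inj₁ refl = contradiction refl u≢v
      ... | inj₁ refl | inj₂ v∈S  = x~ v∈S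
      ... | inj₂ u∈S  | inj₁ refl = Graph.~-sym G (x~ u∈S)
      ... | inj₂ u∈S  | inj₂ v∈S  = cl u v u∈S v∈S u≢v

      S⁺⊆A : ∀ z → z ∈ S⁺ → T (A z)
      S⁺⊆A z z∈ with ∈⁻ z∈
      ... | inj₁ refl = Equivalence.from T-≡ (∧-trueˡ e)
      ... | inj₂ z∈S  = Equivalence.from T-≡ (∧-trueˡ (Equivalence.to T-≡ (S⊆ z z∈S)))

  cliques-through : ∀ j A x →
    total (λ S → ⟦ lookup S x ⟧ * ⟦ does (kCliqueIn? (suc j) A S) ⟧) (subsets n) ≡
    ⟦ A x ⟧ * cliques j (λ z → A z ∧ adj G x z)
  cliques-through j A x = trans (total-insert x λ S → ⟦ does (kCliqueIn? (suc j) A S) ⟧)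
    (trans (total-cong pointwise (subsets n))
      (total-* ⟦ A x ⟧ (λ S → ⟦ does (kCliqueIn? j (λ z → A z ∧ adj G x z) S) ⟧) (subsets n)))
    where
    pointwise : ∀ S → ⟦ not (lookup S x) ⟧ * ⟦ does (kCliqueIn? (suc j) A (S [ x ]≔ inside)) ⟧ ≡
      ⟦ A x ⟧ * ⟦ does (kCliqueIn? j (λ z → A z ∧ adj G x z) S) ⟧
    pointwise S with lookup S x in e
    ... | false = trans (+-identityʳ _) (trans (cong ⟦_⟧ (insert-clique j A S x e)) (⟦∧⟧ (A x) _))
    ... | true  = sym (trans (cong (λ b → ⟦ A x ⟧ * ⟦ b ⟧) (dec-false (kCliqueIn? j _ S) loop))
                    (*-zeroʳ ⟦ A x ⟧))
      where
      loop : ¬ KCliqueIn j (λ z → A z ∧ adj G x z) S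
      loop (_ , S⊆) = Graph.~-irr G refl (does⁻ (adj? G x x)
        (∧-trueʳ {A x} (Equivalence.to T-≡ (S⊆ x (lookup⇒[]= x S e)))))

  cliques-pascal : ∀ j A x → cliques (suc j) A ≡
    cliques (suc j) (λ z → A z ∧ not (does (z ≟ x))) + ⟦ A x ⟧ * cliques j (λ z → A z ∧ adj G x z)
  cliques-pascal j A x = begin-equality
    cliques (suc j) A
      ≡⟨ total-cong (λ S → split (lookup S x) ⟦ does (kCliqueIn? (suc j) A S) ⟧) (subsets n) ⟩
    total (λ S → ⟦ not (lookup S x) ⟧ * ⟦ does (kCliqueIn? (suc j) A S) ⟧ +
                 ⟦ lookup S x ⟧ * ⟦ does (kCliqueIn? (suc j) A S) ⟧) (subsets n)
      ≡⟨ total-+ _ _ (subsets n) ⟩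
    total (λ S → ⟦ not (lookup S x) ⟧ * ⟦ does (kCliqueIn? (suc j) A S) ⟧) (subsets n) +
    total (λ S → ⟦ lookup S x ⟧ * ⟦ does (kCliqueIn? (suc j) A S) ⟧) (subsets n)
      ≡⟨ cong₂ _+_ (total-cong avoid (subsets n)) (cliques-through j A x) ⟩
    cliques (suc j) (λ z → A z ∧ not (does (z ≟ x))) + ⟦ A x ⟧ * cliques j (λ z → A z ∧ adj G x z) ∎
    where
    open ≤-Reasoning
    split : ∀ b a → a ≡ ⟦ not b ⟧ * a + ⟦ b ⟧ * a
    split true  a = sym (+-identityʳ a)
    split false a = sym (trans (+-identityʳ (a + 0)) (+-identityʳ a))

    A∖x = λ z → A z ∧ not (does (z ≟ x))

    avoid : ∀ S → ⟦ not (lookup S x) ⟧ * ⟦ does (kCliqueIn? (suc j) A S) ⟧ ≡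
      ⟦ does (kCliqueIn? (suc j) A∖x S) ⟧
    avoid S = trans (sym (⟦∧⟧ (not (lookup S x)) _))
      (cong ⟦_⟧ (sym (does-≡true (kCliqueIn? (suc j) A∖x S) to from)))
      where
      to : KCliqueIn (suc j) A∖x S → not (lookup S x) ∧ does (kCliqueIn? (suc j) A S) ≡ true
      to (cl , S⊆) = ∧-true x∉ (dec-true (kCliqueIn? (suc j) A S)
        (cl , λ z z∈ → Equivalence.from T-≡ (∧-trueˡ (Equivalence.to T-≡ (S⊆ z z∈)))))
        where
        x∉ : not (lookup S x) ≡ true
        x∉ with lookup S x in e
        ... | false = refl
        ... | true  = contradiction (dec-true (x ≟ x) refl)
          (not-true (∧-trueʳ {A x} (Equivalence.to T-≡ (S⊆ x (lookup⇒[]= x S e)))))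

      from : not (lookup S x) ∧ does (kCliqueIn? (suc j) A S) ≡ true → KCliqueIn (suc j) A∖x S
      from e with does⁻ (kCliqueIn? (suc j) A S) (∧-trueʳ {not (lookup S x)} e)
      ... | cl , S⊆ = cl , λ z z∈ → Equivalence.from T-≡
        (∧-true (Equivalence.to T-≡ (S⊆ z z∈)) (cong not (dec-false (z ≟ x)
          λ { refl → not-true (∧-trueˡ e) ([]=⇒lookup z∈) })))

  -- Double counting of the pairs formed by a clique and one of its vertices.
  cliques-handshake : ∀ j A →
    suc j * cliques (suc j) A ≡ sum λ x → ⟦ A x ⟧ * cliques j (λ z → A z ∧ adj G x z)
  cliques-handshake j A = begin-equality
    suc j * cliques (suc j) A
      ≡⟨ total-* (suc j) (λ S → ⟦ does (kCliqueIn? (suc j) A S) ⟧) (subsets n) ⟨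
    total (λ S → suc j * ⟦ does (kCliqueIn? (suc j) A S) ⟧) (subsets n)
      ≡⟨ total-cong (λ S → weigh S (kCliqueIn? (suc j) A S)) (subsets n) ⟩
    total (λ S → sum λ x → ⟦ lookup S x ⟧ * ⟦ does (kCliqueIn? (suc j) A S) ⟧) (subsets n)
      ≡⟨ total-sum (λ x S → ⟦ lookup S x ⟧ * ⟦ does (kCliqueIn? (suc j) A S) ⟧) (subsets n) ⟩
    sum (λ x → total (λ S → ⟦ lookup S x ⟧ * ⟦ does (kCliqueIn? (suc j) A S) ⟧) (subsets n))
      ≡⟨ sum-cong-≗ (cliques-through j A) ⟩
    sum (λ x → ⟦ A x ⟧ * cliques j (λ z → A z ∧ adj G x z)) ∎
    where
    open ≤-Reasoning
    weigh : ∀ S (d : Dec (KCliqueIn (suc j) A S)) →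
      suc j * ⟦ does d ⟧ ≡ sum λ x → ⟦ lookup S x ⟧ * ⟦ does d ⟧
    weigh S (yes ((size , _) , _)) = trans
      (cong (_* 1) (trans (sym size) (size≡card S)))
      (*-distribʳ-sum 1 λ x → ⟦ lookup S x ⟧)
    weigh S (no _) = trans (*-zeroʳ (suc j))
      (sym (trans (sum-cong-≗ λ x → *-zeroʳ ⟦ lookup S x ⟧) (sum-replicate-zero n)))

  cliques-zero : ∀ A → cliques 0 A ≡ 1
  cliques-zero A = trans (total-cong (λ S → cong ⟦_⟧ (does-≡true (kCliqueIn? 0 A S)
      (λ ((size , _) , _) → dec-true (∣ S ∣ Data.Nat.Properties.≟ 0) size)
      (λ e → empty S (does⁻ (∣ S ∣ Data.Nat.Properties.≟ 0) e)))) (subsets n))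
    (one n)
    where

    absent : ∀ {n} {S : Subset n} {x} → ∣ S ∣ ≡ 0 → ¬ (x ∈ S)
    absent {S = outside ∷ S} size (there x∈) = absent size x∈

    empty : ∀ S → ∣ S ∣ ≡ 0 → KCliqueIn 0 A S
    empty S size = (size , λ x y x∈ → contradiction x∈ (absent size)) ,
      λ z z∈ → contradiction z∈ (absent size)

    one : ∀ n → total (λ S → ⟦ does (∣ S ∣ Data.Nat.Properties.≟ 0) ⟧) (subsets n) ≡ 1
    one zero    = refl
    one (suc n) = trans (total-subsets {n} _)
      (trans (cong₂ _+_ (total-* 0 (λ _ → 0) (subsets n)) refl) (one n))

  -- Since `adj G` has no loops, a counted tuple is an ordering of a clique. Fixing its first vertex
  -- and applying the handshake identity avoids any enumeration of permutations.
  tuples≡cliques : ∀ j A → tuples j (λ _ → A) (adj G) ≡ j ! * cliques j A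
  tuples≡cliques zero    A = sym (trans (+-identityʳ _) (cliques-zero A))
  tuples≡cliques (suc j) A = begin-equality
    sum (λ x → ⟦ A x ⟧ * tuples j (λ _ z → A z ∧ adj G x z) (adj G))
      ≡⟨ sum-cong-≗ (λ x → trans (cong (⟦ A x ⟧ *_) (tuples≡cliques j _))
           (x∙yz≈y∙xz ⟦ A x ⟧ (j !) (cliques j λ z → A z ∧ adj G x z))) ⟩
    sum (λ x → j ! * (⟦ A x ⟧ * cliques j λ z → A z ∧ adj G x z))
      ≡⟨ *-distribˡ-sum (j !) (λ x → ⟦ A x ⟧ * cliques j λ z → A z ∧ adj G x z) ⟨
    j ! * sum (λ x → ⟦ A x ⟧ * cliques j λ z → A z ∧ adj G x z)
      ≡⟨ cong (j ! *_) (cliques-handshake j A) ⟨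
    j ! * (suc j * cliques (suc j) A)
      ≡⟨ assoc (j !) (suc j) (cliques (suc j) A) ⟩
    (suc j) ! * cliques (suc j) A ∎
    where
    open ≤-Reasoning
    assoc : ∀ a b c → a * (b * c) ≡ b * a * c
    assoc = solve-∀

  tuples≡P : ∀ k → tuples k (λ _ → everything) (adj G) ≡ k ! * P k G
  tuples≡P k = trans (tuples≡cliques k everything) (cong (k ! *_) (sym (P≡cliques k)))

  cliques-≤ : ∀ j A → cliques j A ≤ n ^ j
  cliques-≤ j A = ≤-trans (m≤n*m (cliques j A) (j !) {{>-nonZero (1≤n! j)}})
    (≤-trans (≤-reflexive (sym (tuples≡cliques j A))) (tuples-≤ j _ _))

cliques-mono : (G H : Graph n) → ∀ j {A B} → (∀ z → A z ≡ true → B z ≡ true) →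
  (∀ u v → A u ≡ true → A v ≡ true → u ~[ G ] v → u ~[ H ] v) →
  cliques G j A ≤ cliques H j B
cliques-mono {n} G H j {A} {B} A⊆B G⊆H = total-mono (λ S → ⟦⟧-mono λ e → up S (does⁻ (kCliqueIn? G j A S) e)) (subsets n)
  where
  up : ∀ S → KCliqueIn G j A S → does (kCliqueIn? H j B S) ≡ true
  up S ((size , cl) , S⊆A) = dec-true (kCliqueIn? H j B S)
    ( (size , λ u v u∈ v∈ u≢v → G⊆H u v (Equivalence.to T-≡ (S⊆A u u∈))
                                  (Equivalence.to T-≡ (S⊆A v v∈)) (cl u v u∈ v∈ u≢v))
    , λ z z∈ → Equivalence.from T-≡ (A⊆B z (Equivalence.to T-≡ (S⊆A z z∈))))

-- Binomial coefficients and powers.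

C-absorb : ∀ n k → suc k * (suc n C suc k) ≡ suc n * (n C k)
C-absorb n       zero    = trans (+-identityʳ _) (trans (nC1≡n (suc n)) (sym (*-identityʳ (suc n))))
C-absorb zero    (suc k) = trans
  (cong (suc (suc k) *_) (k>n⇒nCk≡0 {1} {suc (suc k)} (s≤s (s≤s z≤n)))) (*-zeroʳ (suc (suc k)))
C-absorb (suc n) (suc k) = begin-equality
  suc (suc k) * (suc (suc n) C suc (suc k))
    ≡⟨ cong (suc (suc k) *_) (nCk+nC[k+1]≡[n+1]C[k+1] (suc n) (suc k)) ⟨
  suc (suc k) * (suc n C suc k + suc n C suc (suc k))
    ≡⟨ *-distribˡ-+ (suc (suc k)) (suc n C suc k) _ ⟩
  suc n C suc k + suc k * (suc n C suc k) + suc (suc k) * (suc n C suc (suc k))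
    ≡⟨ cong₂ (λ a b → suc n C suc k + a + b) (C-absorb n k) (C-absorb n (suc k)) ⟩
  suc n C suc k + suc n * (n C k) + suc n * (n C suc k)
    ≡⟨ regroup (suc n C suc k) (suc n) (n C k) (n C suc k) ⟩
  suc n C suc k + suc n * (n C k + n C suc k)
    ≡⟨ cong (λ a → suc n C suc k + suc n * a) (nCk+nC[k+1]≡[n+1]C[k+1] n k) ⟩
  suc (suc n) * (suc n C suc k) ∎
  where
  open ≤-Reasoning
  regroup : ∀ c n a b → c + n * a + n * b ≡ c + n * (a + b)
  regroup = solve-∀

-- This is (n + 1 - k) C(n + 1, k) = (n + 1) C(n, k) for k = r + 1, with the subtraction moved
-- across.
C-delete : ∀ n r → suc n * (n C suc r) + suc r * (suc n C suc r) ≡ suc n * (suc n C suc r)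
C-delete n r = begin-equality
  suc n * (n C suc r) + suc r * (suc n C suc r)
    ≡⟨ cong (suc n * (n C suc r) +_) (C-absorb n r) ⟩
  suc n * (n C suc r) + suc n * (n C r)
    ≡⟨ *-distribˡ-+ (suc n) (n C suc r) (n C r) ⟨
  suc n * (n C suc r + n C r)
    ≡⟨ cong (suc n *_) (trans (+-comm (n C suc r) (n C r)) (nCk+nC[k+1]≡[n+1]C[k+1] n r)) ⟩
  suc n * (suc n C suc r) ∎
  where open ≤-Reasoning

C-positive : ∀ n k → k ≤ n → 0 < n C k
C-positive n       zero    _         = s≤s z≤n
C-positive (suc n) (suc k) (s≤s k≤n) = ≤-trans (C-positive n k k≤n)
  (≤-trans (m≤m+n (n C k) (n C suc k)) (≤-reflexive (nCk+nC[k+1]≡[n+1]C[k+1] n k)))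

private
  falling-suc : ∀ n k → (suc k) ! * (suc n C suc k) ≡ suc n * (k ! * (n C k))
  falling-suc n k = begin-equality
    suc k * k ! * (suc n C suc k)   ≡⟨ regroup (suc k) (k !) _ ⟩
    k ! * (suc k * (suc n C suc k)) ≡⟨ cong (k ! *_) (C-absorb n k) ⟩
    k ! * (suc n * (n C k))         ≡⟨ x∙yz≈y∙xz (k !) (suc n) _ ⟩
    suc n * (k ! * (n C k))         ∎
    where
    open ≤-Reasoning
    regroup : ∀ a b c → a * b * c ≡ b * (a * c)
    regroup = solve-∀

-- The left side is a falling factorial; for k at most n its k factors lie between n - k and n.
falling-≤ : ∀ n k → k ! * (n C k) ≤ n ^ k
falling-≤ n       zero    = ≤-refl
falling-≤ zero    (suc k) = ≤-reflexive (trans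
  (cong ((suc k) ! *_) (k>n⇒nCk≡0 {0} {suc k} (s≤s z≤n))) (*-zeroʳ ((suc k) !)))
falling-≤ (suc n) (suc k) = begin
  (suc k) ! * (suc n C suc k) ≡⟨ falling-suc n k ⟩
  suc n * (k ! * (n C k))     ≤⟨ *-monoʳ-≤ (suc n) (falling-≤ n k) ⟩
  suc n * n ^ k               ≤⟨ *-monoʳ-≤ (suc n) (^-monoˡ-≤ k (n≤1+n n)) ⟩
  suc n * suc n ^ k           ∎
  where open ≤-Reasoning

falling-≥ : ∀ n k → (n ∸ k) ^ k ≤ k ! * (n C k)
falling-≥ n       zero    = ≤-refl
falling-≥ zero    (suc k) = z≤n
falling-≥ (suc n) (suc k) = begin
  (n ∸ k) * (n ∸ k) ^ k       ≤⟨ *-mono-≤ (≤-trans (m∸n≤m n k) (n≤1+n n)) (falling-≥ n k) ⟩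
  suc n * (k ! * (n C k))     ≡⟨ falling-suc n k ⟨
  (suc k) ! * (suc n C suc k) ∎
  where open ≤-Reasoning

2*nC2≤n² : ∀ n → 2 * (n C 2) ≤ n * n
2*nC2≤n² n = ≤-trans (falling-≤ n 2) (≤-reflexive (cong (n *_) (*-identityʳ n)))

private
  -- The mean value estimate N ^ k - w ^ k ≤ k d N ^ (k - 1), multiplied by N.
  pow-step : ∀ N w d k → w ≤ N → N ≤ w + d → N * N ^ k ≤ N * w ^ k + k * d * N ^ k
  pow-step N w d zero    w≤N N≤w+d = m≤m+n _ 0
  pow-step N w d (suc k) w≤N N≤w+d = begin
    N * (N * N ^ k)
      ≤⟨ *-monoʳ-≤ N (pow-step N w d k w≤N N≤w+d) ⟩
    N * (N * w ^ k + k * d * N ^ k)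
      ≡⟨ expand N (w ^ k) (k * d) (N ^ k) ⟩
    N * (N * w ^ k) + k * d * (N * N ^ k)
      ≤⟨ +-monoˡ-≤ _ (*-monoˡ-≤ (N * w ^ k) N≤w+d) ⟩
    (w + d) * (N * w ^ k) + k * d * (N * N ^ k)
      ≤⟨ +-monoˡ-≤ _ (≤-trans (≤-reflexive (*-distribʳ-+ (N * w ^ k) w d))
           (+-monoʳ-≤ _ (*-monoʳ-≤ d (*-monoʳ-≤ N (^-monoˡ-≤ k w≤N))))) ⟩
    w * (N * w ^ k) + d * (N * N ^ k) + k * d * (N * N ^ k)
      ≡⟨ collect N w d k (w ^ k) (N ^ k) ⟩
    N * (w * w ^ k) + suc k * d * (N * N ^ k) ∎
    where
    open ≤-Reasoning
    expand : ∀ N a b c → N * (N * a + b * c) ≡ N * (N * a) + b * (N * c)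
    expand = solve-∀
    collect : ∀ N w d k a b → w * (N * a) + d * (N * b) + k * d * (N * b) ≡
      N * (w * a) + (1 + k) * d * (N * b)
    collect = solve-∀

-- Allows n - m, n + m and n - k to be exchanged for n inside powers, at a relative error of 1 / M.
pow-close : ∀ M N w d k → w ≤ N → N ≤ w + d → M * (k * d) ≤ N → M * N ^ k ≤ M * w ^ k + N ^ k
pow-close M zero    w d k z≤n _ _ = m≤m+n (M * 0 ^ k) (0 ^ k)
pow-close M N@(suc _) w d k w≤N N≤w+d small = *-cancelˡ-≤ N (begin
  N * (M * N ^ k)
    ≡⟨ x∙yz≈y∙xz N M (N ^ k) ⟩
  M * (N * N ^ k)
    ≤⟨ *-monoʳ-≤ M (pow-step N w d k w≤N N≤w+d) ⟩
  M * (N * w ^ k + k * d * N ^ k)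
    ≡⟨ expand M N (w ^ k) (k * d) (N ^ k) ⟩
  N * (M * w ^ k) + M * (k * d) * N ^ k
    ≤⟨ +-monoʳ-≤ _ (*-monoˡ-≤ (N ^ k) small) ⟩
  N * (M * w ^ k) + N * N ^ k
    ≡⟨ *-distribˡ-+ N (M * w ^ k) (N ^ k) ⟨
  N * (M * w ^ k + N ^ k) ∎)
  where
  open ≤-Reasoning
  expand : ∀ M N a b c → M * (N * a + b * c) ≡ N * (M * a) + M * b * c
  expand = solve-∀

-- Cloning, and clique degrees in extremal graphs.

-- Replacing x by a clone of y adjacent to y is the expansion of G along the
-- map that sends x to y and fixes every other vertex.
module _ (G : Graph n) (x y : Fin n) where

  private
    σ : Fin n → Fin n
    σ z with z ≟ x
    ... | yes _ = y
    ... | no  _ = z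

    σ-x : σ x ≡ y
    σ-x with x ≟ x
    ... | yes _  = refl
    ... | no x≢x = contradiction refl x≢x

    σ-≢ : ∀ {z} → z ≢ x → σ z ≡ z
    σ-≢ {z} z≢x with z ≟ x
    ... | yes z≡x = contradiction z≡x z≢x
    ... | no _    = refl

  clone : Graph n
  clone = expansion G σ

  α-clone : α clone ≤ α G
  α-clone = α-expansion G σ

  -- Only cliques through x are new. Those avoiding y come from cliques in the neighbourhood of y.
  -- Those containing both twins exist because x and y are made adjacent to keep α from growing;
  -- there are at most n ^ r of them, one order below the degrees.
  cliques-clone : ∀ r → cliques clone (suc (suc r)) everything ≤
    cliques G (suc (suc r)) (λ z → everything z ∧ not (does (z ≟ x))) +
    (cliques G (suc r) (adj G y) + n ^ r)
  cliques-clone r = begin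
    cliques clone (suc (suc r)) everything
      ≡⟨ cliques-pascal clone (suc r) everything x ⟩
    cliques clone (suc (suc r)) (λ z → everything z ∧ not (does (z ≟ x))) +
    1 * cliques clone (suc r) (adj clone x)
      ≤⟨ +-mono-≤
           (cliques-mono clone G (suc (suc r)) (λ _ e → e) (λ u v eu ev → unclone (≢x u eu) (≢x v ev)))
           (≤-reflexive (*-identityˡ _)) ⟩
    cliques G (suc (suc r)) (λ z → everything z ∧ not (does (z ≟ x))) + cliques clone (suc r) (adj clone x)
      ≤⟨ +-monoʳ-≤ _ (begin
        cliques clone (suc r) (adj clone x)
          ≡⟨ cliques-pascal clone r (adj clone x) y ⟩
        cliques clone (suc r) (λ z → adj clone x z ∧ not (does (z ≟ y))) +
        ⟦ adj clone x y ⟧ * cliques clone r (λ z → adj clone x z ∧ adj clone y z)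
          ≤⟨ +-mono-≤
               (cliques-mono clone G (suc r) near-y λ u v eu ev → unclone (x≢ u eu) (x≢ v ev))
               (≤-trans (*-mono-≤ (⟦⟧≤1 (adj clone x y)) (cliques-≤ clone r _)) (≤-reflexive (*-identityˡ _))) ⟩
        cliques G (suc r) (adj G y) + n ^ r ∎) ⟩
    cliques G (suc (suc r)) (λ z → everything z ∧ not (does (z ≟ x))) +
    (cliques G (suc r) (adj G y) + n ^ r) ∎
    where
    open ≤-Reasoning
    ≢x : ∀ u → everything u ∧ not (does (u ≟ x)) ≡ true → u ≢ x
    ≢x u e u≡x = not-true e (dec-true (u ≟ x) u≡x)

    x≢ : ∀ u → adj clone x u ∧ not (does (u ≟ y)) ≡ true → u ≢ x
    x≢ u e u≡x = proj₁ (does⁻ (adj? clone x u) (∧-trueˡ e)) (sym u≡x)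

    unclone : ∀ {u v} → u ≢ x → v ≢ x → u ~[ clone ] v → u ~[ G ] v
    unclone u≢x v≢x (u≢v , inj₁ σu≡σv) =
      contradiction (trans (sym (σ-≢ u≢x)) (trans σu≡σv (σ-≢ v≢x))) u≢v
    unclone u≢x v≢x (_ , inj₂ σu~σv) = subst₂′ (σ-≢ u≢x) (σ-≢ v≢x) σu~σv
      where
      subst₂′ : ∀ {u u′ v v′} → u ≡ u′ → v ≡ v′ → u ~[ G ] v → u′ ~[ G ] v′
      subst₂′ refl refl e = e

    near-y : ∀ z → adj clone x z ∧ not (does (z ≟ y)) ≡ true → adj G y z ≡ true
    near-y z e with does⁻ (adj? clone x z) (∧-trueˡ e)
    ... | x≢z , inj₁ σx≡σz = contradiction
      (dec-true (z ≟ y) (trans (sym (σ-≢ (≢-sym x≢z))) (trans (sym σx≡σz) σ-x)))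
      (not-true (∧-trueʳ {adj clone x z} e))
    ... | x≢z , inj₂ σx~σz = dec-true (adj? G y z)
      (subst (λ w → w ~[ G ] z) σ-x (subst (σ x ~[ G ]_) (σ-≢ (≢-sym x≢z)) σx~σz))

extremal-degree : ∀ {r l} (G : Graph n) → α G < l → P (suc (suc r)) G ≡ f n (suc (suc r)) l →
  ∀ x y → cliques G (suc r) (adj G x) ≤ cliques G (suc r) (adj G y) + n ^ r
extremal-degree {n} {r} {l} G αG<l extremal x y = +-cancelˡ-≤ _ _ _ (begin
  rest + cliques G (suc r) (adj G x)
    ≡⟨ cong (rest +_) (*-identityˡ _) ⟨
  rest + 1 * cliques G (suc r) (adj G x)
    ≡⟨ cliques-pascal G (suc r) everything x ⟨
  cliques G (suc (suc r)) everything
    ≡⟨ P≡cliques G (suc (suc r)) ⟨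
  P (suc (suc r)) G
    ≡⟨ extremal ⟩
  f n (suc (suc r)) l
    ≤⟨ f-minimal n (suc (suc r)) l (clone G x y) (≤-<-trans (α-clone G x y) αG<l) ⟩
  P (suc (suc r)) (clone G x y)
    ≡⟨ P≡cliques (clone G x y) (suc (suc r)) ⟩
  cliques (clone G x y) (suc (suc r)) everything
    ≤⟨ cliques-clone G x y r ⟩
  rest + (cliques G (suc r) (adj G y) + n ^ r) ∎)
  where
  open ≤-Reasoning
  rest = cliques G (suc (suc r)) λ z → everything z ∧ not (does (z ≟ x))

-- The comparison of degrees is averaged over y: the ordered degrees add up to k ! times the number
-- of k-cliques, k = r + 2.
extremal-tuples : ∀ {r l} (G : Graph n) → α G < l → P (suc (suc r)) G ≡ f n (suc (suc r)) l →
  ∀ x → n * tuples (suc r) (λ _ → adj G x) (adj G) ≤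
    (suc (suc r)) ! * f n (suc (suc r)) l + (suc r) ! * n ^ suc r
extremal-tuples {n} {r} {l} G αG<l extremal x = begin
  n * tuples (suc r) (λ _ → adj G x) (adj G)
    ≡⟨ sum-const n _ ⟨
  sum {n} (λ _ → tuples (suc r) (λ _ → adj G x) (adj G))
    ≤⟨ sum-mono (λ y → begin
      tuples (suc r) (λ _ → adj G x) (adj G)
        ≡⟨ tuples≡cliques G (suc r) (adj G x) ⟩
      (suc r) ! * cliques G (suc r) (adj G x)
        ≤⟨ *-monoʳ-≤ ((suc r) !) (extremal-degree G αG<l extremal x y) ⟩
      (suc r) ! * (cliques G (suc r) (adj G y) + n ^ r)
        ≡⟨ *-distribˡ-+ ((suc r) !) (cliques G (suc r) (adj G y)) (n ^ r) ⟩
      (suc r) ! * cliques G (suc r) (adj G y) + (suc r) ! * n ^ r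
        ≡⟨ cong (_+ (suc r) ! * n ^ r) (trans (+-identityʳ _) (tuples≡cliques G (suc r) (adj G y))) ⟨
      1 * tuples (suc r) (λ _ → adj G y) (adj G) + (suc r) ! * n ^ r ∎) ⟩
  sum (λ y → 1 * tuples (suc r) (λ _ → adj G y) (adj G) + (suc r) ! * n ^ r)
    ≡⟨ ∑-distrib-+ (λ y → 1 * tuples (suc r) (λ _ → adj G y) (adj G)) _ ⟩
  tuples (suc (suc r)) (λ _ → everything) (adj G) + sum {n} (λ _ → (suc r) ! * n ^ r)
    ≡⟨ cong₂ _+_
         (trans (tuples≡P G (suc (suc r))) (cong ((suc (suc r)) ! *_) extremal))
         (trans (sum-const n _) (x∙yz≈y∙xz n ((suc r) !) (n ^ r))) ⟩
  (suc (suc r)) ! * f n (suc (suc r)) l + (suc r) ! * n ^ suc r ∎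
  where open ≤-Reasoning

-- Vertex deletion and monotonicity of the minimal density.

P-delete : ∀ r (G : Graph (suc n)) v →
  P (suc r) (delete v G) + cliques G r (adj G v) ≤ P (suc r) G
P-delete r G v = begin
  P (suc r) G⁻ + cliques G r (adj G v)
    ≤⟨ +-monoˡ-≤ _ (*-cancelˡ-≤ ((suc r) !) {{>-nonZero (1≤n! (suc r))}} (begin
      (suc r) ! * P (suc r) G⁻
        ≡⟨ tuples≡P G⁻ (suc r) ⟨
      tuples (suc r) (λ _ → everything) (adj G⁻)
        ≤⟨ tuples-mono (suc r) {As = λ _ → everything} (λ _ x _ → cong not (dec-false (punchIn v x ≟ v) (punchInᵢ≢i v x)))
             (λ _ _ e → e) ⟩
      tuples (suc r) (λ _ x → others (punchIn v x)) (λ x y → adj G (punchIn v x) (punchIn v y))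
        ≡⟨ tuples-punchIn (suc r) v (λ _ → others) (adj G)
             (λ _ → cong not (dec-true (v ≟ v) refl)) ⟨
      tuples (suc r) (λ _ → others) (adj G)
        ≡⟨ tuples≡cliques G (suc r) others ⟩
      (suc r) ! * cliques G (suc r) others ∎)) ⟩
  cliques G (suc r) others + cliques G r (adj G v)
    ≡⟨ cong (cliques G (suc r) others +_) (*-identityˡ _) ⟨
  cliques G (suc r) others + 1 * cliques G r (adj G v)
    ≡⟨ cliques-pascal G r everything v ⟨
  cliques G (suc r) everything
    ≡⟨ P≡cliques G (suc r) ⟨
  P (suc r) G ∎
  where
  open ≤-Reasoning
  G⁻ = delete v G
  others = λ z → everything z ∧ not (does (z ≟ v))

-- Each vertex is deleted in turn from an extremal graph on n + 1 vertices. A k-clique, k = r + 1,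
-- survives n + 1 - k of the deletions; the subtracted k stands on the left.
f-delete : ∀ n r l → 2 ≤ l → suc n * f n (suc r) l + suc r * f (suc n) (suc r) l ≤ suc n * f (suc n) (suc r) l
f-delete n r l 2≤l with f-attained (suc n) (suc r) l 2≤l
... | G , αG<l , extremal = begin
  suc n * f n (suc r) l + suc r * f (suc n) (suc r) l
    ≡⟨ cong₂ _+_ (sym (sum-const (suc n) (f n (suc r) l)))
         (trans (cong (suc r *_) (trans (sym extremal) (P≡cliques G (suc r))))
           (cliques-handshake G r everything)) ⟩
  sum {suc n} (λ _ → f n (suc r) l) + sum (λ v → 1 * cliques G r (adj G v))
    ≡⟨ ∑-distrib-+ (λ _ → f n (suc r) l) (λ v → 1 * cliques G r (adj G v)) ⟨
  sum (λ v → f n (suc r) l + 1 * cliques G r (adj G v))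
    ≤⟨ sum-bound (λ v → begin
      f n (suc r) l + 1 * cliques G r (adj G v)
        ≤⟨ +-mono-≤ (f-minimal n (suc r) l (delete v G) (≤-<-trans (α-delete v G) αG<l))
             (≤-reflexive (*-identityˡ _)) ⟩
      P (suc r) (delete v G) + cliques G r (adj G v)
        ≤⟨ P-delete r G v ⟩
      P (suc r) G
        ≡⟨ extremal ⟩
      f (suc n) (suc r) l ∎) ⟩
  suc n * f (suc n) (suc r) l ∎
  where open ≤-Reasoning

-- `f-delete` and `C-delete` have the same shape, one an inequality and one an equation. Dividing
-- them gives the monotonicity of `c` in cross-multiplied form.
f-ratio : ∀ n r l → 2 ≤ l → f n (suc r) l * (suc n C suc r) ≤ f (suc n) (suc r) l * (n C suc r)
f-ratio n r l 2≤l = *-cancelˡ-≤ (suc n) (+-cancelʳ-≤ (suc r * f′ * C′) _ _ (begin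
  suc n * (f₀ * C′) + suc r * f′ * C′     ≡⟨ left (suc n) f₀ C′ (suc r) f′ ⟩
  (suc n * f₀ + suc r * f′) * C′          ≤⟨ *-monoˡ-≤ C′ (f-delete n r l 2≤l) ⟩
  suc n * f′ * C′                         ≡⟨ mid (suc n) f′ C′ ⟩
  f′ * (suc n * C′)                       ≡⟨ cong (f′ *_) (C-delete n r) ⟨
  f′ * (suc n * (n C suc r) + suc r * C′) ≡⟨ right f′ (suc n) (n C suc r) (suc r) C′ ⟩
  suc n * (f′ * (n C suc r)) + suc r * f′ * C′ ∎))
  where
  open ≤-Reasoning
  f₀ = f n (suc r) l
  f′ = f (suc n) (suc r) l
  C′ = suc n C suc r
  left : ∀ n f c r g → n * (f * c) + r * g * c ≡ (n * f + r * g) * c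
  left = solve-∀
  mid : ∀ n g c → n * g * c ≡ g * (n * c)
  mid = solve-∀
  right : ∀ g n c r d → g * (n * c + r * d) ≡ n * (g * c) + r * g * d
  right = solve-∀

-- Edit distance from an expansion.

module _ (G H : Graph n) where

  -- Repeats the test local to `∣E_△E_∣`, so that the count there unfolds to it by definition.
  differ? : ∀ x y → Dec (x Fin.< y ×
    ((x ~[ G ] y × ¬ (x ~[ H ] y)) ⊎ (x ~[ H ] y × ¬ (x ~[ G ] y))))
  differ? x y = (x Fin.<? y) ×-dec
    ((adj? G x y ×-dec ¬? (adj? H x y)) ⊎-dec (adj? H x y ×-dec ¬? (adj? G x y)))

  differs : Fin n → Fin n → Bool
  differs x y = does (differ? x y)

  △≡sum : ∣E G △E H ∣ ≡ sum λ x → sum λ y → ⟦ differs x y ⟧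
  △≡sum = trans (count≡total _ (cartesianProduct (allFin n) (allFin n)))
    (trans (total-product (λ (x , y) → ⟦ differs x y ⟧) _,_ (allFin n) (allFin n))
      (trans (total-tabulate (λ x → total (λ y → ⟦ differs x y ⟧) (allFin n)) id)
        (sum-cong-≗ λ x → total-tabulate (λ y → ⟦ differs x y ⟧) id)))

  differs-cover : ∀ x y → adj G x y ≢ adj H x y → 1 ≤ ⟦ differs x y ⟧ + ⟦ differs y x ⟧
  differs-cover x y G≢H with <-cmp x y
  ... | tri< x<y _ _ = ≤-trans (≤-reflexive (cong ⟦_⟧ (sym e))) (m≤m+n _ _)
    where
    e : differs x y ≡ true
    e = dec-true (differ? x y) (x<y , opposite (adj? G x y) (adj? H x y) G≢H)
      where
      opposite : ∀ {A B : Set} (a? : Dec A) (b? : Dec B) → does a? ≢ does b? →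
        (A × ¬ B) ⊎ (B × ¬ A)
      opposite (yes a) (yes b) G≢H = contradiction refl G≢H
      opposite (yes a) (no ¬b) G≢H = inj₁ (a , ¬b)
      opposite (no ¬a) (yes b) G≢H = inj₂ (b , ¬a)
      opposite (no ¬a) (no ¬b) G≢H = contradiction refl G≢H
  ... | tri≈ _ refl _ = contradiction
    (trans (dec-false (adj? G x x) (Graph.~-irr G refl)) (sym (dec-false (adj? H x x) (Graph.~-irr H refl)))) G≢H
  ... | tri> _ _ y<x = ≤-trans (≤-reflexive (cong ⟦_⟧ (sym e))) (m≤n+m _ _)
    where
    e : differs y x ≡ true
    e = dec-true (differ? y x) (y<x , opposite (adj? G x y) (adj? H x y) G≢H)
      where
      opposite : (a? : Dec (x ~[ G ] y)) (b? : Dec (x ~[ H ] y)) → does a? ≢ does b? →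
        (y ~[ G ] x × ¬ (y ~[ H ] x)) ⊎ (y ~[ H ] x × ¬ (y ~[ G ] x))
      opposite (yes a) (yes b) G≢H = contradiction refl G≢H
      opposite (yes a) (no ¬b) G≢H = inj₁ (Graph.~-sym G a , ¬b ∘ Graph.~-sym H)
      opposite (no ¬a) (yes b) G≢H = inj₂ (Graph.~-sym H b , ¬a ∘ Graph.~-sym G)
      opposite (no ¬a) (no ¬b) G≢H = contradiction refl G≢H

  pairs-≤ : (Z : Fin n → Fin n → Bool) →
    (∀ x y → Z x y ≡ true → x ≢ y → adj G x y ≢ adj H x y) →
    sum (λ x → card (Z x)) ≤ n + 2 * ∣E G △E H ∣
  pairs-≤ Z Z⇒≢ = begin
    sum (λ x → sum λ y → ⟦ Z x y ⟧)
      ≤⟨ sum-mono (λ x → sum-mono λ y → cover x y) ⟩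
    sum (λ x → sum λ y → ⟦ does (x ≟ y) ⟧ + (⟦ differs x y ⟧ + ⟦ differs y x ⟧))
      ≡⟨ sum-cong-≗ (λ x → trans (∑-distrib-+ (λ y → ⟦ does (x ≟ y) ⟧) (λ y → ⟦ differs x y ⟧ + ⟦ differs y x ⟧))
           (cong₂ _+_ (sum-δ₁ x) (∑-distrib-+ (λ y → ⟦ differs x y ⟧) (λ y → ⟦ differs y x ⟧)))) ⟩
    sum (λ x → 1 + (row x + column x))
      ≡⟨ trans (∑-distrib-+ (λ _ → 1) (λ x → row x + column x))
           (cong₂ _+_ (trans (sum-const n 1) (*-identityʳ n)) (∑-distrib-+ row column)) ⟩
    n + (sum row + sum column)
      ≡⟨ cong (n +_) (cong₂ _+_ (sym △≡sum)
           (trans (∑-comm λ x y → ⟦ differs y x ⟧) (trans (sym △≡sum) (sym (+-identityʳ _))))) ⟩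
    n + 2 * ∣E G △E H ∣ ∎
    where
    open ≤-Reasoning
    row    = λ x → sum λ y → ⟦ differs x y ⟧
    column = λ x → sum λ y → ⟦ differs y x ⟧

    cover : ∀ x y → ⟦ Z x y ⟧ ≤ ⟦ does (x ≟ y) ⟧ + (⟦ differs x y ⟧ + ⟦ differs y x ⟧)
    cover x y with Z x y in e
    ... | false = z≤n
    ... | true with x ≟ y
    ...   | yes _  = s≤s z≤n
    ...   | no x≢y = differs-cover x y (Z⇒≢ x y e x≢y)

module _ (F : Graph m) (V : Fin n → Fin m) (G : Graph n) where

  -- The expansion with a loop at every vertex, which makes it an exact blow-up of `closed F`. These
  -- loops are missing from G and are counted in `missing`.
  linked : Fin n → Fin n → Bool
  linked x y = closed F (V x) (V y)

  private
    E : Graph n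
    E = expansion F V

  adj-expansion : ∀ x y → x ≢ y → adj E x y ≡ linked x y
  adj-expansion x y x≢y = does-≡true (adj? E x y) (closed⁺ F ∘ proj₂) λ e → x≢y , closed⁻ F e

  -- `spurious` is phrased through complements because it is the error in the relation of
  -- non-adjacency, by which independent tuples are counted.
  missing spurious : ℕ
  missing  = excess linked (adj G)
  spurious = excess (λ x y → not (linked x y)) (λ x y → not (adj G x y))

  missing-≤ : missing ≤ n + 2 * ∣E E △E G ∣
  missing-≤ = pairs-≤ E G (λ x y → linked x y ∧ not (adj G x y)) λ x y e x≢y same →
    not-true (∧-trueʳ {linked x y} e) (trans (sym same) (trans (adj-expansion x y x≢y) (∧-trueˡ e)))

  spurious-≤ : spurious ≤ n + 2 * ∣E E △E G ∣
  spurious-≤ = pairs-≤ E G (λ x y → not (linked x y) ∧ not (not (adj G x y))) λ x y e x≢y same →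
    not-true (∧-trueʳ {not (linked x y)} e)
      (cong not (trans (sym same) (trans (adj-expansion x y x≢y) (not-false (∧-trueˡ e)))))
    where
    not-false : ∀ {b} → not b ≡ true → b ≡ false
    not-false {false} _ = refl

  -- At least (n / g) ^ p tuples can be picked from the sets W a, all with pairwise non-linked
  -- entries. Spurious edges destroy at most p * p * `spurious` * n ^ (p - 2) of them, which by
  -- hypothesis is fewer, so an independent tuple survives.
  transversal : ∀ p (φ : Fin p → Fin m) → IndependentFamily F φ →
    (W : Fin p → Fin n → Bool) → (∀ a x → W a x ≡ true → V x ≡ φ a) →
    ∀ g → (∀ a → n ≤ g * card (W a)) → p * p * g ^ p * spurious < n * n →
    Σ (Fin p → Fin n) λ ψ → (∀ a → W a (ψ a) ≡ true) × IndependentFamily G ψ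
  transversal p φ ind W W⊆V g large few
    with tuples p W (λ x y → not (adj G x y)) in count
  ... | zero = contradiction (begin-strict
      n * n * n ^ p
        ≤⟨ *-monoʳ-≤ (n * n) (tuples-product p W apart n g full large) ⟩
      n * n * (g ^ p * tuples p W apart)
        ≡⟨ x∙yz≈y∙xz (n * n) (g ^ p) (tuples p W apart) ⟩
      g ^ p * (n * n * tuples p W apart)
        -- The sets W a are unchanged, so d = 0 and only pairs are lost.
        ≤⟨ *-monoʳ-≤ (g ^ p) (tuples-perturb p W W apart (λ x y → not (adj G x y)) 0
             (λ a → ≤-reflexive (trans (sum-cong-≗ λ z → none (W a z)) (sum-replicate-zero n)))) ⟩
      g ^ p * (n * n * tuples p W (λ x y → not (adj G x y)) + (p * 0 * n ^ suc p + p * p * spurious * n ^ p))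
        ≡⟨ cong (λ c → g ^ p * (n * n * c + (p * 0 * n ^ suc p + p * p * spurious * n ^ p))) count ⟩
      g ^ p * (n * n * 0 + (p * 0 * n ^ suc p + p * p * spurious * n ^ p))
        ≡⟨ collect (g ^ p) (n * n) p (n ^ suc p) spurious (n ^ p) ⟩
      p * p * g ^ p * spurious * n ^ p
        <⟨ *-monoˡ-< (n ^ p) {{n^p≢0}} few ⟩
      n * n * n ^ p ∎) (n≮n _)
    where
    open ≤-Reasoning
    apart = λ x y → not (linked x y)

    n^p≢0 : NonZero (n ^ p)
    n^p≢0 = m^n≢0 n p {{n≢0 n few}}
      where
      n≢0 : ∀ n {c} → c < n * n → NonZero n
      n≢0 (suc n) _ = _

    none : ∀ b → ⟦ b ∧ not b ⟧ ≡ 0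
    none true  = refl
    none false = refl

    full : ∀ a b x y → a ≢ b → W a x ≡ true → W b y ≡ true → apart x y ≡ true
    full a b x y a≢b Wx Wy = cong not (≢true λ e → split (closed⁻ F e))
      where
      split : ¬ (V x ≡ V y ⊎ V x ~[ F ] V y)
      split rewrite W⊆V a x Wx | W⊆V b y Wy = λ
        { (inj₁ e) → proj₁ (ind a b a≢b) e
        ; (inj₂ e) → proj₂ (ind a b a≢b) e }

    collect : ∀ g N p M s q → g * (N * 0 + (p * 0 * M + p * p * s * q)) ≡ p * p * g * s * q
    collect = solve-∀
  ... | suc _ with tuples-witness p W (λ x y → not (adj G x y))
                  (λ x y e → cong not (dec-false (adj? G y x)
                    λ y~x → not-true e (dec-true (adj? G x y) (Graph.~-sym G y~x))))
                  (subst (0 <_) (sym count) (s≤s z≤n))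
  ...   | ψ , in-W , nonadjacent = ψ , in-W , λ a b a≢b →
    (λ ψa≡ψb → proj₁ (ind a b a≢b)
      (trans (sym (W⊆V a (ψ a) (in-W a))) (trans (cong V ψa≡ψb) (W⊆V b (ψ b) (in-W b)))))
    , λ ψa~ψb → not-true (nonadjacent a b a≢b) (dec-true (adj? G (ψ a) (ψ b)) ψa~ψb)

  -- The clique degree of a vertex, seen through the partition.

  missed : (Fin m → Bool) → Fin n → ℕ
  missed X x = card λ z → X (V z) ∧ not (adj G x z)

  -- The parts in X and the set B carry disjoint collections of linked tuples. As B consists of
  -- neighbours of x, only vertices in the parts of X are lost on restriction to the neighbourhood
  -- of x. The set B serves to charge neighbours of x outside X.
  degree-lower : ∀ r (X : Fin m → Bool) (B : Fin n → Bool) x →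
    (∀ z → B z ≡ true → X (V z) ≡ false) → (∀ z → B z ≡ true → adj G x z ≡ true) →
    (∀ y z → B y ≡ true → B z ≡ true → linked y z ≡ true) →
    n * n * (tuples (suc r) (λ _ z → X (V z)) linked + card B ^ suc r) ≤
    n * n * tuples (suc r) (λ _ → adj G x) (adj G) +
      (suc r * missed X x * n ^ suc (suc r) + suc r * suc r * missing * n ^ suc r)
  degree-lower r X B x B∩X B⊆N B-linked = begin
    n * n * (tuples (suc r) (λ _ z → X (V z)) linked + card B ^ suc r)
      ≤⟨ *-monoʳ-≤ (n * n) (+-monoʳ-≤ (tuples (suc r) (λ _ z → X (V z)) linked) B-tuples) ⟩
    n * n * (tuples (suc r) (λ _ z → X (V z)) linked + tuples (suc r) (λ _ → B) linked)
      ≤⟨ *-monoʳ-≤ (n * n) (tuples-super r (X ∘ V) B X∪B linked λ z → disjoint (X (V z)) (B z) (B∩X z)) ⟩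
    n * n * tuples (suc r) (λ _ → X∪B) linked
      ≤⟨ tuples-perturb (suc r) (λ _ → X∪B) (λ _ → adj G x) linked (adj G) (missed X x)
           (λ _ → sum-mono λ z → uncovered (X (V z)) (B z) (adj G x z) (B⊆N z)) ⟩
    n * n * tuples (suc r) (λ _ → adj G x) (adj G) +
      (suc r * missed X x * n ^ suc (suc r) + suc r * suc r * missing * n ^ suc r) ∎
    where
    open ≤-Reasoning
    X∪B = λ z → X (V z) ∨ B z

    B-tuples : card B ^ suc r ≤ tuples (suc r) (λ _ → B) linked
    B-tuples = ≤-trans
      (tuples-product (suc r) (λ _ → B) linked (card B) 1
        (λ _ _ y z _ → B-linked y z) (λ _ → ≤-reflexive (sym (*-identityˡ (card B)))))
      (≤-reflexive (trans (cong (_* tuples (suc r) (λ _ → B) linked) (^-zeroˡ (suc r))) (*-identityˡ _)))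

    disjoint : ∀ a b → (b ≡ true → a ≡ false) → ⟦ a ⟧ + ⟦ b ⟧ ≤ ⟦ a ∨ b ⟧
    disjoint true  true  imp with () ← imp refl
    disjoint true  false _ = ≤-refl
    disjoint false b     _ = ≤-refl

    uncovered : ∀ a b c → (b ≡ true → c ≡ true) → ⟦ (a ∨ b) ∧ not c ⟧ ≤ ⟦ a ∧ not c ⟧
    uncovered true  b     c     _   = ≤-refl
    uncovered false true  true  _   = ≤-refl
    uncovered false true  false imp with () ← imp refl
    uncovered false false c     _   = ≤-refl

-- Here N = n ^ r, W = (n ∸ m) ^ r, tx is the number of r-tuples that complete
-- a vertex to a clique, and TX + β bounds it from below up to perturbation.
degree-arithmetic : ∀ n N W A D K t tx TX β r u b c → 0 < n →
  n * n * (TX + β) ≤ n * n * tx + (r * u * (n * N) + r * r * b * N) →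
  W * A ≤ D * TX → n * tx ≤ t + c * N →
  4 * K * A * N ≤ 4 * K * A * W + N →
  4 * K * D * c ≤ n → 4 * K * D * r * u ≤ n → 4 * K * D * (r * r) * b ≤ n * n →
  K * (n * (N * A + D * β)) ≤ K * D * t + n * N
degree-arithmetic n N W A D K t tx TX β r u b c 0<n lower blow upper close c-small u-small b-small =
  -- Four errors cost at most a quarter of n * N each: the rounding of part sizes (`close`), the
  -- clones (`c-small`), the non-neighbours of x (`u-small`) and the missing pairs (`b-small`).
  *-cancelˡ-≤ (4 * n * n) {{m*n≢0 (4 * n) n {{m*n≢0 4 n}}}} (begin
  4 * n * n * (K * (n * (N * A + D * β)))
    ≡⟨ e₁ n K N A D β ⟩
  n * n * n * (4 * K * A * N) + 4 * K * D * (n * (n * n * β))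
    ≤⟨ +-monoˡ-≤ _ (*-monoʳ-≤ (n * n * n) close) ⟩
  n * n * n * (4 * K * A * W + N) + 4 * K * D * (n * (n * n * β))
    ≡⟨ e₂ n K N A D β W ⟩
  4 * K * (n * n * n) * (W * A) + 4 * K * D * (n * (n * n * β)) + n * n * n * N
    ≤⟨ +-monoˡ-≤ _ (+-monoˡ-≤ _ (*-monoʳ-≤ (4 * K * (n * n * n)) blow)) ⟩
  4 * K * (n * n * n) * (D * TX) + 4 * K * D * (n * (n * n * β)) + n * n * n * N
    ≡⟨ e₃ n K N D β TX ⟩
  4 * K * D * n * (n * n * (TX + β)) + n * n * n * N
    ≤⟨ +-monoˡ-≤ _ (*-monoʳ-≤ (4 * K * D * n) lower) ⟩
  4 * K * D * n * (n * n * tx + (r * u * (n * N) + r * r * b * N)) + n * n * n * N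
    ≡⟨ e₄ n K N D tx r u b ⟩
  4 * K * D * (n * n) * (n * tx) + (4 * K * D * r * u * (n * n * N) + 4 * K * D * (r * r) * b * (n * N)) + n * n * n * N
    ≤⟨ +-monoˡ-≤ _ (+-mono-≤ (*-monoʳ-≤ (4 * K * D * (n * n)) upper)
         (+-mono-≤ (*-monoˡ-≤ (n * n * N) u-small) (*-monoˡ-≤ (n * N) b-small))) ⟩
  4 * K * D * (n * n) * (t + c * N) + (n * (n * n * N) + n * n * (n * N)) + n * n * n * N
    ≡⟨ e₅ n K N D t c ⟩
  4 * n * n * (K * D * t) + (4 * K * D * c * (n * n * N) + 3 * (n * n * n * N))
    ≤⟨ +-monoʳ-≤ (4 * n * n * (K * D * t)) (+-monoˡ-≤ (3 * (n * n * n * N)) (*-monoˡ-≤ (n * n * N) c-small)) ⟩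
  4 * n * n * (K * D * t) + (n * (n * n * N) + 3 * (n * n * n * N))
    ≡⟨ e₆ n K N D t ⟩
  4 * n * n * (K * D * t + n * N) ∎)
  where
  open ≤-Reasoning
  instance
    n≢0 : NonZero n
    n≢0 = >-nonZero 0<n
  e₁ : ∀ n K N A D β → 4 * n * n * (K * (n * (N * A + D * β))) ≡
    n * n * n * (4 * K * A * N) + 4 * K * D * (n * (n * n * β))
  e₁ = solve-∀
  e₂ : ∀ n K N A D β W → n * n * n * (4 * K * A * W + N) + 4 * K * D * (n * (n * n * β)) ≡
    4 * K * (n * n * n) * (W * A) + 4 * K * D * (n * (n * n * β)) + n * n * n * N
  e₂ = solve-∀
  e₃ : ∀ n K N D β TX → 4 * K * (n * n * n) * (D * TX) + 4 * K * D * (n * (n * n * β)) + n * n * n * N ≡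
    4 * K * D * n * (n * n * (TX + β)) + n * n * n * N
  e₃ = solve-∀
  e₄ : ∀ n K N D tx r u b →
    4 * K * D * n * (n * n * tx + (r * u * (n * N) + r * r * b * N)) + n * n * n * N ≡
    4 * K * D * (n * n) * (n * tx) + (4 * K * D * r * u * (n * n * N) + 4 * K * D * (r * r) * b * (n * N)) + n * n * n * N
  e₄ = solve-∀
  e₅ : ∀ n K N D t c →
    4 * K * D * (n * n) * (t + c * N) + (n * (n * n * N) + n * n * (n * N)) + n * n * n * N ≡
    4 * n * n * (K * D * t) + (4 * K * D * c * (n * n * N) + 3 * (n * n * n * N))
  e₅ = solve-∀
  e₆ : ∀ n K N D t → 4 * n * n * (K * D * t) + (n * (n * n * N) + 3 * (n * n * n * N)) ≡
    4 * n * n * (K * D * t + n * N)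
  e₆ = solve-∀

-- Passage between rational and integer inequalities.

private
  ÷ᵘ : ∀ a b → toℚᵘ (a ÷ suc b) ℚᵘ.≃ mkℚᵘ (ℤ.+ a) b
  ÷ᵘ a b = ℚ.toℚᵘ-fromℚᵘ (mkℚᵘ (ℤ.+ a) b)

  ≤ᵘ⁺ : ∀ {a b c d} → a * suc d ≤ c * suc b → mkℚᵘ (ℤ.+ a) b ℚᵘ.≤ mkℚᵘ (ℤ.+ c) d
  ≤ᵘ⁺ {a} {b} {c} {d} le = *≤* (subst₂ ℤ._≤_ (ℤ.pos-* a (suc d)) (ℤ.pos-* c (suc b)) (ℤ.+≤+ le))

  ≤ᵘ⁻ : ∀ {a b c d} → mkℚᵘ (ℤ.+ a) b ℚᵘ.≤ mkℚᵘ (ℤ.+ c) d → a * suc d ≤ c * suc b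
  ≤ᵘ⁻ {a} {b} {c} {d} (*≤* le) = ℤ.drop‿+≤+
    (subst₂ ℤ._≤_ (sym (ℤ.pos-* a (suc d))) (sym (ℤ.pos-* c (suc b))) le)

÷-mono : ∀ {a b c d} → 0 < b → 0 < d → a * d ≤ c * b → a ÷ b ℚ.≤ c ÷ d
÷-mono {a} {suc b} {c} {suc d} _ _ le = ℚ.toℚᵘ-cancel-≤ (begin
  toℚᵘ (a ÷ suc b) ≃⟨ ÷ᵘ a b ⟩
  mkℚᵘ (ℤ.+ a) b     ≤⟨ ≤ᵘ⁺ le ⟩
  mkℚᵘ (ℤ.+ c) d     ≃⟨ ÷ᵘ c d ⟨
  toℚᵘ (c ÷ suc d) ∎)
  where open ℚᵘ.≤-Reasoning

÷-gap : ∀ {a b q c d} → 0 < b → 0 < d → a ÷ b ℚ.+ 1 ÷ suc q ℚ.≤ c ÷ d →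
  (a * suc q + b) * d ≤ c * (b * suc q)
÷-gap {a} {suc b} {q} {c} {suc d} _ _ gap = ≤-trans
  (≤-reflexive (cong (λ s → (a * suc q + s) * suc d) (sym (+-identityʳ (suc b)))))
  (≤ᵘ⁻ (begin
  mkℚᵘ (ℤ.+ (a * suc q + 1 * suc b)) (q + b * suc q)
    ≡⟨ cong (λ i → mkℚᵘ i (q + b * suc q)) (trans (ℤ.pos-+ (a * suc q) (1 * suc b))
         (cong₂ ℤ._+_ (ℤ.pos-* a (suc q)) (ℤ.pos-* 1 (suc b)))) ⟩
  mkℚᵘ (ℤ.+ a) b ℚᵘ.+ mkℚᵘ (ℤ.+ 1) q
    ≃⟨ ℚᵘ.+-cong (÷ᵘ a b) (÷ᵘ 1 q) ⟨
  toℚᵘ (a ÷ suc b) ℚᵘ.+ toℚᵘ (1 ÷ suc q)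
    ≃⟨ ℚ.toℚᵘ-homo-+ (a ÷ suc b) (1 ÷ suc q) ⟨
  toℚᵘ (a ÷ suc b ℚ.+ 1 ÷ suc q)
    ≤⟨ ℚ.toℚᵘ-mono-≤ gap ⟩
  toℚᵘ (c ÷ suc d)
    ≃⟨ ÷ᵘ c d ⟩
  mkℚᵘ (ℤ.+ c) d ∎))
  where open ℚᵘ.≤-Reasoning

private
  fromℕ-≤ᵘ : ∀ {a q c} → fromℕ a ℚ.≤ 1 ÷ suc q ℚ.* fromℕ c →
    mkℚᵘ (ℤ.+ a) 0 ℚᵘ.≤ mkℚᵘ (ℤ.+ (1 * c)) (q * 1)
  fromℕ-≤ᵘ {a} {q} {c} le = begin
    mkℚᵘ (ℤ.+ a) 0                         ≃⟨ ÷ᵘ a 0 ⟨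
    toℚᵘ (fromℕ a)                       ≤⟨ ℚ.toℚᵘ-mono-≤ le ⟩
    toℚᵘ (1 ÷ suc q ℚ.* fromℕ c)         ≃⟨ ℚ.toℚᵘ-homo-* (1 ÷ suc q) (fromℕ c) ⟩
    toℚᵘ (1 ÷ suc q) ℚᵘ.* toℚᵘ (fromℕ c) ≃⟨ ℚᵘ.*-cong (÷ᵘ 1 q) (÷ᵘ c 0) ⟩
    mkℚᵘ (ℤ.+ 1 ℤ.* ℤ.+ c) (q * 1)           ≡⟨ cong (λ i → mkℚᵘ i (q * 1)) (ℤ.pos-* 1 c) ⟨
    mkℚᵘ (ℤ.+ (1 * c)) (q * 1)             ∎
    where open ℚᵘ.≤-Reasoning

fromℕ-≤ : ∀ {a q c} → fromℕ a ℚ.≤ 1 ÷ suc q ℚ.* fromℕ c → suc q * a ≤ c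
fromℕ-≤ {a} {q} {c} le = begin
  suc q * a       ≡⟨ cong (λ s → suc s * a) (*-identityʳ q) ⟨
  suc (q * 1) * a ≡⟨ *-comm (suc (q * 1)) a ⟩
  a * suc (q * 1) ≤⟨ ≤ᵘ⁻ {a} {0} {1 * c} {q * 1} (fromℕ-≤ᵘ {a} {q} {c} le) ⟩
  1 * c * 1       ≡⟨ trans (*-identityʳ (1 * c)) (*-identityˡ c) ⟩
  c               ∎
  where open ≤-Reasoning

1÷-positive : ∀ q → 0ℚ ℚ.< 1 ÷ suc q
1÷-positive q = ℚ.toℚᵘ-cancel-< (ℚᵘ.<-respʳ-≃ (ℚᵘ.≃-sym (÷ᵘ 1 q)) (*<* (ℤ.+<+ (s≤s z≤n))))

archimedean : ∀ η → 0ℚ ℚ.< η → ∃[ N ] (∀ q → N ≤ q → 1 ÷ suc q ℚ.≤ η)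
-- The denominator of η is d + 1 and its numerator is at least 1, so 1 / (d + 1) does not exceed η.
archimedean η@(mkℚ (ℤ.+ suc p) d _) _ = d , λ q d≤q → ℚ.toℚᵘ-cancel-≤
  (ℚᵘ.≤-respˡ-≃ (ℚᵘ.≃-sym (÷ᵘ 1 q)) (≤ᵘ⁺ {1} {q} {suc p} {d}
    (≤-trans (≤-reflexive (*-identityˡ (suc d)))
      (≤-trans (s≤s d≤q) (m≤m+n (suc q) (p * suc q))))))
archimedean (mkℚ (ℤ.+ 0) _ _)   (ℚ.*<* (ℤ.+<+ ()))
archimedean (mkℚ ℤ.-[1+ _ ] _ _) (ℚ.*<* ())

-- Monotonicity of `c` and uniform strictness.

c-step : ∀ n r l → 2 ≤ l → suc r ≤ n → c (suc r) l n ℚ.≤ c (suc r) l (suc n)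
c-step n r l 2≤l k≤n = ÷-mono (C-positive n (suc r) k≤n)
  (C-positive (suc n) (suc r) (≤-trans k≤n (n≤1+n n))) (f-ratio n r l 2≤l)

c-mono : ∀ n d r l → 2 ≤ l → suc r ≤ n → c (suc r) l n ℚ.≤ c (suc r) l (d + n)
c-mono n zero    r l 2≤l k≤n = ℚ.≤-refl
c-mono n (suc d) r l 2≤l k≤n = ℚ.≤-trans (c-mono n d r l 2≤l k≤n)
  (c-step (d + n) r l 2≤l (≤-trans k≤n (m≤n+m n d)))

-- A nondecreasing sequence stays below its later values, so an extremal graph meets the density
-- hypothesis of stability for every positive δ.
extremal-density : ∀ r l (G : Graph n) → 2 ≤ l → suc r ≤ n → P (suc r) G ≡ f n (suc r) l →
  ∀ δ → 0ℚ ℚ.< δ → const (density (suc r) G) ≤lim c (suc r) l ⊕ const δ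
extremal-density {n} r l G 2≤l k≤n extremal δ 0<δ η 0<η = n , λ n′ n≤n′ → begin
  density (suc r) G
    ≡⟨ cong (_÷ (n C suc r)) extremal ⟩
  c (suc r) l n
    ≤⟨ c-mono n (n′ ∸ n) r l 2≤l k≤n ⟩
  c (suc r) l (n′ ∸ n + n)
    ≡⟨ cong (c (suc r) l) (m∸n+n≡m n≤n′) ⟩
  c (suc r) l n′
    ≤⟨ pad (c (suc r) l n′) 0<δ ⟩
  c (suc r) l n′ ℚ.+ δ
    ≤⟨ pad (c (suc r) l n′ ℚ.+ δ) 0<η ⟩
  c (suc r) l n′ ℚ.+ δ ℚ.+ η ∎
  where
  open ℚ.≤-Reasoning
  pad : ∀ p {ε} → 0ℚ ℚ.< ε → p ℚ.≤ p ℚ.+ ε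
  pad p 0<ε = ℚ.≤-trans (ℚ.≤-reflexive (sym (ℚ.+-identityʳ p))) (ℚ.+-monoʳ-≤ p (ℚ.<⇒≤ 0<ε))

-- Strictness yields a gap only for legal X. Deciding legality makes it possible to attach a
-- threshold to every X, a vacuous one if X is illegal, and to combine them.
inducedAvoiding? : ∀ p (F : Graph m) X → Dec (InducedAvoiding (edgeless p) F X)
inducedAvoiding? {m} p F X = map′ to from (Any.any? embeds? (vectors (allFin m) p))
  where
  Embeds : Vec (Fin m) p → Set
  Embeds v = (∀ a b → lookup v a ≡ lookup v b → a ≡ b) × (∀ a → lookup v a ∉ X) ×
    (∀ a b → ¬ (lookup v a ~[ F ] lookup v b))

  embeds? : ∀ v → Dec (Embeds v)
  embeds? v =
    (all? λ a → all? λ b → (lookup v a ≟ lookup v b) →-dec (a ≟ b)) ×-dec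
    (all? λ a → ¬? (lookup v a ∈? X)) ×-dec
    (all? λ a → all? λ b → ¬? (adj? F (lookup v a) (lookup v b)))

  to : Any.Any Embeds (vectors (allFin m) p) → InducedAvoiding (edgeless p) F X
  to any with v , inj , avoids , ind ← Any.satisfied any = record
    { φ         = lookup v
    ; injective = λ {a} {b} → inj a b
    ; avoids    = avoids
    ; induced   = λ a b → mk⇔ (λ ()) (ind a b)
    }

  from : InducedAvoiding (edgeless p) F X → Any.Any Embeds (vectors (allFin m) p)
  from emb = lose (∈-vectors ∈-allFin (tabulate φ))
    ( (λ a b e → injective (trans (sym (at a)) (trans e (at b))))
    , (λ a → subst (_∉ X) (sym (at a)) (avoids a))
    , λ a b a~b → Equivalence.from (induced a b) (adjacent (at a) (at b) a~b))
    where
    open InducedAvoiding emb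
    at : ∀ a → lookup (tabulate φ) a ≡ φ a
    at = lookup∘tabulate φ

    adjacent : ∀ {x x′ y y′} → x ≡ x′ → y ≡ y′ → x ~[ F ] y → x′ ~[ F ] y′
    adjacent refl refl e = e

IsNeighbourhood : Graph m → Subset m → Set
IsNeighbourhood F X = ∃[ i ] X ≡ closedNeighbourhood F i

isNeighbourhood? : (F : Graph m) (X : Subset m) → Dec (IsNeighbourhood F X)
isNeighbourhood? F X = any? λ i → ≡-dec _≟ᵇ_ X (closedNeighbourhood F i)

uniform : ∀ {a p} {A : Set a} (Φ : A → ℕ → Set p) → (∀ x {i j} → i ≤ j → Φ x i → Φ x j) →
  (∀ x → ∃[ i ] Φ x i) → ∀ xs → ∃[ i ] (∀ x → x ∈ᴸ xs → Φ x i)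
uniform Φ mono ev []       = 0 , λ _ ()
uniform Φ mono ev (x ∷ xs) with ev x | uniform Φ mono ev xs
... | i , Φi | j , Φj = i ⊔ j , λ
  { _ (Any.here refl) → mono x (m≤m⊔n i j) Φi
  ; y (Any.there y∈)  → mono y (m≤n⊔m i j) (Φj y y∈) }

-- There are finitely many X, so one number N can serve both as a threshold for n and, through 1 /
-- (N + 1), as the gap.
strict-uniform : ∀ k l (F : Graph m) → IsStrict k l F →
  ∃[ N ] (∀ X → Legal l F X → ¬ IsNeighbourhood F X →
    ∀ n → N ≤ n → c k l n ℚ.+ 1 ÷ suc N ℚ.≤ grad k F X)
strict-uniform {m} k l F strict with uniform Gap mono gap (subsets m)
  where
  Gap : Subset m → ℕ → Set
  -- The denominator q varies apart from n, which makes the property monotone in N; it is set to N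
  -- at the end.
  Gap X N = Legal l F X → ¬ IsNeighbourhood F X →
    ∀ n q → N ≤ n → N ≤ q → c k l n ℚ.+ 1 ÷ suc q ℚ.≤ grad k F X

  mono : ∀ X {i j} → i ≤ j → Gap X i → Gap X j
  mono X i≤j gap legal ¬nbhd n q j≤n j≤q = gap legal ¬nbhd n q (≤-trans i≤j j≤n) (≤-trans i≤j j≤q)

  gap : ∀ X → ∃[ N ] Gap X N
  gap X with inducedAvoiding? (l ∸ 1) F X | isNeighbourhood? F X
  ... | yes emb | _        = 0 , λ legal → contradiction emb legal
  ... | no _    | yes nbhd = 0 , λ _ ¬nbhd → contradiction nbhd ¬nbhd
  ... | no legal | no ¬nbhd with strict X legal ¬nbhd
  ...   | η , 0<η , N , above with archimedean η 0<η
  ...     | M , small = N ⊔ M , λ _ _ n q ≤n ≤q → ℚ.≤-trans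
    (ℚ.+-monoʳ-≤ (c k l n) (small q (≤-trans (m≤n⊔m N M) ≤q)))
    (above n (≤-trans (m≤m⊔n N M) ≤n))
... | N , all-X = N , λ X legal ¬nbhd n N≤n →
  all-X X (∈-vectors ∈-booleans X) legal ¬nbhd n N N≤n ≤-refl

-- Extension of independent families, and sizes of balanced parts.

cons : Fin n → (Fin p → Fin n) → Fin (suc p) → Fin n
cons x φ zero    = x
cons x φ (suc a) = φ a

family-cons : (G : Graph n) (x : Fin n) (φ : Fin p → Fin n) →
  (∀ a → φ a ≢ x × ¬ (x ~[ G ] φ a)) → IndependentFamily G φ → IndependentFamily G (cons x φ)
family-cons G x φ away ind zero    zero    a≢b = contradiction refl a≢b
family-cons G x φ away ind zero    (suc b) _   = ≢-sym (proj₁ (away b)) , proj₂ (away b)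
family-cons G x φ away ind (suc a) zero    _   =
  proj₁ (away a) , proj₂ (away a) ∘ Graph.~-sym G
family-cons G x φ away ind (suc a) (suc b) a≢b = ind a b λ { refl → a≢b refl }

partSize≡card : (V : Partition n m) → ∀ i → partSize V i ≡ card (fibre V i)
partSize≡card {n} V i = trans (count≡total (λ x → V x ≟ i) (allFin n))
  (total-tabulate (λ x → ⟦ fibre V i x ⟧) id)

module _ (V : Partition n m) (balanced : Balanced V) where

  private
    near : ∀ i j → card (fibre V i) ≤ suc (card (fibre V j))
    near i j = ≤-trans (≤-reflexive (sym (partSize≡card V i)))
      (≤-trans (balanced i j) (≤-reflexive (cong suc (partSize≡card V j))))

    n≡sum : n ≡ sum λ i → card (fibre V i)
    n≡sum = trans (sym (trans (sum-const n 1) (*-identityʳ n)))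
      (trans (sum-fibres V λ _ → 1) (sum-cong-≗ λ i → *-identityʳ (card (fibre V i))))

  part-≥ : ∀ i → n ≤ m * card (fibre V i) + m
  part-≥ i = begin
    n                                  ≡⟨ n≡sum ⟩
    sum (λ j → card (fibre V j))       ≤⟨ sum-bound (λ j → near j i) ⟩
    m * suc (card (fibre V i))         ≡⟨ *-suc m (card (fibre V i)) ⟩
    m + m * card (fibre V i)           ≡⟨ +-comm m _ ⟩
    m * card (fibre V i) + m           ∎
    where open ≤-Reasoning

  part-≤ : ∀ i → m * card (fibre V i) ≤ n + m
  part-≤ i = begin
    m * card (fibre V i)                     ≡⟨ sum-const m _ ⟨
    sum {m} (λ _ → card (fibre V i))         ≤⟨ sum-mono (λ j → ≤-trans (near i j) (≤-reflexive (+-comm 1 _))) ⟩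
    sum (λ j → card (fibre V j) + 1)         ≡⟨ ∑-distrib-+ (λ j → card (fibre V j)) (λ _ → 1) ⟩
    sum (λ j → card (fibre V j)) + sum {m} (λ _ → 1)
      ≡⟨ cong₂ _+_ (sym n≡sum) (trans (sum-const m 1) (*-identityʳ m)) ⟩
    n + m                                    ∎
    where open ≤-Reasoning

-- The structure of an extremal graph.

-- Strictness gives grad X ≥ c + 1/q.  Counts of tuples are then exact up to
-- n ^ k / K, and a part is almost joined to a vertex if it contains fewer than
-- n / g non-neighbours of it.  A X is grad X times D.
record Setup (r p : ℕ) (F : Graph m) (G : Graph n) (V : Partition n m) (q K g : ℕ) : Set where
  D = m ^ suc r
  Cₖ = n C suc (suc r)
  N = n ^ suc r
  t = (suc (suc r)) ! * f n (suc (suc r)) (suc (suc p))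
  Q = 4 * K * D * suc r

  A : (Fin m → Bool) → ℕ
  A X = tuples (suc r) (λ _ → X) (closed F)

  field
    0<n : 0 < n
    0<m : 0 < m
    αF<l : α F < suc (suc p)
    αG<l : α G < suc (suc p)
    extremal : P (suc (suc r)) G ≡ f n (suc (suc r)) (suc (suc p))
    balanced : Balanced V
    gap : ∀ X → Legal (suc (suc p)) F X → ¬ IsNeighbourhood F X →
      (f n (suc (suc r)) (suc (suc p)) * q + Cₖ) * D ≤ A (lookup X) * (Cₖ * q)
    K>2q : 2 * q < K
    K>m  : suc m < K
    K>8m : 2 * (8 * m) ^ suc r < K
    g≥Qm : 2 * Q * m ≤ g
    g≥8m : 8 * m ≤ g
    n≥kk : 2 * (suc (suc r) * suc (suc r)) ≤ n
    n≥r! : 4 * K * D * (suc r) ! ≤ n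
    n≥rm : 4 * K * D * (suc r * m) ≤ n
    n≥Q  : 2 * Q ≤ n
    n≥m  : 24 * m ≤ n
    n≥km : 2 * (suc (suc r) * m) ≤ n
    n≥KD : 2 * K * (m * D) * (suc (suc r) * m) ≤ n
    missing₁ : 4 * K * D * (suc r * suc r) * missing F V G ≤ n * n
    missing₂ : 2 * m * Q * missing F V G ≤ n * n
    spurious₁ : suc p * suc p * g ^ suc p * spurious F V G < n * n
    spurious₀ : p * p * g ^ p * spurious F V G < n * n

  open ≤-Reasoning

  private
    nb : Fin m → Fin m → Bool
    nb = closed F

    instance
      n≢0 : NonZero n
      n≢0 = >-nonZero 0<n

      m≢0 : NonZero m
      m≢0 = >-nonZero 0<m

      N≢0 : NonZero N
      N≢0 = m^n≢0 n (suc r)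

      D≢0 : NonZero D
      D≢0 = m^n≢0 m (suc r)

      nN≢0 : NonZero (n * N)
      nN≢0 = m*n≢0 n N

    A≤D : ∀ X → A X ≤ D
    A≤D X = tuples-≤ (suc r) (λ _ → X) (closed F)

  -- Divided by K * D * n ^ k this reads A X / D + (card B / n) ^ (k - 1) ≤ t / n ^ k + 1 / (K D),
  -- with k = r + 2: what X and B contribute to the clique degree of x cannot noticeably exceed the
  -- average.
  degree-bound : ∀ (X : Fin m → Bool) (B : Fin n → Bool) x →
    (∀ z → B z ≡ true → X (V z) ≡ false) → (∀ z → B z ≡ true → adj G x z ≡ true) →
    (∀ y z → B y ≡ true → B z ≡ true → linked F V G y z ≡ true) →
    Q * missed F V G X x ≤ n →
    K * (n * (N * A X + D * card B ^ suc r)) ≤ K * D * t + n * N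
  degree-bound X B x B∩X B⊆N B-linked few = degree-arithmetic n N ((n ∸ m) ^ suc r) (A X) D K t
    (tuples (suc r) (λ _ → adj G x) (adj G)) (tuples (suc r) (λ _ z → X (V z)) (linked F V G))
    (card B ^ suc r) (suc r) (missed F V G X x) (missing F V G) ((suc r) !) 0<n
    (degree-lower F V G r X B x B∩X B⊆N B-linked)
    (blowup-lower V (suc r) (λ _ → X) (closed F) (n ∸ m) m λ i →
      ≤-trans (∸-monoˡ-≤ m (part-≥ V balanced i)) (≤-reflexive (m+n∸n≡m _ m)))
    (extremal-tuples G αG<l extremal x)
    (pow-close (4 * K * A X) n (n ∸ m) m (suc r) (m∸n≤m n m) (≤-trans (m≤n+m∸n n m) (≤-reflexive (+-comm m _)))
      (≤-trans (*-monoˡ-≤ (suc r * m) (*-monoʳ-≤ (4 * K) (A≤D X))) n≥rm))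
    n≥r! few missing₁

  -- Part i has at least n / (2 m) vertices, and together they miss at most `missing` pairs. Hence
  -- one of them misses few vertices of the parts in `nb i`, and the degree bound at this vertex,
  -- with B empty, speaks of A (nb i).
  neighbourhood-bound : ∀ i → K * (n * (N * A (nb i))) ≤ K * D * t + n * N
  neighbourhood-bound i with pigeonhole (fibre V i) (λ x → Q * missed F V G (nb i) x) (suc n) average
    where
    average : sum (λ x → ⟦ fibre V i x ⟧ * (Q * missed F V G (nb i) x)) < card (fibre V i) * suc n
    average = *-cancelˡ-< (2 * m) _ _ (begin-strict
      2 * m * sum (λ x → ⟦ fibre V i x ⟧ * (Q * missed F V G (nb i) x))
        ≤⟨ *-monoʳ-≤ (2 * m) (sum-mono λ x → only x (V x ≟ i)) ⟩
      2 * m * sum (λ x → Q * card (λ z → linked F V G x z ∧ not (adj G x z)))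
        ≡⟨ cong (2 * m *_) (*-distribˡ-sum Q (λ x → card (λ z → linked F V G x z ∧ not (adj G x z)))) ⟨
      2 * m * (Q * missing F V G)
        ≡⟨ *-assoc (2 * m) Q _ ⟨
      2 * m * Q * missing F V G
        ≤⟨ missing₂ ⟩
      n * n
        <⟨ *-monoʳ-< n (n<1+n n) ⟩
      n * suc n
        ≤⟨ *-monoˡ-≤ (suc n) half ⟩
      2 * m * card (fibre V i) * suc n
        ≡⟨ *-assoc (2 * m) (card (fibre V i)) (suc n) ⟩
      2 * m * (card (fibre V i) * suc n) ∎)
      where
      only : ∀ x (d : Dec (V x ≡ i)) → ⟦ does d ⟧ * (Q * missed F V G (nb i) x) ≤
        Q * card (λ z → linked F V G x z ∧ not (adj G x z))
      only x (yes e) = ≤-reflexive (trans (*-identityˡ _)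
        (cong (λ j → Q * missed F V G (nb j) x) (sym e)))
      only x (no _)  = z≤n

      half : n ≤ 2 * m * card (fibre V i)
      half = +-cancelʳ-≤ n _ _ (begin
        n + n
          ≡⟨ cong (n +_) (+-identityʳ n) ⟨
        2 * n
          ≤⟨ *-monoʳ-≤ 2 (part-≥ V balanced i) ⟩
        2 * (m * card (fibre V i) + m)
          ≡⟨ expand m (card (fibre V i)) ⟩
        2 * m * card (fibre V i) + 2 * m
          ≤⟨ +-monoʳ-≤ (2 * m * card (fibre V i)) (≤-trans (*-monoˡ-≤ m (m≤m+n 2 22)) n≥m) ⟩
        2 * m * card (fibre V i) + n ∎)
        where
        expand : ∀ m c → 2 * (m * c + m) ≡ 2 * m * c + 2 * m
        expand = solve-∀
  ... | x , x∈ , few = ≤-trans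
    (*-monoʳ-≤ K (*-monoʳ-≤ n (m≤m+n (N * A (nb i)) _)))
    (degree-bound (nb i) (λ _ → false) x (λ _ ()) (λ _ ()) (λ _ _ ()) (≤-pred few))

  -- The expansion of F along V competes in the minimum f. Its cliques are governed by the k-tuples
  -- of F, whose number is the sum of the A (nb i); so the average of A (nb i) / D is at least t / n
  -- ^ k up to 1 / (K m D).
  expansion-bound : K * (m * D * t) ≤ K * sum (λ i → A (nb i)) * (n * N) + n * N
  -- Doubling leaves room to bound the error (n + m) ^ k by 2 * n ^ k.
  expansion-bound = *-cancelˡ-≤ 2 (begin
    2 * (K * (m * D * t))
      ≤⟨ *-monoʳ-≤ 2 (*-monoʳ-≤ K count-≤) ⟩
    2 * (K * ((n + m) ^ k * S))
      ≡⟨ e₁ K ((n + m) ^ k) S ⟩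
    2 * K * S * (n + m) ^ k
      ≤⟨ pow-close (2 * K * S) (n + m) n m k (m≤m+n n m) ≤-refl
           (≤-trans (*-monoˡ-≤ (k * m) (*-monoʳ-≤ (2 * K) (sum-bound λ i → A≤D (nb i))))
             (≤-trans n≥KD (m≤m+n n m))) ⟩
    2 * K * S * n ^ k + (n + m) ^ k
      ≤⟨ +-monoʳ-≤ (2 * K * S * n ^ k) twice ⟩
    2 * K * S * n ^ k + 2 * n ^ k
      ≡⟨ e₂ K S (n ^ k) ⟩
    2 * (K * S * n ^ k + n ^ k) ∎)
    where
    k = suc (suc r)
    S = sum λ i → A (nb i)
    E = expansion F V

    twice : (n + m) ^ k ≤ 2 * n ^ k
    twice = +-cancelʳ-≤ ((n + m) ^ k) _ _ (begin
      (n + m) ^ k + (n + m) ^ k ≡⟨ cong ((n + m) ^ k +_) (+-identityʳ _) ⟨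
      2 * (n + m) ^ k           ≤⟨ pow-close 2 (n + m) n m k (m≤m+n n m) ≤-refl (≤-trans n≥km (m≤m+n n m)) ⟩
      2 * n ^ k + (n + m) ^ k   ∎)

    count-≤ : m * D * t ≤ (n + m) ^ k * S
    count-≤ = begin
      m * D * t
        ≤⟨ *-monoʳ-≤ (m * D) (begin
          k ! * f n k (suc (suc p))
            ≤⟨ *-monoʳ-≤ (k !) (f-minimal n k (suc (suc p)) E (≤-<-trans (α-expansion F V) αF<l)) ⟩
          k ! * P k E
            ≡⟨ tuples≡P E k ⟨
          tuples k (λ _ → everything) (adj E)
            ≤⟨ tuples-mono k {As = λ _ → everything} (λ _ _ e → e) (λ x y e →
                 trans (sym (adj-expansion F V G x y (proj₁ (does⁻ (adj? E x y) e)))) e) ⟩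
          tuples k (λ _ → everything) (linked F V G) ∎) ⟩
      m ^ k * tuples k (λ _ → everything) (linked F V G)
        ≤⟨ blowup-upper V k (λ _ → everything) (closed F) (n + m) m (part-≤ V balanced) ⟩
      (n + m) ^ k * tuples k (λ _ → everything) (closed F)
        ≡⟨ cong ((n + m) ^ k *_) (sum-cong-≗ λ i → *-identityˡ (A (nb i))) ⟩
      (n + m) ^ k * S ∎

    e₁ : ∀ K a S → 2 * (K * (a * S)) ≡ 2 * K * S * a
    e₁ = solve-∀
    e₂ : ∀ K S a → 2 * K * S * a + 2 * a ≡ 2 * (K * S * a + a)
    e₂ = solve-∀

  -- The average of the A (nb i) is at least D c, because expansions of F are
  -- competitors, and none of them exceeds D c.
  neighbourhoods-equal : ∀ i j → A (nb i) ≤ A (nb j)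
  neighbourhoods-equal i j with A (nb j) <? A (nb i)
  ... | no ≮  = ≮⇒≥ ≮
  -- If A (nb j) were smaller, it could be raised by one, being an integer, without breaking the
  -- common upper bound. The sum S + 1 would then exceed what the bounds allow, since K > m + 1.
  ... | yes Aj<Ai = contradiction (*-cancelʳ-≤ K (suc m) (n * N) (+-cancelˡ-≤ (K * S * (n * N)) _ _ (begin
    K * S * (n * N) + K * (n * N)
      ≡⟨ e₁ K S (n * N) ⟩
    K * (n * N) * (S + 1)
      ≡⟨ cong (λ s → K * (n * N) * (S + s)) (sum-δ₁ j) ⟨
    K * (n * N) * (S + sum (λ h → ⟦ does (j ≟ h) ⟧))
      ≡⟨ cong (K * (n * N) *_) (∑-distrib-+ (λ h → A (nb h)) (λ h → ⟦ does (j ≟ h) ⟧)) ⟨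
    K * (n * N) * sum (λ h → A (nb h) + ⟦ does (j ≟ h) ⟧)
      ≡⟨ *-distribˡ-sum (K * (n * N)) (λ h → A (nb h) + ⟦ does (j ≟ h) ⟧) ⟩
    sum (λ h → K * (n * N) * (A (nb h) + ⟦ does (j ≟ h) ⟧))
      ≤⟨ sum-bound (λ h → raised h (j ≟ h)) ⟩
    m * (K * D * t + n * N)
      ≡⟨ e₂ m K D t (n * N) ⟩
    K * (m * D * t) + m * (n * N)
      ≤⟨ +-monoˡ-≤ (m * (n * N)) expansion-bound ⟩
    K * S * (n * N) + n * N + m * (n * N)
      ≡⟨ +-assoc (K * S * (n * N)) (n * N) (m * (n * N)) ⟩
    K * S * (n * N) + suc m * (n * N) ∎))) (<⇒≱ K>m)
    where
    S = sum λ h → A (nb h)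

    bound : ∀ h a → a ≤ A (nb h) → K * (n * N) * a ≤ K * D * t + n * N
    bound h a a≤ = ≤-trans (*-monoʳ-≤ (K * (n * N)) a≤)
      (≤-trans (≤-reflexive (assoc K n N (A (nb h)))) (neighbourhood-bound h))
      where
      assoc : ∀ K n N a → K * (n * N) * a ≡ K * (n * (N * a))
      assoc = solve-∀

    raised : ∀ h (d : Dec (j ≡ h)) → K * (n * N) * (A (nb h) + ⟦ does d ⟧) ≤ K * D * t + n * N
    raised h (yes refl) = bound i _ (≤-trans (≤-reflexive (+-comm (A (nb j)) 1)) Aj<Ai)
    raised h (no _)     = bound h _ (≤-reflexive (+-identityʳ _))

    e₁ : ∀ K S a → K * S * a + K * a ≡ K * a * (S + 1)
    e₁ = solve-∀
    e₂ : ∀ m K D t a → m * (K * D * t + a) ≡ K * (m * D * t) + m * a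
    e₂ = solve-∀

  falling-half : n * N ≤ 2 * ((suc (suc r)) ! * Cₖ)
  falling-half = ≤-trans (+-cancelʳ-≤ (n ^ k) _ _ (begin
    n ^ k + n ^ k           ≡⟨ cong (n ^ k +_) (+-identityʳ _) ⟨
    2 * n ^ k               ≤⟨ pow-close 2 n (n ∸ k) k k (m∸n≤m n k)
                                 (≤-trans (m≤n+m∸n n k) (≤-reflexive (+-comm k _))) n≥kk ⟩
    2 * (n ∸ k) ^ k + n ^ k ∎)) (*-monoʳ-≤ 2 (falling-≥ n k))
    where k = suc (suc r)

  -- Otherwise strictness would put A / D at least 1 / q above f / C(n, k), which is no less than t
  -- / n ^ k, while the hypothesis permits at most 1 / (K D) above t / n ^ k. Since n ^ k is at most
  -- twice k ! * C(n, k), this contradicts K > 2 q.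
  legal⇒neighbourhood : ∀ X → Legal (suc (suc p)) F X →
    K * (n * (N * A (lookup X))) ≤ K * D * t + n * N → IsNeighbourhood F X
  legal⇒neighbourhood X legal small with isNeighbourhood? F X
  ... | yes nbhd = nbhd
  ... | no ¬nbhd = contradiction (*-cancelʳ-≤ K (2 * q) Φ {{Φ≢0}} (begin
    K * Φ
      ≤⟨ m≤m*n (K * Φ) D ⟩
    K * Φ * D
      ≤⟨ +-cancelˡ-≤ (q * (K * D * t)) _ _ (begin
        q * (K * D * t) + K * Φ * D
          ≡⟨ e₁ q K D (k !) (f n k (suc (suc p))) Cₖ ⟩
        K * (k !) * ((f n k (suc (suc p)) * q + Cₖ) * D)
          ≤⟨ *-monoʳ-≤ (K * (k !)) (gap X legal ¬nbhd) ⟩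
        K * (k !) * (A (lookup X) * (Cₖ * q))
          ≡⟨ e₂ K (k !) (A (lookup X)) Cₖ q ⟩
        K * A (lookup X) * q * Φ
          ≤⟨ *-monoʳ-≤ (K * A (lookup X) * q) (falling-≤ n k) ⟩
        K * A (lookup X) * q * (n * N)
          ≡⟨ e₃ K (A (lookup X)) q n N ⟩
        q * (K * (n * (N * A (lookup X))))
          ≤⟨ *-monoʳ-≤ q small ⟩
        q * (K * D * t + n * N)
          ≡⟨ *-distribˡ-+ q (K * D * t) (n * N) ⟩
        q * (K * D * t) + q * (n * N) ∎) ⟩
    q * (n * N)
      ≤⟨ *-monoʳ-≤ q falling-half ⟩
    q * (2 * Φ)
      ≡⟨ e₄ q Φ ⟩
    2 * q * Φ ∎)) (<⇒≱ K>2q)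
    where
    k = suc (suc r)
    Φ = k ! * Cₖ

    Φ≢0 : NonZero Φ
    Φ≢0 = positive Φ falling-half
      where
      positive : ∀ a → n * N ≤ 2 * a → NonZero a
      positive zero    le = contradiction (≤-trans (>-nonZero⁻¹′ nN≢0) le) (λ ())
        where
        >-nonZero⁻¹′ : ∀ {a} → NonZero a → 0 < a
        >-nonZero⁻¹′ {suc a} _ = s≤s z≤n
      positive (suc a) _  = _

    e₁ : ∀ q K D k f c → q * (K * D * (k * f)) + K * (k * c) * D ≡ K * k * ((f * q + c) * D)
    e₁ = solve-∀
    e₂ : ∀ K k a c q → K * k * (a * (c * q)) ≡ K * a * q * (k * c)
    e₂ = solve-∀
    e₃ : ∀ K a q n N → K * a * q * (n * N) ≡ q * (K * (n * (N * a)))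
    e₃ = solve-∀
    e₄ : ∀ q a → q * (2 * a) ≡ 2 * q * a
    e₄ = solve-∀

  -- Assigning a part to every vertex.

  private
    -- The vertex x is left out, so that a transversal of such sets can be extended by x as a new
    -- element.
    missesIn : Fin n → Fin m → Fin n → Bool
    missesIn x h z = fibre V h z ∧ (not (adj G x z) ∧ not (does (z ≟ x)))

    small? : ∀ x h → Dec (g * card (missesIn x h) < n)
    small? x h = g * card (missesIn x h) <? n

    profile : Fin n → Subset m
    profile x = tabulate λ h → does (small? x h)

    lookup-profile : ∀ x h → lookup (profile x) h ≡ does (small? x h)
    lookup-profile x = lookup∘tabulate (λ h → does (small? x h))

    profile-legal : ∀ x → Legal (suc (suc p)) F (profile x)
    profile-legal x emb with transversal F V G (suc p) φ
      (λ a b a≢b → (λ e → a≢b (injective e)) , λ φa~φb → Equivalence.from (induced a b) φa~φb)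
      (λ a → missesIn x (φ a))
      (λ a z e → does⁻ (V z ≟ φ a) (∧-trueˡ e)) g
      (λ a → ≮⇒≥ λ lt → avoids a (lookup⇒[]= (φ a) (profile x)
        (trans (lookup-profile x (φ a)) (dec-true (small? x (φ a)) lt)))) spurious₁
      where open InducedAvoiding emb
    ... | ψ , ψ∈ , ind = <⇒≱ αG<l (family⇒≤α G (cons x ψ) (family-cons G x ψ away ind))
      where
      open InducedAvoiding emb
      away : ∀ a → ψ a ≢ x × ¬ (x ~[ G ] ψ a)
      away a = (λ e → not-true (∧-trueʳ {not (adj G x (ψ a))} rest) (dec-true (ψ a ≟ x) e)) ,
        λ x~ → not-true (∧-trueˡ rest) (dec-true (adj? G x (ψ a)) x~)
        where rest = ∧-trueʳ {fibre V (φ a) (ψ a)} (ψ∈ a)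

    -- Each part of X contributes at most n / g, and x itself may add one. The bound g ≥ 2 Q m keeps
    -- the former within half of n / Q, and n ≥ 2 Q the latter.
    profile-missed : ∀ x X → (∀ h → X h ≡ true → g * card (missesIn x h) ≤ n) →
      Q * missed F V G X x ≤ n
    profile-missed x X few = *-cancelˡ-≤ (2 * g) {{m*n≢0 2 g {{_}} {{g≢0}}}} (begin
      2 * g * (Q * missed F V G X x)
        ≡⟨ e₁ g Q (missed F V G X x) ⟩
      2 * Q * (g * missed F V G X x)
        ≤⟨ *-monoʳ-≤ (2 * Q) (begin
          g * missed F V G X x
            ≤⟨ *-monoʳ-≤ g missed-≤ ⟩
          g * (sum (λ h → ⟦ X h ⟧ * card (missesIn x h)) + 1)
            ≡⟨ *-distribˡ-+ g (sum (λ h → ⟦ X h ⟧ * card (missesIn x h))) 1 ⟩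
          g * sum (λ h → ⟦ X h ⟧ * card (missesIn x h)) + g * 1
            ≡⟨ cong₂ _+_ (*-distribˡ-sum g (λ h → ⟦ X h ⟧ * card (missesIn x h))) (*-identityʳ g) ⟩
          sum (λ h → g * (⟦ X h ⟧ * card (missesIn x h))) + g
            ≤⟨ +-monoˡ-≤ g (sum-bound λ h → each h (X h) refl) ⟩
          m * n + g ∎) ⟩
      2 * Q * (m * n + g)
        ≡⟨ e₂ Q m n g ⟩
      2 * Q * m * n + g * (2 * Q)
        ≤⟨ +-mono-≤ (*-monoˡ-≤ n g≥Qm) (*-monoʳ-≤ g n≥Q) ⟩
      g * n + g * n
        ≡⟨ e₃ g n ⟩
      2 * g * n ∎)
      where
      g≢0 : NonZero g
      g≢0 = >-nonZero (≤-trans (≤-trans 0<m (m≤n*m m 8)) g≥8m)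

      each : ∀ h b → X h ≡ b → g * (⟦ b ⟧ * card (missesIn x h)) ≤ n
      each h false _ = ≤-trans (≤-reflexive (*-zeroʳ g)) z≤n
      each h true  e = ≤-trans (≤-reflexive (cong (g *_) (*-identityˡ (card (missesIn x h))))) (few h e)

      rest : Fin n → Bool
      rest z = not (adj G x z) ∧ not (does (z ≟ x))

      missed-≤ : missed F V G X x ≤ sum (λ h → ⟦ X h ⟧ * card (missesIn x h)) + 1
      missed-≤ = begin
        sum (λ z → ⟦ X (V z) ∧ not (adj G x z) ⟧)
          ≤⟨ sum-mono (λ z → cover (X (V z)) (adj G x z) (z ≟ x) (x ≟ z)) ⟩
        sum (λ z → ⟦ X (V z) ⟧ * ⟦ rest z ⟧ + ⟦ does (x ≟ z) ⟧)
          ≡⟨ ∑-distrib-+ (λ z → ⟦ X (V z) ⟧ * ⟦ rest z ⟧) (λ z → ⟦ does (x ≟ z) ⟧) ⟩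
        sum (λ z → ⟦ X (V z) ⟧ * ⟦ rest z ⟧) + sum (λ z → ⟦ does (x ≟ z) ⟧)
          ≡⟨ cong₂ _+_ (begin-equality
            sum (λ z → ⟦ X (V z) ⟧ * ⟦ rest z ⟧)
              ≡⟨ sum-cong-≗ (λ z → trans (cong (_* ⟦ rest z ⟧) (sym (sum-δ (V z) (λ h → ⟦ X h ⟧))))
                   (*-distribʳ-sum ⟦ rest z ⟧ (λ h → ⟦ fibre V h z ⟧ * ⟦ X h ⟧))) ⟩
            sum (λ z → sum λ h → ⟦ fibre V h z ⟧ * ⟦ X h ⟧ * ⟦ rest z ⟧)
              ≡⟨ ∑-comm (λ z h → ⟦ fibre V h z ⟧ * ⟦ X h ⟧ * ⟦ rest z ⟧) ⟩
            sum (λ h → sum λ z → ⟦ fibre V h z ⟧ * ⟦ X h ⟧ * ⟦ rest z ⟧)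
              ≡⟨ sum-cong-≗ (λ h → trans
                   (sum-cong-≗ λ z → trans (swap ⟦ fibre V h z ⟧ ⟦ X h ⟧ ⟦ rest z ⟧)
                     (cong (⟦ X h ⟧ *_) (sym (⟦∧⟧ (fibre V h z) (rest z)))))
                   (sym (*-distribˡ-sum ⟦ X h ⟧ (λ z → ⟦ missesIn x h z ⟧)))) ⟩
            sum (λ h → ⟦ X h ⟧ * card (missesIn x h)) ∎) (sum-δ₁ x) ⟩
        sum (λ h → ⟦ X h ⟧ * card (missesIn x h)) + 1 ∎
        where
        swap : ∀ a b c → a * b * c ≡ b * (a * c)
        swap = solve-∀

        cover : ∀ {z} a b (d : Dec (z ≡ x)) (d′ : Dec (x ≡ z)) →
          ⟦ a ∧ not b ⟧ ≤ ⟦ a ⟧ * ⟦ not b ∧ not (does d) ⟧ + ⟦ does d′ ⟧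
        cover false b     d       d′       = z≤n
        cover true  true  d       d′       = z≤n
        cover true  false (no _)  d′       = s≤s z≤n
        cover true  false (yes _) (yes _)  = s≤s z≤n
        cover true  false (yes e) (no x≢z) = contradiction (sym e) x≢z

      e₁ : ∀ g Q u → 2 * g * (Q * u) ≡ 2 * Q * (g * u)
      e₁ = solve-∀
      e₂ : ∀ Q m n g → 2 * Q * (m * n + g) ≡ 2 * Q * m * n + g * (2 * Q)
      e₂ = solve-∀
      e₃ : ∀ g n → g * n + g * n ≡ 2 * g * n
      e₃ = solve-∀

  typed : ∀ x → ∃[ i ] (∀ h → nb i h ≡ true → g * card (missesIn x h) ≤ n)
  typed x = from-profile (legal⇒neighbourhood X (profile-legal x)
    (≤-trans (*-monoʳ-≤ K (*-monoʳ-≤ n (m≤m+n (N * A (lookup X)) (D * card nothing ^ suc r))))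
      (degree-bound (lookup X) nothing x (λ _ ()) (λ _ ()) (λ _ _ ())
        (profile-missed x (lookup X) λ h e → member h e))))
    where
    X = profile x

    nothing : Fin n → Bool
    nothing _ = false

    member : ∀ h → lookup X h ≡ true → g * card (missesIn x h) ≤ n
    member h e = <⇒≤ (does⁻ (small? x h) (trans (sym (lookup-profile x h)) e))

    from-profile : IsNeighbourhood F X → ∃[ i ] (∀ h → nb i h ≡ true → g * card (missesIn x h) ≤ n)
    from-profile (i , X≡) = i , λ h e →
      member h (trans (cong (λ Y → lookup Y h) X≡) (trans (lookup∘tabulate (nb i) h) e))

  private
    neighboursIn : Fin n → Fin m → Fin n → Bool
    neighboursIn x h z = fibre V h z ∧ adj G x z

  -- All A (nb j) being equal, A (nb i) is their average and accounts for t by `expansion-bound`.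
  -- Only error terms remain to pay for the cliques among the neighbours B of x in part h, so (card
  -- B / n) ^ (k - 1) ≤ 2 / (K D); the size of K turns this into card B ≤ n / (8 m).
  few-extra : ∀ x i → (∀ h → nb i h ≡ true → g * card (missesIn x h) ≤ n) →
    ∀ h → nb i h ≡ false → 8 * m * card (neighboursIn x h) ≤ n
  few-extra x i few h far = ≮⇒≥ λ large → <⇒≱ K>8m (*-cancelʳ-≤ K (2 * (8 * m) ^ suc r) (m * (n * N)) {{m*n≢0 m (n * N)}} (begin
    K * (m * (n * N))
      ≤⟨ *-monoʳ-≤ K (*-monoʳ-≤ m (*-monoʳ-≤ n (^-monoˡ-≤ (suc r) (<⇒≤ large)))) ⟩
    K * (m * (n * (8 * m * card B) ^ suc r))
      ≡⟨ cong (λ a → K * (m * (n * a))) (^-distribʳ-* (suc r) (8 * m) (card B)) ⟩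
    K * (m * (n * ((8 * m) ^ suc r * card B ^ suc r)))
      ≡⟨ e₁ K m n ((8 * m) ^ suc r) (card B ^ suc r) ⟩
    (8 * m) ^ suc r * (K * m * n * card B ^ suc r)
      ≤⟨ *-monoʳ-≤ ((8 * m) ^ suc r) (≤-trans (m≤m*n _ D) β-bound) ⟩
    (8 * m) ^ suc r * (2 * (m * (n * N)))
      ≡⟨ e₂ ((8 * m) ^ suc r) (m * (n * N)) ⟩
    2 * (8 * m) ^ suc r * (m * (n * N)) ∎))
    where
    B = neighboursIn x h
    β = card B ^ suc r
    S = sum λ j → A (nb j)

    e₁ : ∀ K m n a b → K * (m * (n * (a * b))) ≡ a * (K * m * n * b)
    e₁ = solve-∀
    e₂ : ∀ a b → a * (2 * b) ≡ 2 * a * b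
    e₂ = solve-∀
    e₃ : ∀ K m n N a b D → K * (m * a) * (n * N) + K * m * n * b * D ≡ m * (K * (n * (N * a + D * b)))
    e₃ = solve-∀
    e₄ : ∀ m K D t a → m * (K * D * t + a) ≡ K * (m * D * t) + m * a
    e₄ = solve-∀

    ^-distribʳ-* : ∀ k a b → (a * b) ^ k ≡ a ^ k * b ^ k
    ^-distribʳ-* zero    a b = refl
    ^-distribʳ-* (suc k) a b = trans (cong (a * b *_) (^-distribʳ-* k a b)) (shuffle a b (a ^ k) (b ^ k))
      where
      shuffle : ∀ a b c d → a * b * (c * d) ≡ a * c * (b * d)
      shuffle = solve-∀

    V∈B : ∀ z → B z ≡ true → V z ≡ h
    V∈B z e = does⁻ (V z ≟ h) (∧-trueˡ e)

    with-extra : K * (n * (N * A (nb i) + D * β)) ≤ K * D * t + n * N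
    with-extra = degree-bound (nb i) B x
      (λ z e → trans (cong (nb i) (V∈B z e)) far)
      (λ z e → ∧-trueʳ {fibre V h z} e)
      (λ y z ey ez → trans (cong₂ nb (V∈B y ey) (V∈B z ez)) (closed-refl F h))
      (profile-missed x (nb i) few)

    β-bound : K * m * n * β * D ≤ 2 * (m * (n * N))
    β-bound = +-cancelˡ-≤ (K * S * (n * N)) _ _ (begin
      K * S * (n * N) + K * m * n * β * D
        ≤⟨ +-monoˡ-≤ _ (*-monoˡ-≤ (n * N) (*-monoʳ-≤ K (sum-bound λ j → neighbourhoods-equal j i))) ⟩
      K * (m * A (nb i)) * (n * N) + K * m * n * β * D
        ≡⟨ e₃ K m n N (A (nb i)) β D ⟩
      m * (K * (n * (N * A (nb i) + D * β)))
        ≤⟨ *-monoʳ-≤ m with-extra ⟩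
      m * (K * D * t + n * N)
        ≡⟨ e₄ m K D t (n * N) ⟩
      K * (m * D * t) + m * (n * N)
        ≤⟨ +-monoˡ-≤ (m * (n * N)) expansion-bound ⟩
      K * S * (n * N) + n * N + m * (n * N)
        ≡⟨ +-assoc (K * S * (n * N)) (n * N) (m * (n * N)) ⟩
      K * S * (n * N) + (n * N + m * (n * N))
        ≤⟨ +-monoʳ-≤ (K * S * (n * N)) (+-monoˡ-≤ (m * (n * N)) (m≤n*m (n * N) m)) ⟩
      K * S * (n * N) + (m * (n * N) + m * (n * N))
        ≡⟨ cong (K * S * (n * N) +_) (cong (m * (n * N) +_) (+-identityʳ _)) ⟨
      K * S * (n * N) + 2 * (m * (n * N)) ∎)

  -- Joining vertices of equal or adjacent parts.

  private
    avoidsBoth : Fin n → Fin n → Fin m → Fin n → Bool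
    avoidsBoth x y h z = fibre V h z ∧
      ((not (adj G x z) ∧ not (does (z ≟ x))) ∧ (not (adj G y z) ∧ not (does (z ≟ y))))

    τ : Fin n → Fin m
    τ x = proj₁ (typed x)

    τ-few : ∀ x h → nb (τ x) h ≡ false → 8 * m * card (neighboursIn x h) ≤ n
    τ-few x = few-extra x (τ x) (proj₂ (typed x))

    -- On the scale of 8 m, part h has size 8 n - 8 m or more, the neighbours of x and of y take
    -- away n each, and x and y themselves 16 m; with 24 m ≤ n at least 5 n remains, of which n is
    -- kept. Then g ≥ 8 m.
    common : ∀ x y h → nb (τ x) h ≡ false → nb (τ y) h ≡ false → n ≤ g * card (avoidsBoth x y h)
    common x y h x-far y-far = ≤-trans (+-cancelʳ-≤ (7 * n) _ _ (begin
      8 * n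
        ≤⟨ *-monoʳ-≤ 8 (part-≥ V balanced h) ⟩
      8 * (m * card (fibre V h) + m)
        ≡⟨ e₁ m (card (fibre V h)) ⟩
      8 * m * card (fibre V h) + 8 * m
        ≤⟨ +-monoˡ-≤ (8 * m) (*-monoʳ-≤ (8 * m) split) ⟩
      8 * m * (card W + (card Bx + (card By + 2))) + 8 * m
        ≡⟨ e₂ m (card W) (card Bx) (card By) ⟩
      8 * m * card W + (8 * m * card Bx + (8 * m * card By + 24 * m))
        ≤⟨ +-monoʳ-≤ (8 * m * card W) (+-mono-≤ (τ-few x h x-far) (+-mono-≤ (τ-few y h y-far) n≥m)) ⟩
      8 * m * card W + (n + (n + n))
        ≤⟨ +-monoʳ-≤ (8 * m * card W) (≤-trans (≤-reflexive (e₃ n)) (*-monoˡ-≤ n (m≤m+n 3 4))) ⟩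
      8 * m * card W + 7 * n ∎)) (*-monoˡ-≤ (card W) g≥8m)
      where
      W  = avoidsBoth x y h
      Bx = neighboursIn x h
      By = neighboursIn y h

      cover : ∀ {z} v a b (d : Dec (z ≡ x)) (d′ : Dec (z ≡ y)) (δ : Dec (x ≡ z)) (δ′ : Dec (y ≡ z)) →
        ⟦ v ⟧ ≤ ⟦ v ∧ ((not a ∧ not (does d)) ∧ (not b ∧ not (does d′))) ⟧ +
          (⟦ v ∧ a ⟧ + (⟦ v ∧ b ⟧ + (⟦ does δ ⟧ + ⟦ does δ′ ⟧)))
      cover false a     b     d       d′      δ        δ′       = z≤n
      cover true  true  b     d       d′      δ        δ′       = s≤s z≤n
      cover true  false true  (yes _) d′      δ        δ′       = s≤s z≤n
      cover true  false true  (no _)  d′      δ        δ′       = s≤s z≤n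
      cover true  false false (yes _) d′      (yes _)  δ′       = s≤s z≤n
      cover true  false false (yes e) d′      (no x≢z) δ′       = contradiction (sym e) x≢z
      cover true  false false (no _)  (no _)  δ        δ′       = s≤s z≤n
      cover true  false false (no _)  (yes _) (yes _)  (yes _)  = s≤s z≤n
      cover true  false false (no _)  (yes _) (no _)   (yes _)  = s≤s z≤n
      cover true  false false (no _)  (yes e) δ        (no y≢z) = contradiction (sym e) y≢z

      split : card (fibre V h) ≤ card W + (card Bx + (card By + 2))
      split = begin
        card (fibre V h)
          ≤⟨ sum-mono (λ z → cover (fibre V h z) (adj G x z) (adj G y z) (z ≟ x) (z ≟ y) (x ≟ z) (y ≟ z)) ⟩
        sum (λ z → ⟦ W z ⟧ + (⟦ Bx z ⟧ + (⟦ By z ⟧ + (⟦ does (x ≟ z) ⟧ + ⟦ does (y ≟ z) ⟧))))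
          ≡⟨ trans (∑-distrib-+ (λ z → ⟦ W z ⟧) (λ z → ⟦ Bx z ⟧ + (⟦ By z ⟧ + (⟦ does (x ≟ z) ⟧ + ⟦ does (y ≟ z) ⟧))))
               (cong (card W +_) (trans (∑-distrib-+ (λ z → ⟦ Bx z ⟧) (λ z → ⟦ By z ⟧ + (⟦ does (x ≟ z) ⟧ + ⟦ does (y ≟ z) ⟧)))
               (cong (card Bx +_) (trans (∑-distrib-+ (λ z → ⟦ By z ⟧) (λ z → ⟦ does (x ≟ z) ⟧ + ⟦ does (y ≟ z) ⟧))
               (cong (card By +_) (trans (∑-distrib-+ (λ z → ⟦ does (x ≟ z) ⟧) (λ z → ⟦ does (y ≟ z) ⟧))
                 (cong₂ _+_ (sum-δ₁ x) (sum-δ₁ y)))))))) ⟩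
        card W + (card Bx + (card By + 2)) ∎

      e₁ : ∀ m c → 8 * (m * c + m) ≡ 8 * m * c + 8 * m
      e₁ = solve-∀
      e₂ : ∀ m w a b → 8 * m * (w + (a + (b + 2))) + 8 * m ≡ 8 * m * w + (8 * m * a + (8 * m * b + 24 * m))
      e₂ = solve-∀
      e₃ : ∀ n → n + (n + n) ≡ 3 * n
      e₃ = solve-∀

    punctured : Fin m → Fin m → Subset m
    punctured i j = tabulate λ h → nb i h ∧ not (does (h ≟ j))

    lookup-punctured : ∀ i j h → lookup (punctured i j) h ≡ nb i h ∧ not (does (h ≟ j))
    lookup-punctured i j = lookup∘tabulate λ h → nb i h ∧ not (does (h ≟ j))

    -- The constant tuple at j is lost, and it was counted because equal entries are permitted.
    punctured-smaller : ∀ i j → nb i j ≡ true → A (lookup (punctured i j)) < A (nb i)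
    punctured-smaller i j i~j = begin-strict
      A (lookup (punctured i j))
        <⟨ m<m+n (A (lookup (punctured i j))) at-j ⟩
      A (lookup (punctured i j)) + A (λ h → does (h ≟ j))
        ≤⟨ tuples-super r (lookup (punctured i j)) (λ h → does (h ≟ j)) (nb i) (closed F)
             (λ h → subst (λ b → ⟦ b ⟧ + ⟦ does (h ≟ j) ⟧ ≤ ⟦ nb i h ⟧) (sym (lookup-punctured i j h))
               (parts h (h ≟ j))) ⟩
      A (nb i) ∎
      where
      parts : ∀ h (d : Dec (h ≡ j)) → ⟦ nb i h ∧ not (does d) ⟧ + ⟦ does d ⟧ ≤ ⟦ nb i h ⟧
      parts h (yes refl) rewrite i~j = ≤-refl
      parts h (no _) with nb i h
      ... | true  = ≤-refl
      ... | false = ≤-refl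

      at-j : 0 < A (λ h → does (h ≟ j))
      at-j = subst₂ _≤_ (^-zeroˡ (suc r)) (trans (cong (_* A (λ h → does (h ≟ j))) (^-zeroˡ (suc r))) (*-identityˡ _))
        (tuples-product (suc r) (λ _ h → does (h ≟ j)) (closed F) 1 1
          (λ _ _ h h′ _ e e′ → subst₂ (λ a b → closed F a b ≡ true)
            (sym (does⁻ (h ≟ j) e)) (sym (does⁻ (h′ ≟ j) e′)) (closed-refl F j))
          (λ _ → ≤-trans (≤-trans (≤-reflexive (sym (sum-δ₁ j)))
            (card-mono λ h e → dec-true (h ≟ j) (sym (does⁻ (j ≟ h) e)))) (≤-reflexive (sym (*-identityˡ _)))))

    -- The count for the punctured set satisfies the bound of `legal⇒neighbourhood`. It cannot be a
    -- closed neighbourhood, because these share one exact count and the drop is strict.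
    punctured-illegal : ∀ i j → nb i j ≡ true → ¬ Legal (suc (suc p)) F (punctured i j)
    punctured-illegal i j i~j legal = absurd (legal⇒neighbourhood X legal
      (≤-trans (*-monoʳ-≤ K (*-monoʳ-≤ n (*-monoʳ-≤ N (<⇒≤ smaller)))) (neighbourhood-bound i)))
      where
      X = punctured i j

      smaller : A (lookup X) < A (nb i)
      smaller = punctured-smaller i j i~j

      absurd : ¬ IsNeighbourhood F X
      absurd (i′ , X≡) = <⇒≱ smaller (≤-trans (neighbourhoods-equal i i′)
        (tuples-mono (suc r) {As = λ _ → nb i′} (λ _ h e → trans (cong (λ Y → lookup Y h) X≡)
          (trans (lookup∘tabulate (nb i′) h) e)) (λ _ _ e → e)))

    -- The family φ has l - 2 members. Common non-neighbours of x and y in their parts contain an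
    -- independent transversal, and adding non-adjacent x and y would bring it to size l.
    far⇒family : ∀ (φ : Fin p → Fin m) → IndependentFamily F φ → ∀ x y →
      (∀ a → nb (τ x) (φ a) ≡ false) → (∀ a → nb (τ y) (φ a) ≡ false) →
      x ≢ y → ¬ ¬ (x ~[ G ] y)
    far⇒family φ ind x y x-far y-far x≢y x≁y = build (transversal F V G p φ ind
      (λ a → avoidsBoth x y (φ a)) (λ a z e → does⁻ (V z ≟ φ a) (∧-trueˡ e)) g
      (λ a → common x y (φ a) (x-far a) (y-far a)) spurious₀)
      where
      build : ¬ Σ (Fin p → Fin n) λ ψ → (∀ a → avoidsBoth x y (φ a) (ψ a) ≡ true) × IndependentFamily G ψ
      build (ψ , ψ∈ , ψ-ind) = <⇒≱ αG<l (family⇒≤α G (cons x (cons y ψ))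
        (family-cons G x (cons y ψ) x-away (family-cons G y ψ y-away ψ-ind)))
        where
        away : ∀ w a → not (adj G w (ψ a)) ∧ not (does (ψ a ≟ w)) ≡ true → ψ a ≢ w × ¬ (w ~[ G ] ψ a)
        away w a e = (λ ψa≡w → not-true (∧-trueʳ {not (adj G w (ψ a))} e) (dec-true (ψ a ≟ w) ψa≡w)) ,
          λ w~ → not-true (∧-trueˡ e) (dec-true (adj? G w (ψ a)) w~)

        y-away : ∀ a → ψ a ≢ y × ¬ (y ~[ G ] ψ a)
        y-away a = away y a (∧-trueʳ {not (adj G x (ψ a)) ∧ not (does (ψ a ≟ x))}
          (∧-trueʳ {fibre V (φ a) (ψ a)} (ψ∈ a)))

        x-away : ∀ a → cons y ψ a ≢ x × ¬ (x ~[ G ] cons y ψ a)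
        x-away zero    = ≢-sym x≢y , x≁y
        x-away (suc a) = away x a (∧-trueˡ (∧-trueʳ {fibre V (φ a) (ψ a)} (ψ∈ a)))

  joined : ∀ x y → x ≢ y → nb (τ x) (τ y) ≡ true → x ~[ G ] y
  joined x y x≢y i~j = decidable-stable (adj? G x y) λ x≁y →
    punctured-illegal i j i~j λ emb → embedded emb x≁y
    where
    i = τ x
    j = τ y

    -- The embedded set contains j: otherwise it would be independent together
    -- with i.  Replacing j by x and y contradicts α G < l.
    embedded : InducedAvoiding (edgeless (suc p)) F (punctured i j) → ¬ ¬ (x ~[ G ] y)
    embedded emb = locate (any? λ a → φ a ≟ j)
      where
      open InducedAvoiding emb

      φ-ind : IndependentFamily F φ
      φ-ind a b a≢b = (λ e → a≢b (injective e)) , λ φa~φb → Equivalence.from (induced a b) φa~φb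

      i-far : ∀ a → φ a ≢ j → nb i (φ a) ≡ false
      i-far a φa≢j = ≢true λ e → avoids a (lookup⇒[]= (φ a) (punctured i j)
        (trans (lookup-punctured i j (φ a)) (∧-true e (cong not (dec-false (φ a ≟ j) φa≢j)))))

      locate : Dec (∃[ a ] φ a ≡ j) → ¬ ¬ (x ~[ G ] y)
      locate (no missed-j) _ = <⇒≱ αF<l (family⇒≤α F (cons i φ) (family-cons F i φ
        (λ a → (λ e → true≢false (trans (cong (nb i) e) (closed-refl F i)) (far a))
             , λ i~φa → true≢false (closed⁺ F (inj₂ i~φa)) (far a)) φ-ind))
        where
        far : ∀ a → nb i (φ a) ≡ false
        far a = i-far a λ e → missed-j (a , e)
      locate (yes (a₀ , φa₀≡j)) = far⇒family (φ ∘ punchIn a₀)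
        (λ a b a≢b → φ-ind (punchIn a₀ a) (punchIn a₀ b) (a≢b ∘ punchIn-injective a₀ a b)) x y
        (λ a → i-far (punchIn a₀ a) λ e → proj₁ (φ-ind _ _ (punchInᵢ≢i a₀ a)) (trans e (sym φa₀≡j)))
        (λ a → ≢true λ e → j-far a (closed⁻ F e)) x≢y
        where
        j-far : ∀ a → ¬ (j ≡ φ (punchIn a₀ a) ⊎ j ~[ F ] φ (punchIn a₀ a))
        j-far a (inj₁ e) = proj₁ (φ-ind a₀ (punchIn a₀ a) (≢-sym (punchInᵢ≢i a₀ a))) (trans φa₀≡j e)
        j-far a (inj₂ e) = proj₂ (φ-ind a₀ (punchIn a₀ a) (≢-sym (punchInᵢ≢i a₀ a)))
          (subst (λ w → w ~[ F ] φ (punchIn a₀ a)) (sym φa₀≡j) e)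

  expansion⊆ : Σ (Partition n m) λ V′ → expansion F V′ ⊆ᴱ G
  expansion⊆ = τ , λ x y (x≢y , near) → joined x y x≢y (closed⁺ F near)

-- Choice of constants.

upperBound : ∀ xs → ∃[ b ] All (_≤ b) xs
upperBound []       = 0 , []
upperBound (x ∷ xs) with b , xs≤b ← upperBound xs =
  x ⊔ b , m≤m⊔n x b ∷ All.map (λ y≤b → ≤-trans y≤b (m≤n⊔m x b)) xs≤b

-- One half of n * n pays for the n diagonal pairs, the other for the edited edges, whose number is
-- at most C(n, 2) / (2 J + 1).
few-errors : ∀ J n Δ b → 2 * J ≤ n → suc (2 * J) * Δ ≤ n C 2 → b ≤ n + 2 * Δ → J * b ≤ n * n
few-errors J n Δ b 2J≤n JΔ≤ b≤ = *-cancelˡ-≤ 2 (begin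
  2 * (J * b)
    ≤⟨ *-monoʳ-≤ 2 (*-monoʳ-≤ J b≤) ⟩
  2 * (J * (n + 2 * Δ))
    ≡⟨ e J n Δ ⟩
  2 * J * n + 2 * (2 * J * Δ)
    ≤⟨ +-mono-≤ (*-monoˡ-≤ n 2J≤n) (≤-trans
         (*-monoʳ-≤ 2 (≤-trans (*-monoˡ-≤ Δ (n≤1+n (2 * J))) JΔ≤)) (2*nC2≤n² n)) ⟩
  n * n + n * n
    ≡⟨ cong (n * n +_) (+-identityʳ (n * n)) ⟨
  2 * (n * n) ∎)
  where
  open ≤-Reasoning
  e : ∀ J n Δ → 2 * (J * (n + 2 * Δ)) ≡ 2 * J * n + 2 * (2 * J * Δ)
  e = solve-∀

below : ∀ c b {J N} → 0 < N → suc c ≤ J → J * b ≤ N → c * b < N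
below c zero    0<N _ _    = ≤-<-trans (≤-reflexive (*-zeroʳ c)) 0<N
below c (suc b) _   c<J J≤ = <-≤-trans (*-monoˡ-< (suc b) (n<1+n c)) (≤-trans (*-monoˡ-≤ (suc b) c<J) J≤)

-- K has to beat the gap 1 / q, the number of parts, and the inverse density (8 m) ^ (k - 1) of
-- cliques among extra neighbours. J is measured against g ^ p and g ^ (p + 1), the inverse
-- densities of the tuples from which transversals are drawn.
record Constants (m r p q : ℕ) : Set where
  field
    K g J n₀ : ℕ
  D = m ^ suc r
  Q = 4 * K * D * suc r
  field
    K>2q : 2 * q < K
    K>m  : suc m < K
    K>8m : 2 * (8 * m) ^ suc r < K
    g≥Qm : 2 * Q * m ≤ g
    g≥8m : 8 * m ≤ g
    J≥₁  : 4 * K * D * (suc r * suc r) ≤ J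
    J≥₂  : 2 * m * Q ≤ J
    J≥₃  : suc (suc p * suc p * g ^ suc p) ≤ J
    J≥₄  : suc (p * p * g ^ p) ≤ J
    n₀≥1  : 1 ≤ n₀
    n₀≥2J : 2 * J ≤ n₀
    n₀≥kk : 2 * (suc (suc r) * suc (suc r)) ≤ n₀
    n₀≥r! : 4 * K * D * (suc r) ! ≤ n₀
    n₀≥rm : 4 * K * D * (suc r * m) ≤ n₀
    n₀≥Q  : 2 * Q ≤ n₀
    n₀≥m  : 24 * m ≤ n₀
    n₀≥km : 2 * (suc (suc r) * m) ≤ n₀
    n₀≥KD : 2 * K * (m * D) * (suc (suc r) * m) ≤ n₀

constants : ∀ m r p q → Constants m r p q
constants m r p q = with-K (upperBound (suc (2 * q) ∷ suc (suc m) ∷ suc (2 * (8 * m) ^ suc r) ∷ []))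
  where
  D = m ^ suc r

  with-K : ∃[ K ] All (_≤ K) (suc (2 * q) ∷ suc (suc m) ∷ suc (2 * (8 * m) ^ suc r) ∷ []) →
    Constants m r p q
  with-K (K , K>2q ∷ K>m ∷ K>8m ∷ []) = with-g (upperBound (2 * Q * m ∷ 8 * m ∷ []))
    where
    Q = 4 * K * D * suc r

    with-g : ∃[ g ] All (_≤ g) (2 * Q * m ∷ 8 * m ∷ []) → Constants m r p q
    with-g (g , g≥Qm ∷ g≥8m ∷ []) = with-J (upperBound _)
      where
      with-J : ∃[ J ] All (_≤ J) (4 * K * D * (suc r * suc r) ∷ 2 * m * Q ∷
        suc (suc p * suc p * g ^ suc p) ∷ suc (p * p * g ^ p) ∷ []) → Constants m r p q
      with-J (J , J≥₁ ∷ J≥₂ ∷ J≥₃ ∷ J≥₄ ∷ []) = with-n₀ (upperBound _)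
        where
        with-n₀ : ∃[ n₀ ] All (_≤ n₀) (1 ∷ 2 * J ∷ 2 * (suc (suc r) * suc (suc r)) ∷
          4 * K * D * (suc r) ! ∷ 4 * K * D * (suc r * m) ∷ 2 * Q ∷ 24 * m ∷
          2 * (suc (suc r) * m) ∷ 2 * K * (m * D) * (suc (suc r) * m) ∷ []) → Constants m r p q
        with-n₀ (n₀ , n₁ ∷ n₂ ∷ n₃ ∷ n₄ ∷ n₅ ∷ n₆ ∷ n₇ ∷ n₈ ∷ n₉ ∷ []) = record
          { K = K ; g = g ; J = J ; n₀ = n₀
          ; K>2q = K>2q ; K>m = K>m ; K>8m = K>8m ; g≥Qm = g≥Qm ; g≥8m = g≥8m
          ; J≥₁ = J≥₁ ; J≥₂ = J≥₂ ; J≥₃ = J≥₃ ; J≥₄ = J≥₄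
          ; n₀≥1 = n₁ ; n₀≥2J = n₂ ; n₀≥kk = n₃ ; n₀≥r! = n₄ ; n₀≥rm = n₅ ; n₀≥Q = n₆
          ; n₀≥m = n₇ ; n₀≥km = n₈ ; n₀≥KD = n₉ }

theorem19 : (k l : ℕ) → 2 ≤ k → 2 ≤ l →
    (m : ℕ) (F : Graph m) → IsStabilityGraph k l F → IsStrict k l F →
    ∃[ n₀ ] ((n : ℕ) → n₀ ≤ n → (G : Graph n) → α G < l → P k G ≡ f n k l →
    Σ (Partition n m) λ V → expansion F V ⊆ᴱ G)
theorem19 (suc (suc r)) (suc (suc p)) (s≤s (s≤s z≤n)) 2≤l@(s≤s (s≤s z≤n)) m F stability strict =
  conclude (strict-uniform k l F strict)
  where
  k = suc (suc r)
  l = suc (suc p)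

  Conclusion : Set₁
  Conclusion = ∃[ n₀ ] ((n : ℕ) → n₀ ≤ n → (G : Graph n) → α G < l → P k G ≡ f n k l →
    Σ (Partition n m) λ V → expansion F V ⊆ᴱ G)

  Gaps : ℕ → Set
  Gaps M = ∀ X → Legal l F X → ¬ IsNeighbourhood F X →
    ∀ n → M ≤ n → c k l n ℚ.+ 1 ÷ suc M ℚ.≤ grad k F X

  with-constants : ∀ M → Gaps M → Constants m r p (suc M) → Conclusion
  -- Stability is invoked with ε = 1 / (2 J + 1), the edit distance that `few-errors` asks for.
  with-constants M gaps cs = finish (IsStabilityGraph.stable stability (1 ÷ suc (2 * J)) (1÷-positive (2 * J)))
    where
    open Constants cs

    ClosePartition : ∀ {n} → Graph n → Set
    ClosePartition {n} G = Σ (Partition n m) λ V → Balanced V ×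
      fromℕ (∣E expansion F V △E G ∣) ℚ.≤ (1 ÷ suc (2 * J)) ℚ.* fromℕ (n C 2)

    from-close : ∀ n → n₀ ≤ n → k ≤ n → M ≤ n → (G : Graph n) → α G < l → P k G ≡ f n k l →
      ClosePartition G → Σ (Partition n m) λ V → expansion F V ⊆ᴱ G
    from-close n n₀≤n k≤n M≤n G αG<l extremal (V , balanced , few) = Setup.expansion⊆ setup
      where
      0<n : 0 < n
      0<n = ≤-trans n₀≥1 n₀≤n

      -- An F without vertices is excluded by the partition: a vertex of G must lie in some part.
      0<m : 0 < m
      0<m = inhabited n V 0<n
        where
        inhabited : ∀ n {m} → (Fin n → Fin m) → 0 < n → 0 < m
        inhabited (suc n) {zero}  V _ with () ← V zero
        inhabited (suc n) {suc m} V _ = s≤s z≤n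

      Δ = ∣E expansion F V △E G ∣

      errors : ∀ b → b ≤ n + 2 * Δ → J * b ≤ n * n
      errors b = few-errors J n Δ b (≤-trans n₀≥2J n₀≤n) (fromℕ-≤ {Δ} {2 * J} {n C 2} few)

      J-missing : J * missing F V G ≤ n * n
      J-missing = errors (missing F V G) (missing-≤ F V G)

      J-spurious : J * spurious F V G ≤ n * n
      J-spurious = errors (spurious F V G) (spurious-≤ F V G)

      0<n² : 0 < n * n
      0<n² = *-mono-≤ 0<n 0<n

      setup : Setup r p F G V (suc M) K g
      setup = record
        { 0<n = 0<n
        ; 0<m = 0<m
        ; αF<l = IsStabilityGraph.α<l stability
        ; αG<l = αG<l
        ; extremal = extremal
        ; balanced = balanced
        ; gap = λ X legal ¬nbhd → subst
            (λ a → (f n k l * suc M + (n C k)) * D ≤ a * ((n C k) * suc M))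
            (count-goodTuple (suc r) F X)
            (÷-gap {f n k l} {n C k} {M} {count (goodTuple? F X) (vectors (List.allFin m) (suc r))} {D}
              (C-positive n k k≤n) (m^n>0 m {{>-nonZero 0<m}} (suc r)) (gaps X legal ¬nbhd n M≤n))
        ; K>2q = K>2q
        ; K>m  = K>m
        ; K>8m = K>8m
        ; g≥Qm = g≥Qm
        ; g≥8m = g≥8m
        ; n≥kk = ≤-trans n₀≥kk n₀≤n
        ; n≥r! = ≤-trans n₀≥r! n₀≤n
        ; n≥rm = ≤-trans n₀≥rm n₀≤n
        ; n≥Q  = ≤-trans n₀≥Q n₀≤n
        ; n≥m  = ≤-trans n₀≥m n₀≤n
        ; n≥km = ≤-trans n₀≥km n₀≤n
        ; n≥KD = ≤-trans n₀≥KD n₀≤n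
        ; missing₁ = ≤-trans (*-monoˡ-≤ (missing F V G) J≥₁) J-missing
        ; missing₂ = ≤-trans (*-monoˡ-≤ (missing F V G) J≥₂) J-missing
        ; spurious₁ = below (suc p * suc p * g ^ suc p) (spurious F V G) 0<n² J≥₃ J-spurious
        ; spurious₀ = below (p * p * g ^ p) (spurious F V G) 0<n² J≥₄ J-spurious
        }

    finish : ∃[ n₁ ] ∃[ δ ] (ℚ.0ℚ ℚ.< δ × (∀ n → n₁ ≤ n → (G : Graph n) → α G < l →
      const (density k G) ≤lim c k l ⊕ const δ → ClosePartition G)) → Conclusion
    finish (n₁ , δ , 0<δ , close) = all-bounds (upperBound (n₀ ∷ k ∷ M ∷ n₁ ∷ []))
      where
      all-bounds : ∃[ b ] All (_≤ b) (n₀ ∷ k ∷ M ∷ n₁ ∷ []) → Conclusion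
      all-bounds (b , n₀≤b ∷ k≤b ∷ M≤b ∷ n₁≤b ∷ []) = b , λ n b≤n G αG<l extremal →
        from-close n (≤-trans n₀≤b b≤n) (≤-trans k≤b b≤n) (≤-trans M≤b b≤n) G αG<l extremal
          (close n (≤-trans n₁≤b b≤n) G αG<l
            (extremal-density (suc r) l G 2≤l (≤-trans k≤b b≤n) extremal δ 0<δ))

  conclude : ∃[ M ] Gaps M → Conclusion
  -- The uniform gap is 1 / (M + 1), whence q = M + 1.
  conclude (M , gaps) = with-constants M gaps (constants m r p (suc M))
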